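{- For $n\ge 1$ let $c_n$ be the number of level one cheesy polyominoes (on the hexagonal tiling, counted up to translation) having exactly $n$ cells. Then there exist real constants $\kappa$ and $\lambda$, with decimal expansions $\kappa=0.144176\ldots$ and $\lambda=4.114907\ldots$ (i.e. $0.144176\le\kappa<0.144177$ and $4.114907\le\lambda<4.114908$), such that $$c_n\sim \kappa\,\lambda^n\qquad (n\to\infty),$$ i.e. $\lim_{n\to\infty} c_n/(\kappa\lambda^n)=1$.
   Context: Consider the regular hexagonal tiling of the Euclidean plane, oriented so that every hexagonal tile has two horizontal edges; tiles are called cells. A (hexagonal-celled) polyomino is a union of finitely many (at least one) cells whose interior is connected (for unions of hexagonal cells, this is equivalent to the union being connected). Two polyominoes are considered equal if and only if one is the image of the other under a translation. The cells of a polyomino $P$ are partitioned according to their horizontal projection (cells with the same projection onto the horizontal axis lie in the same block); each block is a column of $P$. Cells of the tiling with the same horizontal projection are stacked vertically, consecutive ones sharing a horizontal edge. A column need not be a connected set; its connected components are its maximal runs of vertically consecutive cells. If a column has two connected components, the gap (hole) between them is the set of cells of the tiling lying in that vertical stack strictly between the two components. Columns are ordered from left to right; the first column is the leftmost one, and two columns are adjacent if they are consecutive in this order. A polyomino $P$ is rightward-semi-directed if the first (leftmost) column of $P$ has no gap (i.e. is connected) and, in every pair of adjacent columns of $P$, every connected component of the right column has at least one edge in common with the left column. For an integer $m\ge 1$, a polyomino $P$ is a level $m$ cheesy polyomino if: (i) $P$ is rightward-semi-directed; (ii) every column of $P$ has at most two connected components; (iii) if a column of $P$ has two connected components, then the gap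 between the components consists of at most $m$ cells. -}

module Defs where

open import Level using (0ℓ)
open import Data.Nat as ℕ using (ℕ; zero; suc)
import Data.Nat.Properties as ℕ
open import Data.Integer as ℤ using (ℤ; +_; 0ℤ; 1ℤ)
import Data.Integer.Properties as ℤ
open import Data.Rational as ℚ using (ℚ; 0ℚ; 1ℚ; ½; _⊔_; ∣_∣; Positive; positive)
import Data.Rational.Properties as ℚ
open import Data.Rational.Solver using (module +-*-Solver)
open import Data.Fin using (Fin)
open import Data.List using (List; []; _∷_; length)
open import Data.List.Membership.Propositional using (_∈_; _∉_)
open import Data.List.Relation.Unary.Unique.Propositional using (Unique)
open import Data.Product using (∃-syntax; _×_; _,_; proj₁; proj₂)
open import Data.Sum using (_⊎_; inj₁; inj₂)
open import Function.Bundles using (Bijection; _⇔_; mk⇔; Equivalence)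
open import Relation.Nullary using (¬_)
open import Relation.Binary.Bundles using (Setoid)
open import Relation.Binary.Construct.Closure.ReflexiveTransitive using (Star)
open import Relation.Binary.PropositionalEquality

-- The cell (x , y) is the hexagon (of side 1, with two horizontal edges)
-- centred at (3x/2 , √3 (y - x/2)).  Thus x determines the horizontal
-- projection, y the height within the vertical stack, and the translations
-- preserving the tiling are exactly the translations of ℤ × ℤ.

Cell : Set
Cell = ℤ × ℤ

neighbours : Cell → List Cell
neighbours (x , y) =
    (x , y ℤ.+ 1ℤ)
  ∷ (x , y ℤ.- 1ℤ)
  ∷ (x ℤ.+ 1ℤ , y)
  ∷ (x ℤ.+ 1ℤ , y ℤ.+ 1ℤ)
  ∷ (x ℤ.- 1ℤ , y)
  ∷ (x ℤ.- 1ℤ , y ℤ.- 1ℤ)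
  ∷ []

ShareEdge : Cell → Cell → Set
ShareEdge c d = d ∈ neighbours c

translate : ℤ × ℤ → Cell → Cell
translate (u , v) (x , y) = (u ℤ.+ x , v ℤ.+ y)

-- The interior of a union of cells is connected iff any two of its cells are
-- joined by a path of cells in which consecutive cells share an edge.

Connected : List Cell → Set
Connected P = ∀ {c d} → c ∈ P → d ∈ P →
              Star (λ a b → ShareEdge a b × b ∈ P) c d

record Polyomino : Set where
  field
    cells     : List Cell
    unique    : Unique cells
    nonEmpty  : ∃[ c ] c ∈ cells
    connected : Connected cells

  size : ℕ
  size = length cells

open Polyomino public using (cells; size)

_∈ₚ_ _∉ₚ_ : Cell → Polyomino → Set
c ∈ₚ P = c ∈ cells P
c ∉ₚ P = c ∉ cells P

-- Equality up to translation.  The order in which cells are listed is ignored.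

_≈ₚ_ : Polyomino → Polyomino → Set
P ≈ₚ Q = ∃[ t ] (∀ c → c ∈ₚ P ⇔ translate t c ∈ₚ Q)

IsColumn : Polyomino → ℤ → Set
IsColumn P x = ∃[ y ] (x , y) ∈ₚ P

IsFirstColumn : Polyomino → ℤ → Set
IsFirstColumn P x = IsColumn P x × (∀ x′ → IsColumn P x′ → x ℤ.≤ x′)

AdjacentColumns : Polyomino → ℤ → ℤ → Set
AdjacentColumns P x x′ =
  IsColumn P x × IsColumn P x′ × x ℤ.< x′ ×
  (∀ x″ → x ℤ.< x″ → x″ ℤ.< x′ → ¬ IsColumn P x″)

-- A maximal run of vertically consecutive cells, given by the heights of its
-- bottom and top cells.

record IsComponent (P : Polyomino) (x bottom top : ℤ) : Set where
  field
    bottom≤top : bottom ℤ.≤ top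
    filled     : ∀ y → bottom ℤ.≤ y → y ℤ.≤ top → (x , y) ∈ₚ P
    below∉     : (x , bottom ℤ.- 1ℤ) ∉ₚ P
    above∉     : (x , top ℤ.+ 1ℤ) ∉ₚ P

record Component (P : Polyomino) (x : ℤ) : Set where
  field
    bottom top  : ℤ
    isComponent : IsComponent P x bottom top

open Component public using (bottom; top)

SameComponent : ∀ {P x} → Component P x → Component P x → Set
SameComponent C D = bottom C ≡ bottom D × top C ≡ top D

NoGap : Polyomino → ℤ → Set
NoGap P x = (C D : Component P x) → SameComponent C D

AtMostTwoComponents : Polyomino → ℤ → Set
AtMostTwoComponents P x =
  (C D E : Component P x) →
  SameComponent C D ⊎ SameComponent C E ⊎ SameComponent D E

-- Two distinct components C, D of a column, with C below D; when the column
-- has only these two components, the gap consists of the cells at heights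
-- top C + 1, …, bottom D - 1.

gapSize : ∀ {P x} → Component P x → Component P x → ℤ
gapSize C D = bottom D ℤ.- top C ℤ.- 1ℤ

GapsAtMost : ℕ → Polyomino → ℤ → Set
GapsAtMost m P x =
  (C D : Component P x) → top C ℤ.< bottom D → gapSize C D ℤ.≤ + m

TouchesColumn : ∀ P x {x′} → Component P x′ → Set
TouchesColumn P x {x′} C =
  ∃[ y ] ∃[ y′ ] ((x , y) ∈ₚ P × bottom C ℤ.≤ y′ × y′ ℤ.≤ top C ×
                  ShareEdge (x , y) (x′ , y′))

record RightwardSemiDirected (P : Polyomino) : Set where
  field
    firstColumn     : ∀ x → IsFirstColumn P x → NoGap P x
    adjacentColumns : ∀ x x′ → AdjacentColumns P x x′ →
                      (C : Component P x′) → TouchesColumn P x C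

record IsCheesy (m : ℕ) (P : Polyomino) : Set where
  field
    rightwardSemiDirected : RightwardSemiDirected P
    atMostTwoComponents   : ∀ x → IsColumn P x → AtMostTwoComponents P x
    gapsAtMost            : ∀ x → IsColumn P x → GapsAtMost m P x

record CheesyPolyomino (m n : ℕ) : Set where
  field
    polyomino : Polyomino
    isCheesy  : IsCheesy m polyomino
    size≡n    : size polyomino ≡ n

open CheesyPolyomino public using (polyomino)

private
  translate-0 : ∀ c → translate (0ℤ , 0ℤ) c ≡ c
  translate-0 (x , y) = cong₂ _,_ (ℤ.+-identityˡ x) (ℤ.+-identityˡ y)

  translate-+ : ∀ s t c →
    translate s (translate t c) ≡ translate (translate s t) c
  translate-+ (u , v) (u′ , v′) (x , y) =
    cong₂ _,_ (sym (ℤ.+-assoc u u′ x)) (sym (ℤ.+-assoc v v′ y))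

  inverse : ℤ × ℤ → ℤ × ℤ
  inverse (u , v) = (ℤ.- u , ℤ.- v)

  translate-inverseʳ : ∀ t c → translate t (translate (inverse t) c) ≡ c
  translate-inverseʳ t@(u , v) c =
    trans (translate-+ t (inverse t) c)
      (trans (cong₂ (λ a b → translate (a , b) c)
                    (ℤ.+-inverseʳ u) (ℤ.+-inverseʳ v))
             (translate-0 c))

  ≈ₚ-refl : ∀ P → P ≈ₚ P
  ≈ₚ-refl P = (0ℤ , 0ℤ) , λ c →
    mk⇔ (subst (_∈ₚ P) (sym (translate-0 c))) (subst (_∈ₚ P) (translate-0 c))

  ≈ₚ-sym : ∀ P Q → P ≈ₚ Q → Q ≈ₚ P
  ≈ₚ-sym P Q (t , f) = inverse t , λ c →
    let module F = Equivalence (f (translate (inverse t) c))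
        eq = translate-inverseʳ t c
    in mk⇔ (λ c∈Q → F.from (subst (_∈ₚ Q) (sym eq) c∈Q))
           (λ d∈P → subst (_∈ₚ Q) eq (F.to d∈P))

  ≈ₚ-trans : ∀ P Q R → P ≈ₚ Q → Q ≈ₚ R → P ≈ₚ R
  ≈ₚ-trans P Q R (s , f) (t , g) = translate t s , λ c →
    let module F = Equivalence (f c)
        module G = Equivalence (g (translate s c))
        eq = translate-+ t s c
    in mk⇔ (λ c∈P → subst (_∈ₚ R) eq (G.to (F.to c∈P)))
           (λ d∈R → F.from (G.from (subst (_∈ₚ R) (sym eq) d∈R)))

cheesySetoid : (m n : ℕ) → Setoid 0ℓ 0ℓ
cheesySetoid m n = record
  { Carrier       = CheesyPolyomino m n
  ; _≈_           = λ P Q → polyomino P ≈ₚ polyomino Q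
  ; isEquivalence = record
    { refl  = λ {P} → ≈ₚ-refl (polyomino P)
    ; sym   = λ {P} {Q} → ≈ₚ-sym (polyomino P) (polyomino Q)
    ; trans = λ {P} {Q} {R} →
        ≈ₚ-trans (polyomino P) (polyomino Q) (polyomino R)
    }
  }

HasCardinality : Setoid 0ℓ 0ℓ → ℕ → Set
HasCardinality S k = Bijection (setoid (Fin k)) S

-- A real is represented by a Cauchy sequence of rationals.  Different sequences
-- may represent the same real; the order and limit notions below respect this.

IsCauchy : (ℕ → ℚ) → Set
IsCauchy x = ∀ ε → 0ℚ ℚ.< ε →
  ∃[ N ] (∀ m n → N ℕ.≤ m → N ℕ.≤ n → ∣ x m ℚ.- x n ∣ ℚ.≤ ε)

record ℝ : Set where
  constructor _,ᴿ_
  field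
    seq    : ℕ → ℚ
    cauchy : IsCauchy seq

open ℝ public

infix  4 _<ᴿ_ _≤ᴿ_
infixl 6 _+ᴿ_ _-ᴿ_
infixl 7 _*ᴿ_
infixr 8 _^ᴿ_
infix  8 -ᴿ_

_<ᴿ_ : ℝ → ℝ → Set
x <ᴿ y = ∃[ ε ] (0ℚ ℚ.< ε ×
  ∃[ N ] (∀ n → N ℕ.≤ n → seq x n ℚ.+ ε ℚ.≤ seq y n))

_≤ᴿ_ : ℝ → ℝ → Set
x ≤ᴿ y = ∀ ε → 0ℚ ℚ.< ε →
  ∃[ N ] (∀ n → N ℕ.≤ n → seq x n ℚ.≤ seq y n ℚ.+ ε)

private
  open +-*-Solver

  <⇒pos : ∀ {p} → 0ℚ ℚ.< p → Positive p
  <⇒pos = positive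

  pos⇒< : ∀ p → .{{Positive p}} → 0ℚ ℚ.< p
  pos⇒< p = ℚ.positive⁻¹ p

  *-pos : ∀ {p q} → 0ℚ ℚ.< p → 0ℚ ℚ.< q → 0ℚ ℚ.< p ℚ.* q
  *-pos {p} {q} 0<p 0<q =
    pos⇒< (p ℚ.* q) {{ℚ.pos*pos⇒pos p {{<⇒pos 0<p}} q {{<⇒pos 0<q}}}}

  1/_[_] : ∀ p → 0ℚ ℚ.< p → ℚ
  1/ p [ 0<p ] = ℚ.1/_ p {{ℚ.pos⇒nonZero p {{<⇒pos 0<p}}}}

  1/-pos : ∀ p 0<p → 0ℚ ℚ.< 1/ p [ 0<p ]
  1/-pos p 0<p = pos⇒< 1/ p [ 0<p ] {{ℚ.1/pos⇒pos p {{<⇒pos 0<p}}}}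

  1/-inverse : ∀ p 0<p → p ℚ.* 1/ p [ 0<p ] ≡ 1ℚ
  1/-inverse p 0<p = ℚ.*-inverseʳ p {{ℚ.pos⇒nonZero p {{<⇒pos 0<p}}}}

  *-mono-≤ : ∀ {p q r s} → 0ℚ ℚ.≤ r → 0ℚ ℚ.≤ q → p ℚ.≤ q → r ℚ.≤ s →
             p ℚ.* r ℚ.≤ q ℚ.* s
  *-mono-≤ {p} {q} {r} {s} 0≤r 0≤q p≤q r≤s = ℚ.≤-trans
    (ℚ.*-monoʳ-≤-nonNeg r {{ℚ.nonNegative 0≤r}} p≤q)
    (ℚ.*-monoˡ-≤-nonNeg q {{ℚ.nonNegative 0≤q}} r≤s)

  half+half : ∀ p → ½ ℚ.* p ℚ.+ ½ ℚ.* p ≡ p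
  half+half p = trans (sym (ℚ.*-distribʳ-+ p ½ ½)) (ℚ.*-identityˡ p)

  0<½ : 0ℚ ℚ.< ½
  0<½ = pos⇒< ½

  ∣p∣≤∣q∣+∣p-q∣ : ∀ p q → ∣ p ∣ ℚ.≤ ∣ q ∣ ℚ.+ ∣ p ℚ.- q ∣
  ∣p∣≤∣q∣+∣p-q∣ p q = subst (λ z → ∣ z ∣ ℚ.≤ ∣ q ∣ ℚ.+ ∣ p ℚ.- q ∣)
    (solve 2 (λ a b → b :+ (a :- b) := a) refl p q)
    (ℚ.∣p+q∣≤∣p∣+∣q∣ q (p ℚ.- q))

  ∣p-q∣≡∣q-p∣ : ∀ p q → ∣ p ℚ.- q ∣ ≡ ∣ q ℚ.- p ∣
  ∣p-q∣≡∣q-p∣ p q = trans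
    (cong ∣_∣ (solve 2 (λ a b → a :- b := :- (b :- a)) refl p q))
    (ℚ.∣-p∣≡∣p∣ (q ℚ.- p))

  p≤r+q⇒p-r≤q : ∀ {p q r} → p ℚ.≤ r ℚ.+ q → p ℚ.- r ℚ.≤ q
  p≤r+q⇒p-r≤q {p} {q} {r} le = subst (p ℚ.- r ℚ.≤_)
    (solve 2 (λ a b → (a :+ b) :- a := b) refl r q)
    (ℚ.+-monoˡ-≤ (ℚ.- r) le)

  ∣∣-lub : ∀ {p q} → p ℚ.≤ q → ℚ.- p ℚ.≤ q → ∣ p ∣ ℚ.≤ q
  ∣∣-lub {p} p≤q -p≤q with ℚ.∣p∣≡p∨∣p∣≡-p p
  ... | inj₁ eq = subst (ℚ._≤ _) (sym eq) p≤q
  ... | inj₂ eq = subst (ℚ._≤ _) (sym eq) -p≤q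

  +-cauchy : ∀ x y → IsCauchy (λ n → seq x n ℚ.+ seq y n)
  +-cauchy x y ε 0<ε
    with cauchy x (½ ℚ.* ε) (*-pos 0<½ 0<ε)
       | cauchy y (½ ℚ.* ε) (*-pos 0<½ 0<ε)
  ... | N , p | M , q = N ℕ.⊔ M , λ m n N⊔M≤m N⊔M≤n →
    let xm = seq x m; xn = seq x n; ym = seq y m; yn = seq y n in
    begin
      ∣ (xm ℚ.+ ym) ℚ.- (xn ℚ.+ yn) ∣
        ≡⟨ cong ∣_∣ (solve 4 (λ a b c d →
             (a :+ b) :- (c :+ d) := (a :- c) :+ (b :- d)) refl xm ym xn yn) ⟩
      ∣ (xm ℚ.- xn) ℚ.+ (ym ℚ.- yn) ∣
        ≤⟨ ℚ.∣p+q∣≤∣p∣+∣q∣ (xm ℚ.- xn) (ym ℚ.- yn) ⟩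
      ∣ xm ℚ.- xn ∣ ℚ.+ ∣ ym ℚ.- yn ∣
        ≤⟨ ℚ.+-mono-≤
             (p m n (ℕ.m⊔n≤o⇒m≤o N M N⊔M≤m) (ℕ.m⊔n≤o⇒m≤o N M N⊔M≤n))
             (q m n (ℕ.m⊔n≤o⇒n≤o N M N⊔M≤m) (ℕ.m⊔n≤o⇒n≤o N M N⊔M≤n)) ⟩
      ½ ℚ.* ε ℚ.+ ½ ℚ.* ε
        ≡⟨ half+half ε ⟩
      ε ∎
    where open ℚ.≤-Reasoning

  neg-cauchy : ∀ x → IsCauchy (λ n → ℚ.- seq x n)
  neg-cauchy x ε 0<ε with cauchy x ε 0<ε
  ... | N , p = N , λ m n N≤m N≤n → subst (ℚ._≤ ε)
    (trans (∣p-q∣≡∣q-p∣ (seq x m) (seq x n))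
      (cong ∣_∣ (solve 2 (λ a b → b :- a := (:- a) :- (:- b)) refl
        (seq x m) (seq x n))))
    (p m n N≤m N≤n)

  abs-cauchy : ∀ x → IsCauchy (λ n → ∣ seq x n ∣)
  abs-cauchy x ε 0<ε with cauchy x ε 0<ε
  ... | N , p = N , λ m n N≤m N≤n →
    let xm = seq x m; xn = seq x n in ℚ.≤-trans
      (∣∣-lub
        (p≤r+q⇒p-r≤q (∣p∣≤∣q∣+∣p-q∣ xm xn))
        (subst₂ ℚ._≤_
          (solve 2 (λ a b → b :- a := :- (a :- b)) refl ∣ xm ∣ ∣ xn ∣)
          (∣p-q∣≡∣q-p∣ xn xm)
          (p≤r+q⇒p-r≤q (∣p∣≤∣q∣+∣p-q∣ xn xm))))
      (p m n N≤m N≤n)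

  EventuallyBounded : ℝ → Set
  EventuallyBounded x = ∃[ B ] (0ℚ ℚ.< B ×
    ∃[ N ] (∀ n → N ℕ.≤ n → ∣ seq x n ∣ ℚ.≤ B))

  bounded : ∀ x → EventuallyBounded x
  bounded x with cauchy x 1ℚ (pos⇒< 1ℚ)
  ... | N , p = ∣ seq x N ∣ ℚ.+ 1ℚ
    , ℚ.+-mono-≤-< (ℚ.0≤∣p∣ (seq x N)) (pos⇒< 1ℚ)
    , N , λ n N≤n → ℚ.≤-trans
        (∣p∣≤∣q∣+∣p-q∣ (seq x n) (seq x N))
        (ℚ.+-monoʳ-≤ ∣ seq x N ∣ (p n N N≤n ℕ.≤-refl))

  *-distance : ∀ A B i ε p q r s → 0ℚ ℚ.< A → 0ℚ ℚ.< B →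
    (A ℚ.+ B) ℚ.* i ≡ 1ℚ → ∣ p ∣ ℚ.≤ A → ∣ s ∣ ℚ.≤ B →
    ∣ p ℚ.- r ∣ ℚ.≤ i ℚ.* ε → ∣ q ℚ.- s ∣ ℚ.≤ i ℚ.* ε →
    ∣ p ℚ.* q ℚ.- r ℚ.* s ∣ ℚ.≤ ε
  *-distance A B i ε p q r s 0<A 0<B inv p≤A s≤B dp dq = begin
    ∣ p ℚ.* q ℚ.- r ℚ.* s ∣
      ≡⟨ cong ∣_∣ (solve 4 (λ a b c d → a :* b :- c :* d
           := a :* (b :- d) :+ d :* (a :- c)) refl p q r s) ⟩
    ∣ p ℚ.* (q ℚ.- s) ℚ.+ s ℚ.* (p ℚ.- r) ∣
      ≤⟨ ℚ.∣p+q∣≤∣p∣+∣q∣ (p ℚ.* (q ℚ.- s)) (s ℚ.* (p ℚ.- r)) ⟩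
    ∣ p ℚ.* (q ℚ.- s) ∣ ℚ.+ ∣ s ℚ.* (p ℚ.- r) ∣
      ≡⟨ cong₂ ℚ._+_ (ℚ.∣p*q∣≡∣p∣*∣q∣ p (q ℚ.- s))
                     (ℚ.∣p*q∣≡∣p∣*∣q∣ s (p ℚ.- r)) ⟩
    ∣ p ∣ ℚ.* ∣ q ℚ.- s ∣ ℚ.+ ∣ s ∣ ℚ.* ∣ p ℚ.- r ∣
      ≤⟨ ℚ.+-mono-≤
           (*-mono-≤ (ℚ.0≤∣p∣ (q ℚ.- s)) (ℚ.<⇒≤ 0<A) p≤A dq)
           (*-mono-≤ (ℚ.0≤∣p∣ (p ℚ.- r)) (ℚ.<⇒≤ 0<B) s≤B dp) ⟩
    A ℚ.* (i ℚ.* ε) ℚ.+ B ℚ.* (i ℚ.* ε)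
      ≡⟨ solve 4 (λ a b j e → a :* (j :* e) :+ b :* (j :* e)
           := ((a :+ b) :* j) :* e) refl A B i ε ⟩
    ((A ℚ.+ B) ℚ.* i) ℚ.* ε
      ≡⟨ cong (ℚ._* ε) inv ⟩
    1ℚ ℚ.* ε
      ≡⟨ ℚ.*-identityˡ ε ⟩
    ε ∎
    where open ℚ.≤-Reasoning

  *-cauchy : ∀ x y → IsCauchy (λ n → seq x n ℚ.* seq y n)
  *-cauchy x y ε 0<ε = *-cauchy′ (bounded x) (bounded y)
    where
    *-cauchy′ : EventuallyBounded x → EventuallyBounded y →
      ∃[ N ] (∀ m n → N ℕ.≤ m → N ℕ.≤ n →
      ∣ seq x m ℚ.* seq y m ℚ.- seq x n ℚ.* seq y n ∣ ℚ.≤ ε)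
    *-cauchy′ (A , 0<A , K , p) (B , 0<B , L , q) =
      (K ℕ.⊔ L) ℕ.⊔ (M ℕ.⊔ N) , λ m n ≤m ≤n →
        *-distance A B i ε (seq x m) (seq y m) (seq x n) (seq y n) 0<A 0<B
          (1/-inverse (A ℚ.+ B) 0<A+B)
          (p m (ℕ.m⊔n≤o⇒m≤o K L (ℕ.m⊔n≤o⇒m≤o (K ℕ.⊔ L) (M ℕ.⊔ N) ≤m)))
          (q n (ℕ.m⊔n≤o⇒n≤o K L (ℕ.m⊔n≤o⇒m≤o (K ℕ.⊔ L) (M ℕ.⊔ N) ≤n)))
          (proj₂ cx m n (M≤ ≤m) (M≤ ≤n))
          (proj₂ cy m n (N≤ ≤m) (N≤ ≤n))
      where
      0<A+B = ℚ.+-mono-< 0<A 0<B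
      i     = 1/ A ℚ.+ B [ 0<A+B ]
      0<iε  = *-pos (1/-pos (A ℚ.+ B) 0<A+B) 0<ε
      cx    = cauchy x (i ℚ.* ε) 0<iε
      cy    = cauchy y (i ℚ.* ε) 0<iε
      M     = proj₁ cx
      N     = proj₁ cy
      M≤ : ∀ {k} → (K ℕ.⊔ L) ℕ.⊔ (M ℕ.⊔ N) ℕ.≤ k → M ℕ.≤ k
      M≤ le = ℕ.m⊔n≤o⇒m≤o M N (ℕ.m⊔n≤o⇒n≤o (K ℕ.⊔ L) (M ℕ.⊔ N) le)
      N≤ : ∀ {k} → (K ℕ.⊔ L) ℕ.⊔ (M ℕ.⊔ N) ℕ.≤ k → N ℕ.≤ k
      N≤ le = ℕ.m⊔n≤o⇒n≤o M N (ℕ.m⊔n≤o⇒n≤o (K ℕ.⊔ L) (M ℕ.⊔ N) le)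

fromℚ : ℚ → ℝ
fromℚ q = (λ _ → q) ,ᴿ λ ε 0<ε → 0 , λ _ _ _ _ →
  subst (λ z → ∣ z ∣ ℚ.≤ ε) (sym (ℚ.+-inverseʳ q)) (ℚ.<⇒≤ 0<ε)

fromℕ : ℕ → ℝ
fromℕ n = fromℚ (+ n ℚ./ 1)

0ᴿ 1ᴿ : ℝ
0ᴿ = fromℚ 0ℚ
1ᴿ = fromℚ 1ℚ

_+ᴿ_ : ℝ → ℝ → ℝ
x +ᴿ y = (λ n → seq x n ℚ.+ seq y n) ,ᴿ +-cauchy x y

-ᴿ_ : ℝ → ℝ
-ᴿ x = (λ n → ℚ.- seq x n) ,ᴿ neg-cauchy x

_-ᴿ_ : ℝ → ℝ → ℝ
x -ᴿ y = x +ᴿ (-ᴿ y)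

∣_∣ᴿ : ℝ → ℝ
∣ x ∣ᴿ = (λ n → ∣ seq x n ∣) ,ᴿ abs-cauchy x

_*ᴿ_ : ℝ → ℝ → ℝ
x *ᴿ y = (λ n → seq x n ℚ.* seq y n) ,ᴿ *-cauchy x y

_^ᴿ_ : ℝ → ℕ → ℝ
x ^ᴿ zero  = 1ᴿ
x ^ᴿ suc n = x *ᴿ (x ^ᴿ n)

private
  0<ε⊔p : ∀ {ε} p → 0ℚ ℚ.< ε → 0ℚ ℚ.< ε ⊔ p
  0<ε⊔p {ε} p 0<ε = ℚ.<-≤-trans 0<ε (ℚ.p≤p⊔q ε p)

  recip : ∀ {ε} → 0ℚ ℚ.< ε → (ℕ → ℚ) → ℕ → ℚ
  recip {ε} 0<ε x n = 1/ ε ⊔ x n [ 0<ε⊔p (x n) 0<ε ]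

  1/-distance : ∀ {a b i j ε δ} → 0ℚ ℚ.< ε → 0ℚ ℚ.≤ δ →
    0ℚ ℚ.< i → 0ℚ ℚ.< j → a ℚ.* i ≡ 1ℚ → b ℚ.* j ≡ 1ℚ →
    ε ℚ.≤ a → ε ℚ.≤ b →
    ∣ b ℚ.- a ∣ ℚ.≤ ε ℚ.* ε ℚ.* δ → ∣ i ℚ.- j ∣ ℚ.≤ δ
  1/-distance {a} {b} {i} {j} {ε} {δ} 0<ε 0≤δ 0<i 0<j ai bj ε≤a ε≤b d = begin
    ∣ i ℚ.- j ∣
      ≡⟨ cong ∣_∣ (sym (cong₂ ℚ._-_ (ℚ.*-identityʳ i) (ℚ.*-identityʳ j))) ⟩
    ∣ i ℚ.* 1ℚ ℚ.- j ℚ.* 1ℚ ∣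
      ≡⟨ cong ∣_∣ (sym (cong₂ (λ s t → i ℚ.* s ℚ.- j ℚ.* t) bj ai)) ⟩
    ∣ i ℚ.* (b ℚ.* j) ℚ.- j ℚ.* (a ℚ.* i) ∣
      ≡⟨ cong ∣_∣ (solve 4 (λ a b i j → i :* (b :* j) :- j :* (a :* i)
           := (b :- a) :* (i :* j)) refl a b i j) ⟩
    ∣ (b ℚ.- a) ℚ.* (i ℚ.* j) ∣
      ≡⟨ ℚ.∣p*q∣≡∣p∣*∣q∣ (b ℚ.- a) (i ℚ.* j) ⟩
    ∣ b ℚ.- a ∣ ℚ.* ∣ i ℚ.* j ∣
      ≡⟨ cong (∣ b ℚ.- a ∣ ℚ.*_) (ℚ.0≤p⇒∣p∣≡p 0≤ij) ⟩
    ∣ b ℚ.- a ∣ ℚ.* (i ℚ.* j)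
      ≤⟨ ℚ.*-monoʳ-≤-nonNeg (i ℚ.* j) {{ℚ.nonNegative 0≤ij}} d ⟩
    (ε ℚ.* ε ℚ.* δ) ℚ.* (i ℚ.* j)
      ≡⟨ solve 4 (λ e d i j → (e :* e :* d) :* (i :* j)
           := ((e :* i) :* (e :* j)) :* d) refl ε δ i j ⟩
    ((ε ℚ.* i) ℚ.* (ε ℚ.* j)) ℚ.* δ
      ≤⟨ ℚ.*-monoʳ-≤-nonNeg δ {{ℚ.nonNegative 0≤δ}}
           (*-mono-≤ (ℚ.<⇒≤ (*-pos 0<ε 0<j)) (ℚ.<⇒≤ (pos⇒< 1ℚ))
             (subst (ε ℚ.* i ℚ.≤_) ai
               (ℚ.*-monoʳ-≤-nonNeg i {{ℚ.nonNegative (ℚ.<⇒≤ 0<i)}} ε≤a))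
             (subst (ε ℚ.* j ℚ.≤_) bj
               (ℚ.*-monoʳ-≤-nonNeg j {{ℚ.nonNegative (ℚ.<⇒≤ 0<j)}} ε≤b))) ⟩
    (1ℚ ℚ.* 1ℚ) ℚ.* δ
      ≡⟨ ℚ.*-identityˡ δ ⟩
    δ ∎
    where
    open ℚ.≤-Reasoning
    0≤ij = ℚ.<⇒≤ (*-pos 0<i 0<j)

  recip-cauchy : ∀ (x : ℝ) {ε} (0<ε : 0ℚ ℚ.< ε) N →
    (∀ n → N ℕ.≤ n → 0ℚ ℚ.+ ε ℚ.≤ seq x n) → IsCauchy (recip 0<ε (seq x))
  recip-cauchy x {ε} 0<ε N ε≤x δ 0<δ = N ℕ.⊔ M , λ m n ≤m ≤n →
    1/-distance 0<ε (ℚ.<⇒≤ 0<δ)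
      (1/-pos (ε ⊔ seq x m) (0<ε⊔p (seq x m) 0<ε))
      (1/-pos (ε ⊔ seq x n) (0<ε⊔p (seq x n) 0<ε))
      (1/-inverse (ε ⊔ seq x m) (0<ε⊔p (seq x m) 0<ε))
      (1/-inverse (ε ⊔ seq x n) (0<ε⊔p (seq x n) 0<ε))
      (ℚ.p≤p⊔q ε (seq x m))
      (ℚ.p≤p⊔q ε (seq x n))
      (subst₂ (λ s t → ∣ s ℚ.- t ∣ ℚ.≤ ε ℚ.* ε ℚ.* δ)
        (sym (ε⊔x≡x n (ℕ.m⊔n≤o⇒m≤o N M ≤n)))
        (sym (ε⊔x≡x m (ℕ.m⊔n≤o⇒m≤o N M ≤m)))
        (proj₂ c n m (ℕ.m⊔n≤o⇒n≤o N M ≤n) (ℕ.m⊔n≤o⇒n≤o N M ≤m)))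
    where
    c = cauchy x (ε ℚ.* ε ℚ.* δ) (*-pos (*-pos 0<ε 0<ε) 0<δ)
    M = proj₁ c
    ε⊔x≡x : ∀ n → N ℕ.≤ n → ε ⊔ seq x n ≡ seq x n
    ε⊔x≡x n N≤n =
      ℚ.p≤q⇒p⊔q≡q (subst (ℚ._≤ seq x n) (ℚ.+-identityˡ ε) (ε≤x n N≤n))

-- The proof of 0 < y provides ε > 0 with ε ≤ yₙ for all large n; replacing yₙ
-- by max(ε, yₙ) changes only finitely many terms and makes them all invertible.

reciprocal : (y : ℝ) → 0ᴿ <ᴿ y → ℝ
reciprocal y (ε , 0<ε , N , ε≤y) =
  recip 0<ε (seq y) ,ᴿ recip-cauchy y 0<ε N ε≤y

divide : (x y : ℝ) → 0ᴿ <ᴿ y → ℝ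
divide x y 0<y = x *ᴿ reciprocal y 0<y

syntax divide x y 0<y = x /ᴿ y [ 0<y ]

*ᴿ-pos : ∀ {x y} → 0ᴿ <ᴿ x → 0ᴿ <ᴿ y → 0ᴿ <ᴿ x *ᴿ y
*ᴿ-pos {x} {y} (ε , 0<ε , N , p) (δ , 0<δ , M , q) =
  ε ℚ.* δ , *-pos 0<ε 0<δ , N ℕ.⊔ M , λ n ≤n →
    let ε≤x = subst (ℚ._≤ seq x n) (ℚ.+-identityˡ ε)
                (p n (ℕ.m⊔n≤o⇒m≤o N M ≤n))
        δ≤y = subst (ℚ._≤ seq y n) (ℚ.+-identityˡ δ)
                (q n (ℕ.m⊔n≤o⇒n≤o N M ≤n))
    in subst (ℚ._≤ seq x n ℚ.* seq y n) (sym (ℚ.+-identityˡ (ε ℚ.* δ)))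
         (*-mono-≤ (ℚ.<⇒≤ 0<δ) (ℚ.≤-trans (ℚ.<⇒≤ 0<ε) ε≤x) ε≤x δ≤y)

^ᴿ-pos : ∀ {x} → 0ᴿ <ᴿ x → ∀ n → 0ᴿ <ᴿ x ^ᴿ n
^ᴿ-pos 0<x zero    =
  1ℚ , pos⇒< 1ℚ , 0 , λ _ _ → ℚ.≤-reflexive (ℚ.+-identityˡ 1ℚ)
^ᴿ-pos {x} 0<x (suc n) = *ᴿ-pos {x} {x ^ᴿ n} 0<x (^ᴿ-pos {x} 0<x n)

ConvergesTo : (ℕ → ℝ) → ℝ → Set
ConvergesTo u l = ∀ ε → 0ᴿ <ᴿ ε →
  ∃[ N ] (∀ n → N ℕ.≤ n → ∣ u n -ᴿ l ∣ᴿ <ᴿ ε)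

AsymptoticTo : (u v : ℕ → ℝ) → (∀ n → 0ᴿ <ᴿ v n) → Set
AsymptoticTo u v 0<v = ConvergesTo (λ n → u n /ᴿ v n [ 0<v n ]) 1ᴿ

{-# OPTIONS --safe #-}

-- A column of a level one cheesy polyomino occupies an interval, possibly without one inner
-- cell; its right neighbours fill an interval with one more cell in either case.  So a
-- polyomino amounts to a code listing, column by column, the shape of the column and its
-- offset relative to the preceding one, where the number of offsets is affine in the
-- length of the preceding interval.  Hence the number of completions of a partial code is also
-- affine in that length, the two coefficients satisfy a linear system, and
-- c₍ₙ₊₃₎ = 6 c₍ₙ₊₂₎ - 8 c₍ₙ₊₁₎ + cₙ.  The dominant root λ of x³ - 6x² + 8x - 1 is the limit of a
-- monotone rational iteration, κ is a polynomial in λ, and the deviation cₙ - κ λⁿ is annihilated by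
-- the remaining quadratic factor; with λ replaced by its j-th rational approximation the
-- latter holds up to an error that vanishes as j → ∞ for fixed n.
module Submission where

open import Defs
open import Data.Empty using (⊥; ⊥-elim)
open import Data.Fin as Fin using (Fin; toℕ; fromℕ<)
import Data.Fin.Properties as Fin
open import Data.Integer as ℤ using (ℤ; +_; 0ℤ; 1ℤ)
import Data.Integer.Properties as ℤ
open import Data.Integer.Tactic.RingSolver as ℤ-Ring using ()
open import Data.List as List using (List; []; _∷_; _++_; map; length; allFin; upTo; cartesianProductWith)
open import Data.List.Properties using (length-map; length-++; length-tabulate; length-upTo)
open import Data.List.Membership.DecPropositional as DecMembership using ()
open import Data.List.Membership.Propositional using (_∈_; _∉_; find; lose)
open import Data.List.Membership.Propositional.Properties
open import Data.List.Membership.Propositional.Properties.WithK using (unique∧set⇒bag)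
open import Data.List.Relation.Binary.BagAndSetEquality using (∼bag⇒↭)
open import Data.List.Relation.Binary.Permutation.Propositional.Properties using (↭-length)
import Data.List.Relation.Unary.All as All
import Data.List.Relation.Unary.AllPairs as AllPairs
open import Data.List.Relation.Unary.Any as Any using (here; there; index)
open import Data.List.Relation.Unary.Any.Properties using (lookup-index)
open import Data.List.Relation.Unary.Unique.Propositional using (Unique)
import Data.List.Relation.Unary.Unique.Propositional.Properties as Unique
open import Data.Nat as ℕ using (ℕ; zero; suc)
import Data.Nat.Properties as ℕ
open import Data.Nat.Tactic.RingSolver as ℕ-Ring using ()
open import Data.Product using (∃-syntax; Σ-syntax; _×_; _,_; proj₁; proj₂)
import Data.Product.Properties as Product
open import Data.Rational as ℚ using (ℚ; 0ℚ; 1ℚ; ½; _⊔_; ∣_∣)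
import Data.Rational.Properties as ℚ
open import Data.Rational.Solver using (module +-*-Solver)
open import Data.Rational.Unnormalised as ℚᵘ using (mkℚᵘ)
import Data.Rational.Unnormalised.Properties as ℚᵘ
open import Data.Sum using (_⊎_; inj₁; inj₂)
open import Function using (id)
open import Function.Bundles using (_⇔_; mk⇔; Equivalence)
open import Relation.Binary.Bundles using (Setoid)
open import Relation.Binary.Construct.Closure.ReflexiveTransitive as Star using (Star; _◅_; _◅◅_)
open import Relation.Binary.PropositionalEquality
open import Relation.Nullary using (¬_; Dec; yes; no)
open import Relation.Nullary.Decidable using (¬?; _×-dec_; decidable-stable; from-yes; map′)

-- No equation between real numbers is ever used. Each identity that would hold at the root is
-- proved for an arbitrary rational `z` with an explicit remainder that is a multiple of `p z`, and
-- the remainder is estimated along the approximations. Its bound after n steps grows like 5ⁿ, so no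
-- single approximation serves all n: n is fixed first, and only then is j taken large, which is
-- also the order of quantifiers in the limit of real sequences.
--
-- On the combinatorial side the bound one on gaps is decisive. With two consecutive missing cells,
-- one position to the right would have lost both of its left neighbours, and the interval alone
-- would no longer determine the possible continuations.
--
-- Codes and sets of cells are linked by a relation. The set determines the code, the code and a
-- base cell determine the set, and translations preserve the code; these three facts yield the
-- bijection.

module Enumeration where

  -- Codes, their enumeration by size, and the linear recurrence.

  open import Data.Nat using (_+_; _*_; _≤_)
  open import Data.Nat.Properties using (+-suc; *-distribˡ-+)

  -- Tail s encodes the columns to the right of a column whose interval (gap included) has s + 1
  -- cells.  In solid k d t the next column has k + 1 cells and its top cell is d above the bottom of
  -- the preceding interval; in split i j e t it has a gap e + 1 above that bottom, with i + 1
  -- cells below and j + 1 cells above the gap.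
  data Tail : ℕ → Set where
    done  : ∀ {s} → Tail s
    solid : ∀ {s} k → Fin (suc s + suc k) → Tail k → Tail s
    split : ∀ {s} i j → Fin s → Tail (2 + i + j) → Tail s

  tailSize : ∀ {s} → Tail s → ℕ
  tailSize done            = 0
  tailSize (solid k d t)   = suc (k + tailSize t)
  tailSize (split i j e t) = suc (i + suc (j + tailSize t))

  Code : Set
  Code = ∃[ k ] Tail k

  first : ∀ k → Tail k → Code
  first k t = k , t

  codeSize : Code → ℕ
  codeSize (k , t) = suc (k + tailSize t)

  -- The parameters `k`, `i`, `j` are lower bounds for sizes still to be chosen, and `n` counts the
  -- cells beyond those that the bounds already claim. Raising a bound costs one cell, so every
  -- recursion descends in `n`, and a sum over sizes becomes a chain of appended lists.
  tails  : ∀ (s n : ℕ) → List (Tail s)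
  solids : ∀ (s k n : ℕ) → List (Tail s)
  lows   : ∀ (s i n : ℕ) → List (Tail s)
  highs  : ∀ (s i j n : ℕ) → List (Tail s)

  tails s zero    = done ∷ []
  tails s (suc n) = solids s 0 n ++ lows s 0 n

  solids s k zero    = cartesianProductWith (solid k) (allFin _) (tails k zero)
  solids s k (suc n) = cartesianProductWith (solid k) (allFin _) (tails k (suc n)) ++ solids s (suc k) n

  lows s i zero    = []
  lows s i (suc n) = highs s i 0 n ++ lows s (suc i) n

  highs s i j zero    = cartesianProductWith (split i j) (allFin _) (tails (2 + i + j) zero)
  highs s i j (suc n) = cartesianProductWith (split i j) (allFin _) (tails (2 + i + j) (suc n)) ++ highs s i (suc j) n

  firsts : ∀ (k n : ℕ) → List Code
  firsts k zero    = map (first k) (tails k zero)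
  firsts k (suc n) = map (first k) (tails k (suc n)) ++ firsts (suc k) n

  -- The linear system satisfied by the coefficients of the affine functions of s that count tails.
  P Q M : ℕ → ℕ
  P zero    = 1
  P (suc n) = 3 * P n + 2 * Q n
  Q zero    = 0
  Q (suc n) = P n + 2 * Q n + M n
  M zero    = 0
  M (suc n) = Q n + M n

  length-cartesianProductWith : ∀ {A B C : Set} (f : A → B → C) xs ys →
    length (cartesianProductWith f xs ys) ≡ length xs * length ys
  length-cartesianProductWith f []       ys = refl
  length-cartesianProductWith f (x ∷ xs) ys = trans (length-++ (map (f x) ys))
    (cong₂ _+_ (length-map (f x) ys) (length-cartesianProductWith f xs ys))

  length-product : ∀ {A B : Set} {m} (f : Fin m → A → B) ts →
    length (cartesianProductWith f (allFin m) ts) ≡ m * length ts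
  length-product {m = m} f ts = trans (length-cartesianProductWith f (allFin m) ts)
    (cong (_* length ts) (length-tabulate {n = m} id))

  tailCount : ℕ → ℕ → ℕ
  tailCount k zero    = 1
  tailCount k (suc n) = 2 * P n + Q n + k * (P n + Q n + M n)

  -- `P n + k * Q n` turns out to count the choices of a size of at least k + 1 followed by a tail,
  -- with `n` cells beyond this minimum. Here the size k + 1 itself is split off.
  P-step : ∀ n k → tailCount k (suc n) + (P n + suc k * Q n) ≡ P (suc n) + k * Q (suc n)
  P-step n k = lemma (P n) (Q n) (M n) k
    where
    lemma : ∀ p q m k → 2 * p + q + k * (p + q + m) + (p + suc k * q) ≡ 3 * p + 2 * q + k * (p + 2 * q + m)
    lemma = ℕ-Ring.solve-∀

  -- Simultaneous induction on `n`. A solid column has s + k + 2 offsets, and this factor times an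
  -- affine count makes `solids` quadratic in `k`; a split column has `s` offsets, whence the factor
  -- `s`. `M n` is the sum of the earlier values of `Q`, which arises from summing over the size of
  -- the lower component.
  length-tails  : ∀ (s n : ℕ) → length (tails s n) ≡ tailCount s n
  length-solids : ∀ (s k n : ℕ) → length (solids s k n) ≡
    s * (P n + k * Q n) + (2 * P n + Q n + k * (P n + 2 * Q n + M n) + k * k * Q n)
  length-lows   : ∀ (s i n : ℕ) → length (lows s i n) ≡ s * (M n + Q n + i * M n)
  length-highs  : ∀ (s i j n : ℕ) → length (highs s i j n) ≡ s * (P n + (2 + i + j) * Q n)

  length-tails s zero    = refl
  length-tails s (suc n) = begin
    length (solids s 0 n ++ lows s 0 n)          ≡⟨ length-++ (solids s 0 n) ⟩
    length (solids s 0 n) + length (lows s 0 n)  ≡⟨ cong₂ _+_ (length-solids s 0 n) (length-lows s 0 n) ⟩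
    _                                            ≡⟨ lemma s (P n) (Q n) (M n) ⟩
    tailCount s (suc n) ∎
    where
    open ≡-Reasoning
    lemma : ∀ s p q m → s * (p + 0 * q) + (2 * p + q + 0 * (p + 2 * q + m) + 0 * 0 * q) + s * (m + q + 0 * m)
            ≡ 2 * p + q + s * (p + q + m)
    lemma = ℕ-Ring.solve-∀

  length-solids s k zero = trans (length-product (solid {s} k) (tails k zero)) (lemma s k)
    where
    lemma : ∀ s k → (suc s + suc k) * 1 ≡ s * (1 + k * 0) + (2 * 1 + 0 + k * (1 + 2 * 0 + 0) + k * k * 0)
    lemma = ℕ-Ring.solve-∀
  length-solids s k (suc n) = begin
    length (cartesianProductWith (solid {s} k) (allFin _) (tails k (suc n)) ++ solids s (suc k) n)
      ≡⟨ length-++ (cartesianProductWith (solid {s} k) (allFin _) (tails k (suc n))) ⟩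
    length (cartesianProductWith (solid {s} k) (allFin _) (tails k (suc n))) + length (solids s (suc k) n)
      ≡⟨ cong₂ _+_ (trans (length-product (solid {s} k) (tails k (suc n)))
                          (cong ((suc s + suc k) *_) (length-tails k (suc n))))
                   (length-solids s (suc k) n) ⟩
    _ ≡⟨ lemma s k (P n) (Q n) (M n) ⟩
    _ ∎
    where
    open ≡-Reasoning
    lemma : ∀ s k p q m →
      (suc s + suc k) * (2 * p + q + k * (p + q + m)) +
      (s * (p + suc k * q) + (2 * p + q + suc k * (p + 2 * q + m) + suc k * suc k * q))
      ≡ s * (3 * p + 2 * q + k * (p + 2 * q + m)) +
        (2 * (3 * p + 2 * q) + (p + 2 * q + m) +
         k * (3 * p + 2 * q + 2 * (p + 2 * q + m) + (q + m)) + k * k * (p + 2 * q + m))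
    lemma = ℕ-Ring.solve-∀

  length-lows s i zero = lemma s i
    where
    lemma : ∀ s i → 0 ≡ s * (0 + 0 + i * 0)
    lemma = ℕ-Ring.solve-∀
  length-lows s i (suc n) = begin
    length (highs s i 0 n ++ lows s (suc i) n)            ≡⟨ length-++ (highs s i 0 n) ⟩
    length (highs s i 0 n) + length (lows s (suc i) n)    ≡⟨ cong₂ _+_ (length-highs s i 0 n) (length-lows s (suc i) n) ⟩
    _                                                     ≡⟨ lemma s i (P n) (Q n) (M n) ⟩
    _ ∎
    where
    open ≡-Reasoning
    lemma : ∀ s i p q m → s * (p + (2 + i + 0) * q) + s * (m + q + suc i * m)
            ≡ s * (q + m + (p + 2 * q + m) + i * (q + m))
    lemma = ℕ-Ring.solve-∀

  length-highs s i j zero = trans (length-product (split {s} i j) (tails (2 + i + j) zero)) (lemma s i j)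
    where
    lemma : ∀ s i j → s * 1 ≡ s * (1 + (2 + i + j) * 0)
    lemma = ℕ-Ring.solve-∀
  length-highs s i j (suc n) = begin
    length (cartesianProductWith (split {s} i j) (allFin _) (tails (2 + i + j) (suc n)) ++ highs s i (suc j) n)
      ≡⟨ length-++ (cartesianProductWith (split {s} i j) (allFin _) (tails (2 + i + j) (suc n))) ⟩
    length (cartesianProductWith (split {s} i j) (allFin _) (tails (2 + i + j) (suc n))) + length (highs s i (suc j) n)
      ≡⟨ cong₂ _+_ (trans (length-product (split {s} i j) (tails (2 + i + j) (suc n)))
                          (cong (s *_) (length-tails (2 + i + j) (suc n))))
                   (length-highs s i (suc j) n) ⟩
    s * tailCount (2 + i + j) (suc n) + s * (P n + (2 + i + suc j) * Q n)
      ≡⟨ *-distribˡ-+ s (tailCount (2 + i + j) (suc n)) _ ⟨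
    s * (tailCount (2 + i + j) (suc n) + (P n + (2 + i + suc j) * Q n))
      ≡⟨ cong (λ z → s * (tailCount (2 + i + j) (suc n) + (P n + z * Q n))) (cong (λ m → 2 + m) (+-suc i j)) ⟩
    s * (tailCount (2 + i + j) (suc n) + (P n + suc (2 + i + j) * Q n))
      ≡⟨ cong (s *_) (P-step n (2 + i + j)) ⟩
    _ ∎
    where
    open ≡-Reasoning

  length-firsts : ∀ (k n : ℕ) → length (firsts k n) ≡ P n + k * Q n
  length-firsts k zero    = trans (length-map (first k) (tails k zero)) (lemma k)
    where
    lemma : ∀ k → 1 ≡ 1 + k * 0
    lemma = ℕ-Ring.solve-∀
  length-firsts k (suc n) = begin
    length (map (first k) (tails k (suc n)) ++ firsts (suc k) n)
      ≡⟨ length-++ (map (first k) (tails k (suc n))) ⟩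
    length (map (first k) (tails k (suc n))) + length (firsts (suc k) n)
      ≡⟨ cong₂ _+_ (trans (length-map (first k) (tails k (suc n))) (length-tails k (suc n))) (length-firsts (suc k) n) ⟩
    _ ≡⟨ P-step n k ⟩
    _ ∎
    where open ≡-Reasoning

  codes : ℕ → List Code
  codes zero    = []
  codes (suc n) = firsts 0 n

  -- The value at 0 is the one that extends the linear recurrence backwards.
  count : ℕ → ℕ
  count zero    = 1
  count (suc n) = P n

  length-codes : ∀ n → length (codes (suc n)) ≡ count (suc n)
  length-codes n = trans (length-firsts 0 n) (ℕ.+-identityʳ (P n))

  -- The Cayley-Hamilton theorem for the system of `P`, `Q`, `M`: the matrix with rows (3, 2, 0),
  -- (1, 2, 1), (0, 1, 1) has characteristic polynomial x³ - 6x² + 8x - 1.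
  count-recurrence : ∀ n → count (3 + n) + 8 * count (1 + n) ≡ 6 * count (2 + n) + count n
  count-recurrence zero    = refl
  count-recurrence (suc n) = lemma (P n) (Q n) (M n)
    where
    lemma : ∀ p q m →
      3 * (3 * (3 * p + 2 * q) + 2 * (p + 2 * q + m)) + 2 * (3 * p + 2 * q + 2 * (p + 2 * q + m) + (q + m))
      + 8 * (3 * p + 2 * q) ≡ 6 * (3 * (3 * p + 2 * q) + 2 * (p + 2 * q + m)) + p
    lemma = ℕ-Ring.solve-∀

  -- Soundness and completeness of the enumeration.

  tail-sound  : ∀ s n {t} → t ∈ tails s n → tailSize t ≡ n
  solid-sound : ∀ s k n {t} → t ∈ solids s k n → tailSize t ≡ suc (k + n)
  low-sound   : ∀ s i n {t} → t ∈ lows s i n → tailSize t ≡ suc (i + n)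
  high-sound  : ∀ s i j n {t} → t ∈ highs s i j n → tailSize t ≡ suc (i + suc (j + n))

  tail-sound s zero    (here refl) = refl
  tail-sound s (suc n) t∈ with ∈-++⁻ (solids s 0 n) t∈
  ... | inj₁ t∈solids = solid-sound s 0 n t∈solids
  ... | inj₂ t∈lows   = low-sound s 0 n t∈lows

  solid-sound s k zero t∈ with ∈-cartesianProductWith⁻ (solid k) (allFin _) (tails k zero) t∈
  ... | d , u , _ , u∈ , refl = cong (λ m → suc (k + m)) (tail-sound k zero u∈)
  solid-sound s k (suc n) t∈ with ∈-++⁻ (cartesianProductWith (solid k) (allFin _) (tails k (suc n))) t∈
  ... | inj₂ t∈solids = trans (solid-sound s (suc k) n t∈solids) (cong suc (sym (+-suc k n)))
  ... | inj₁ t∈here with ∈-cartesianProductWith⁻ (solid k) (allFin _) (tails k (suc n)) t∈here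
  ...   | d , u , _ , u∈ , refl = cong (λ m → suc (k + m)) (tail-sound k (suc n) u∈)

  low-sound s i (suc n) t∈ with ∈-++⁻ (highs s i 0 n) t∈
  ... | inj₁ t∈highs = high-sound s i 0 n t∈highs
  ... | inj₂ t∈lows  = trans (low-sound s (suc i) n t∈lows) (cong suc (sym (+-suc i n)))

  high-sound s i j zero t∈ with ∈-cartesianProductWith⁻ (split i j) (allFin _) (tails (2 + i + j) zero) t∈
  ... | e , u , _ , u∈ , refl = cong (λ m → suc (i + suc (j + m))) (tail-sound (2 + i + j) zero u∈)
  high-sound s i j (suc n) t∈ with ∈-++⁻ (cartesianProductWith (split i j) (allFin _) (tails (2 + i + j) (suc n))) t∈
  ... | inj₂ t∈highs = trans (high-sound s i (suc j) n t∈highs) (cong (λ m → suc (i + suc m)) (sym (+-suc j n)))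
  ... | inj₁ t∈here with ∈-cartesianProductWith⁻ (split i j) (allFin _) (tails (2 + i + j) (suc n)) t∈here
  ...   | e , u , _ , u∈ , refl = cong (λ m → suc (i + suc (j + m))) (tail-sound (2 + i + j) (suc n) u∈)

  first-sound : ∀ k n {c} → c ∈ firsts k n → codeSize c ≡ suc (k + n)
  first-sound k zero c∈ with ∈-map⁻ (first k) c∈
  ... | t , t∈ , refl = cong (λ m → suc (k + m)) (tail-sound k zero t∈)
  first-sound k (suc n) c∈ with ∈-++⁻ (map (first k) (tails k (suc n))) c∈
  ... | inj₂ c∈firsts = trans (first-sound (suc k) n c∈firsts) (cong suc (sym (+-suc k n)))
  ... | inj₁ c∈here with ∈-map⁻ (first k) c∈here
  ...   | t , t∈ , refl = cong (λ m → suc (k + m)) (tail-sound k (suc n) t∈)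

  codes-sound : ∀ n {c} → c ∈ codes n → codeSize c ≡ n
  codes-sound (suc n) = first-sound 0 n

  -- In the lemmas below, `l` is how often the lower bound must still be raised before it reaches
  -- the actual size.
  tail-complete : ∀ {s} (t : Tail s) → t ∈ tails s (tailSize t)
  solid-complete : ∀ {s} l k {k′} (d : Fin (suc s + suc k′)) t → k′ ≡ l + k →
                   solid k′ d t ∈ solids s k (l + tailSize t)
  low-complete : ∀ {s} l i {i′} j (e : Fin s) t → i′ ≡ l + i →
                 split i′ j e t ∈ lows s i (l + suc (j + tailSize t))
  high-complete : ∀ {s} i l j {j′} (e : Fin s) t → j′ ≡ l + j →
                  split i j′ e t ∈ highs s i j (l + tailSize t)

  tail-complete done = here refl
  tail-complete {s} (solid k d t) = ∈-++⁺ˡ (solid-complete k 0 d t (sym (ℕ.+-identityʳ k)))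
  tail-complete {s} (split i j e t) =
    ∈-++⁺ʳ (solids s 0 (i + suc (j + tailSize t))) (low-complete i 0 j e t (sym (ℕ.+-identityʳ i)))

  -- `solids` unfolds only when its last argument has a known head, although the required product
  -- occurs in both clauses.
  solid-complete {s} zero k d t refl with tailSize t | tail-complete t
  ... | zero  | t∈ = ∈-cartesianProductWith⁺ (solid k) (∈-allFin d) t∈
  ... | suc n | t∈ = ∈-++⁺ˡ (∈-cartesianProductWith⁺ (solid k) (∈-allFin d) t∈)
  solid-complete {s} (suc l) k d t eq =
    ∈-++⁺ʳ (cartesianProductWith (solid k) (allFin _) (tails k (suc (l + tailSize t))))
           (solid-complete l (suc k) d t (trans eq (sym (+-suc l k))))

  low-complete {s} zero i j e t refl =
    ∈-++⁺ˡ (high-complete i j 0 e t (sym (ℕ.+-identityʳ j)))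
  low-complete {s} (suc l) i j e t eq =
    ∈-++⁺ʳ (highs s i 0 (l + suc (j + tailSize t))) (low-complete l (suc i) j e t (trans eq (sym (+-suc l i))))

  high-complete {s} i zero j e t refl with tailSize t | tail-complete t
  ... | zero  | t∈ = ∈-cartesianProductWith⁺ (split i j) (∈-allFin e) t∈
  ... | suc n | t∈ = ∈-++⁺ˡ (∈-cartesianProductWith⁺ (split i j) (∈-allFin e) t∈)
  high-complete {s} i (suc l) j e t eq =
    ∈-++⁺ʳ (cartesianProductWith (split i j) (allFin _) (tails (2 + i + j) (suc (l + tailSize t))))
           (high-complete i l (suc j) e t (trans eq (sym (+-suc l j))))

  first-complete : ∀ l k {k′} (t : Tail k′) → k′ ≡ l + k → first k′ t ∈ firsts k (l + tailSize t)
  first-complete zero k t refl with tailSize t | tail-complete t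
  ... | zero  | t∈ = ∈-map⁺ (first k) t∈
  ... | suc n | t∈ = ∈-++⁺ˡ (∈-map⁺ (first k) t∈)
  first-complete (suc l) k t eq =
    ∈-++⁺ʳ (map (first k) (tails k (suc (l + tailSize t)))) (first-complete l (suc k) t (trans eq (sym (+-suc l k))))

  codes-complete : ∀ c → c ∈ codes (codeSize c)
  codes-complete (k , t) = first-complete k 0 t (sym (ℕ.+-identityʳ k))

  -- Absence of repetitions in the enumeration.

  data Kind : Set where
    isDone isSolid isSplit : Kind

  kind : ∀ {s} → Tail s → Kind
  kind done            = isDone
  kind (solid _ _ _)   = isSolid
  kind (split _ _ _ _) = isSplit

  -- One less than the size of the lower and of the upper component of the first column.
  lower upper : ∀ {s} → Tail s → ℕ
  lower done            = 0
  lower (solid k _ _)   = k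
  lower (split i _ _ _) = i
  upper done            = 0
  upper (solid _ _ _)   = 0
  upper (split _ j _ _) = j

  -- These invariants separate the appended lists: the part split off has size exactly at the bound,
  -- the remainder lies strictly above it.
  solids-bound : ∀ s k n {t} → t ∈ solids s k n → kind t ≡ isSolid × k ≤ lower t
  solids-bound s k zero t∈ with ∈-cartesianProductWith⁻ (solid k) (allFin _) (tails k zero) t∈
  ... | d , u , _ , u∈ , refl = refl , ℕ.≤-refl
  solids-bound s k (suc n) t∈ with ∈-++⁻ (cartesianProductWith (solid k) (allFin _) (tails k (suc n))) t∈
  ... | inj₂ t∈solids = proj₁ (solids-bound s (suc k) n t∈solids) , ℕ.<⇒≤ (proj₂ (solids-bound s (suc k) n t∈solids))
  ... | inj₁ t∈here with ∈-cartesianProductWith⁻ (solid k) (allFin _) (tails k (suc n)) t∈here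
  ...   | d , u , _ , u∈ , refl = refl , ℕ.≤-refl

  highs-bound : ∀ s i j n {t} → t ∈ highs s i j n → kind t ≡ isSplit × lower t ≡ i × j ≤ upper t
  highs-bound s i j zero t∈ with ∈-cartesianProductWith⁻ (split i j) (allFin _) (tails (2 + i + j) zero) t∈
  ... | e , u , _ , u∈ , refl = refl , refl , ℕ.≤-refl
  highs-bound s i j (suc n) t∈ with ∈-++⁻ (cartesianProductWith (split i j) (allFin _) (tails (2 + i + j) (suc n))) t∈
  ... | inj₂ t∈highs = let kd , lw , up = highs-bound s i (suc j) n t∈highs in kd , lw , ℕ.<⇒≤ up
  ... | inj₁ t∈here with ∈-cartesianProductWith⁻ (split i j) (allFin _) (tails (2 + i + j) (suc n)) t∈here
  ...   | e , u , _ , u∈ , refl = refl , refl , ℕ.≤-refl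

  lows-bound : ∀ s i n {t} → t ∈ lows s i n → kind t ≡ isSplit × i ≤ lower t
  lows-bound s i (suc n) t∈ with ∈-++⁻ (highs s i 0 n) t∈
  ... | inj₁ t∈highs = let kd , lw , _ = highs-bound s i 0 n t∈highs in kd , ℕ.≤-reflexive (sym lw)
  ... | inj₂ t∈lows  = let kd , lw = lows-bound s (suc i) n t∈lows in kd , ℕ.<⇒≤ lw

  firsts-bound : ∀ k n {c} → c ∈ firsts k n → k ≤ proj₁ c
  firsts-bound k zero c∈ with ∈-map⁻ (first k) c∈
  ... | _ , _ , refl = ℕ.≤-refl
  firsts-bound k (suc n) c∈ with ∈-++⁻ (map (first k) (tails k (suc n))) c∈
  ... | inj₂ c∈firsts = ℕ.<⇒≤ (firsts-bound (suc k) n c∈firsts)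
  ... | inj₁ c∈here with ∈-map⁻ (first k) c∈here
  ...   | _ , _ , refl = ℕ.≤-refl

  tails-unique  : ∀ s n → Unique (tails s n)
  solids-unique : ∀ s k n → Unique (solids s k n)
  lows-unique   : ∀ s i n → Unique (lows s i n)
  highs-unique  : ∀ s i j n → Unique (highs s i j n)

  tails-unique s zero    = All.[] AllPairs.∷ AllPairs.[]
  tails-unique s (suc n) = Unique.++⁺ (solids-unique s 0 n) (lows-unique s 0 n)
    λ (t∈solids , t∈lows) → solid≢split
      (trans (sym (proj₁ (solids-bound s 0 n t∈solids))) (proj₁ (lows-bound s 0 n t∈lows)))
    where
    solid≢split : isSolid ≡ isSplit → ⊥
    solid≢split ()

  solids-unique s k zero =
    Unique.cartesianProductWith⁺ (solid k) (λ { refl → refl , refl }) (Unique.allFin⁺ _) (tails-unique k zero)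
  solids-unique s k (suc n) = Unique.++⁺
    (Unique.cartesianProductWith⁺ (solid k) (λ { refl → refl , refl }) (Unique.allFin⁺ _) (tails-unique k (suc n)))
    (solids-unique s (suc k) n) disjoint
    where
    disjoint : ∀ {t} → t ∈ cartesianProductWith (solid k) (allFin _) (tails k (suc n)) × t ∈ solids s (suc k) n → ⊥
    disjoint (t∈here , t∈solids) with ∈-cartesianProductWith⁻ (solid k) (allFin _) (tails k (suc n)) t∈here
    ... | d , u , _ , u∈ , refl = ℕ.<-irrefl refl (proj₂ (solids-bound s (suc k) n t∈solids))

  lows-unique s i zero    = AllPairs.[]
  lows-unique s i (suc n) = Unique.++⁺ (highs-unique s i 0 n) (lows-unique s (suc i) n)
    λ (t∈highs , t∈lows) → ℕ.<-irrefl (sym (proj₁ (proj₂ (highs-bound s i 0 n t∈highs))))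
                                      (proj₂ (lows-bound s (suc i) n t∈lows))

  highs-unique s i j zero =
    Unique.cartesianProductWith⁺ (split i j) (λ { refl → refl , refl }) (Unique.allFin⁺ _) (tails-unique _ zero)
  highs-unique s i j (suc n) = Unique.++⁺
    (Unique.cartesianProductWith⁺ (split i j) (λ { refl → refl , refl }) (Unique.allFin⁺ _) (tails-unique _ (suc n)))
    (highs-unique s i (suc j) n) disjoint
    where
    disjoint : ∀ {t} → t ∈ cartesianProductWith (split i j) (allFin _) (tails _ (suc n)) × t ∈ highs s i (suc j) n → ⊥
    disjoint (t∈here , t∈highs) with ∈-cartesianProductWith⁻ (split i j) (allFin _) (tails _ (suc n)) t∈here
    ... | e , u , _ , u∈ , refl = ℕ.<-irrefl refl (proj₂ (proj₂ (highs-bound s i (suc j) n t∈highs)))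

  firsts-unique : ∀ k n → Unique (firsts k n)
  firsts-unique k zero    = Unique.map⁺ {f = first k} (λ { refl → refl }) (tails-unique k zero)
  firsts-unique k (suc n) =
    Unique.++⁺ (Unique.map⁺ {f = first k} (λ { refl → refl }) (tails-unique k (suc n))) (firsts-unique (suc k) n) disjoint
    where
    disjoint : ∀ {c} → c ∈ map (first k) (tails k (suc n)) × c ∈ firsts (suc k) n → ⊥
    disjoint (c∈here , c∈firsts) with ∈-map⁻ (first k) c∈here
    ... | _ , _ , refl = ℕ.<-irrefl refl (firsts-bound (suc k) n c∈firsts)

  codes-unique : ∀ n → Unique (codes n)
  codes-unique zero    = AllPairs.[]
  codes-unique (suc n) = firsts-unique 0 n

-- Linear inequalities between integers.

module IntegerOrder where
  open import Data.Integer using (_+_; _-_; -_; _≤_; _<_)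

  abstract
    -- Linear arithmetic by certificate: an inequality follows from others when the
    -- differences of their sides add up, which is a ring identity.
    lin₁ : ∀ {a b c d} → a ≤ b → b - a ≡ d - c → c ≤ d
    lin₁ a≤b eq = ℤ.0≤i-j⇒j≤i (subst (0ℤ ≤_) eq (ℤ.i≤j⇒0≤j-i a≤b))

    lin₂ : ∀ {a b a′ b′ c d} → a ≤ b → a′ ≤ b′ → (b - a) + (b′ - a′) ≡ d - c → c ≤ d
    lin₂ a≤b a′≤b′ eq =
      ℤ.0≤i-j⇒j≤i (subst (0ℤ ≤_) eq (ℤ.+-mono-≤ (ℤ.i≤j⇒0≤j-i a≤b) (ℤ.i≤j⇒0≤j-i a′≤b′)))

    lin₃ : ∀ {a b a′ b′ a″ b″ c d} → a ≤ b → a′ ≤ b′ → a″ ≤ b″ →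
           (b - a) + ((b′ - a′) + (b″ - a″)) ≡ d - c → c ≤ d
    lin₃ a≤b a′≤b′ a″≤b″ eq = ℤ.0≤i-j⇒j≤i (subst (0ℤ ≤_) eq
      (ℤ.+-mono-≤ (ℤ.i≤j⇒0≤j-i a≤b) (ℤ.+-mono-≤ (ℤ.i≤j⇒0≤j-i a′≤b′) (ℤ.i≤j⇒0≤j-i a″≤b″))))

    0≤1 : 0ℤ ≤ 1ℤ
    0≤1 = ℤ.+≤+ ℕ.z≤n

    contra₁ : ∀ {a b} → a ≤ b → b - a ≡ - 1ℤ → ⊥
    contra₁ a≤b eq with subst (0ℤ ≤_) eq (ℤ.i≤j⇒0≤j-i a≤b)
    ... | ()

    contra₂ : ∀ {a b c d} → a ≤ b → c ≤ d → (b - a) + (d - c) ≡ - 1ℤ → ⊥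
    contra₂ a≤b c≤d eq with subst (0ℤ ≤_) eq (ℤ.+-mono-≤ (ℤ.i≤j⇒0≤j-i a≤b) (ℤ.i≤j⇒0≤j-i c≤d))
    ... | ()

    -- Strict inequalities are carried as `a + 1ℤ ≤ b`, so that the certificates deal with `≤` only.
    <⇒+1≤ : ∀ {a b} → a < b → a + 1ℤ ≤ b
    <⇒+1≤ {a} {b} a<b = subst (_≤ b) (ℤ.+-comm 1ℤ a) (ℤ.i<j⇒suc[i]≤j a<b)

    +1≤⇒< : ∀ {a b} → a + 1ℤ ≤ b → a < b
    +1≤⇒< {a} {b} le = ℤ.suc[i]≤j⇒i<j (subst (_≤ b) (ℤ.+-comm a 1ℤ) le)

    dichotomy : ∀ a b → a ≤ b ⊎ b + 1ℤ ≤ a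
    dichotomy a b with a ℤ.≤? b
    ... | yes a≤b = inj₁ a≤b
    ... | no  a≰b = inj₂ (<⇒+1≤ (ℤ.≰⇒> a≰b))

    trichotomy : ∀ a b → a + 1ℤ ≤ b ⊎ a ≡ b ⊎ b + 1ℤ ≤ a
    trichotomy a b with dichotomy a b | dichotomy b a
    ... | inj₂ b<a | _        = inj₂ (inj₂ b<a)
    ... | inj₁ _   | inj₂ a<b = inj₁ a<b
    ... | inj₁ a≤b | inj₁ b≤a = inj₂ (inj₁ (ℤ.≤-antisym a≤b b≤a))

    +1≤⇒≢ : ∀ {a b} → a + 1ℤ ≤ b → a ≢ b
    +1≤⇒≢ {a} a<a refl = contra₁ a<a (ℤ-Ring.solve (a ∷ []))

    ≤⇒∃+ : ∀ {a b} → a ≤ b → ∃[ n ] b ≡ a + + n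
    ≤⇒∃+ {a} {b} a≤b with b - a in eq | ℤ.i≤j⇒0≤j-i a≤b
    ... | + n | _ = n , trans (lemma a b) (cong (λ z → a + z) eq)
      where
      lemma : ∀ a b → b ≡ a + (b - a)
      lemma = ℤ-Ring.solve-∀

    +-cancelˡ-≤ : ∀ a {b c} → a + b ≤ a + c → b ≤ c
    +-cancelˡ-≤ a {b} {c} le = lin₁ le (ℤ-Ring.solve (a ∷ b ∷ c ∷ []))

    ≤+ : ∀ a n → a ≤ a + + n
    ≤+ a n = ℤ.i≤i+j a (+ n)

-- Columns with at most one missing cell, and their components.

module Columns where
  open import Data.Integer using (_+_; _-_; -_; _≤_)
  open IntegerOrder

  -- Column x of M is the interval [lo , hi] without the point g.  A column without
  -- gap is recorded with g = hi + 1, so that g is the lowest point above lo outside the column.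
  record Col (M : ℤ → ℤ → Set) (x lo g hi : ℤ) : Set where
    constructor mkCol
    field
      lo<g   : lo + 1ℤ ≤ g
      g≤hi+1 : g ≤ hi + 1ℤ
      g≢hi   : g ≢ hi
      to     : ∀ {y} → M x y → lo ≤ y × y ≤ hi × y ≢ g
      from   : ∀ y → lo ≤ y → y ≤ hi → y ≢ g → M x y

    lo≤hi : lo ≤ hi
    lo≤hi = lin₂ lo<g g≤hi+1 (ℤ-Ring.solve (lo ∷ g ∷ hi ∷ []))

    lo∈ : M x lo
    lo∈ = from _ ℤ.≤-refl lo≤hi (+1≤⇒≢ lo<g)

    hi∈ : M x hi
    hi∈ = from _ lo≤hi ℤ.≤-refl (λ eq → g≢hi (sym eq))

    gap : g ≡ hi + 1ℤ ⊎ g + 1ℤ ≤ hi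
    gap with trichotomy g hi
    ... | inj₁ g<hi         = inj₂ g<hi
    ... | inj₂ (inj₁ g≡hi)  = ⊥-elim (g≢hi g≡hi)
    ... | inj₂ (inj₂ hi<g)  = inj₁ (ℤ.≤-antisym g≤hi+1 hi<g)

  open Col public

  module _ {M : ℤ → ℤ → Set} {x : ℤ} where
    private
      gap-bound : ∀ {lo g g′ hi} → Col M x lo g hi → Col M x lo g′ hi → g ≤ g′
      gap-bound {lo} {g} {g′} {hi} c c′ with dichotomy g g′
      ... | inj₁ g≤g′ = g≤g′
      ... | inj₂ g′<g = ⊥-elim (proj₂ (proj₂ (to c′ (from c g′ lo≤g′ g′≤hi (+1≤⇒≢ g′<g)))) refl)
        where
        lo≤g′ : lo ≤ g′
        lo≤g′ = lin₂ (lo<g c′) 0≤1 (ℤ-Ring.solve (lo ∷ g′ ∷ []))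
        g′≤hi : g′ ≤ hi
        g′≤hi = lin₂ g′<g (g≤hi+1 c) (ℤ-Ring.solve (g′ ∷ g ∷ hi ∷ []))

    abstract
      -- The extreme points determine `lo` and `hi`. Thanks to the convention for columns without
      -- gap, `g` is determined too: the smaller of two candidates would be present by one
      -- description and absent by the other.
      Col-unique : ∀ {lo g hi lo′ g′ hi′} → Col M x lo g hi → Col M x lo′ g′ hi′ →
                   lo ≡ lo′ × g ≡ g′ × hi ≡ hi′
      Col-unique c c′
        with refl ← ℤ.≤-antisym (proj₁ (to c (lo∈ c′))) (proj₁ (to c′ (lo∈ c)))
           | refl ← ℤ.≤-antisym (proj₁ (proj₂ (to c′ (hi∈ c)))) (proj₁ (proj₂ (to c (hi∈ c′))))
        = refl , ℤ.≤-antisym (gap-bound c c′) (gap-bound c′ c) , refl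

  -- `IsComponent` for an arbitrary relation, because components serve to prove connectedness,
  -- before there is a polyomino.
  record Comp (M : ℤ → ℤ → Set) (x b t : ℤ) : Set where
    constructor mkComp
    field
      b≤t    : b ≤ t
      filled : ∀ y → b ≤ y → y ≤ t → M x y
      below∉ : ¬ M x (b - 1ℤ)
      above∉ : ¬ M x (t + 1ℤ)

  LowerComp UpperComp : (lo g hi b t : ℤ) → Set
  LowerComp lo g hi b t = b ≡ lo × t ≡ g - 1ℤ
  UpperComp lo g hi b t = g + 1ℤ ≤ hi × b ≡ g + 1ℤ × t ≡ hi

  module _ {M : ℤ → ℤ → Set} {x lo g hi : ℤ} (c : Col M x lo g hi) where
    g∉ : ¬ M x g
    g∉ g∈ = proj₂ (proj₂ (to c g∈)) refl

    lowerComp : Comp M x lo (g - 1ℤ)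
    lowerComp = mkComp
      (lin₁ (lo<g c) (ℤ-Ring.solve (lo ∷ g ∷ [])))
      (λ y lo≤y y<g → from c y lo≤y
        (lin₂ y<g (g≤hi+1 c) (ℤ-Ring.solve (y ∷ g ∷ hi ∷ [])))
        (+1≤⇒≢ {y} {g} (lin₁ y<g (ℤ-Ring.solve (y ∷ g ∷ [])))))
      (λ lo-1∈ → contra₁ (proj₁ (to c lo-1∈)) (ℤ-Ring.solve (lo ∷ [])))
      (λ ∈ → g∉ (subst (M x) (lemma g) ∈))
      where
      lemma : ∀ g → g - 1ℤ + 1ℤ ≡ g
      lemma = ℤ-Ring.solve-∀

    upperComp : g + 1ℤ ≤ hi → Comp M x (g + 1ℤ) hi
    upperComp g<hi = mkComp g<hi
      (λ y g<y y≤hi → from c y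
        (lin₃ (lo<g c) g<y (ℤ.+-mono-≤ 0≤1 0≤1) (ℤ-Ring.solve (y ∷ g ∷ lo ∷ []))) y≤hi
        (λ y≡g → +1≤⇒≢ g<y (sym y≡g)))
      (λ ∈ → g∉ (subst (M x) (lemma g) ∈))
      (λ hi+1∈ → contra₁ (proj₁ (proj₂ (to c hi+1∈))) (ℤ-Ring.solve (hi ∷ [])))
      where
      lemma : ∀ g → g + 1ℤ - 1ℤ ≡ g
      lemma = ℤ-Ring.solve-∀

    -- A run avoids `g`, so its bottom lies on one side of `g`. If the run stopped short of either
    -- end of that side, the adjacent cell would belong to the column, against maximality.
    component-cases : ∀ {b t} → Comp M x b t → LowerComp lo g hi b t ⊎ UpperComp lo g hi b t
    component-cases {b} {t} (mkComp b≤t filled below∉ above∉) = cases (trichotomy b g)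
      where
      b∈ = to c (filled b ℤ.≤-refl b≤t)
      t∈ = to c (filled t b≤t ℤ.≤-refl)
      lo≤b = proj₁ b∈
      b≤hi = proj₁ (proj₂ b∈)
      t≤hi = proj₁ (proj₂ t∈)
      cases : b + 1ℤ ≤ g ⊎ b ≡ g ⊎ g + 1ℤ ≤ b → LowerComp lo g hi b t ⊎ UpperComp lo g hi b t
      cases (inj₂ (inj₁ b≡g)) = ⊥-elim (proj₂ (proj₂ b∈) b≡g)
      cases (inj₁ b<g) = inj₁ (ℤ.≤-antisym b≤lo lo≤b , ℤ.≤-antisym t≤g-1 g-1≤t)
        where
        b≤lo : b ≤ lo
        b≤lo with dichotomy b lo
        ... | inj₁ b≤lo = b≤lo
        ... | inj₂ lo<b = ⊥-elim (below∉ (from c (b - 1ℤ)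
          (lin₁ lo<b (ℤ-Ring.solve (b ∷ lo ∷ [])))
          (lin₂ b≤hi 0≤1 (ℤ-Ring.solve (b ∷ hi ∷ [])))
          (+1≤⇒≢ {b - 1ℤ} {g} (lin₂ b<g 0≤1 (ℤ-Ring.solve (b ∷ g ∷ []))))))
        t≤g-1 : t ≤ g - 1ℤ
        t≤g-1 with dichotomy g t
        ... | inj₁ g≤t = ⊥-elim (g∉ (filled g (lin₂ b<g 0≤1 (ℤ-Ring.solve (b ∷ g ∷ []))) g≤t))
        ... | inj₂ t<g = lin₁ t<g (ℤ-Ring.solve (g ∷ t ∷ []))
        g-1≤t : g - 1ℤ ≤ t
        g-1≤t with dichotomy (g - 1ℤ) t
        ... | inj₁ le = le
        ... | inj₂ t+1≤g-1 = ⊥-elim (above∉ (from c (t + 1ℤ)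
          (lin₃ lo≤b b≤t 0≤1 (ℤ-Ring.solve (lo ∷ b ∷ t ∷ [])))
          (lin₂ t+1≤g-1 (g≤hi+1 c) (ℤ-Ring.solve (g ∷ t ∷ hi ∷ [])))
          (+1≤⇒≢ {t + 1ℤ} {g} (lin₁ t+1≤g-1 (ℤ-Ring.solve (g ∷ t ∷ []))))))
      cases (inj₂ (inj₂ g<b)) = inj₂ (lin₂ g<b b≤hi (ℤ-Ring.solve (g ∷ b ∷ hi ∷ []))
                                     , ℤ.≤-antisym b≤g+1 g<b , ℤ.≤-antisym t≤hi hi≤t)
        where
        b≤g+1 : b ≤ g + 1ℤ
        b≤g+1 with dichotomy b (g + 1ℤ)
        ... | inj₁ le = le
        ... | inj₂ g+2≤b = ⊥-elim (below∉ (from c (b - 1ℤ)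
          (lin₃ g+2≤b (lo<g c) (ℤ.+-mono-≤ 0≤1 0≤1) (ℤ-Ring.solve (lo ∷ g ∷ b ∷ [])))
          (lin₂ b≤hi 0≤1 (ℤ-Ring.solve (b ∷ hi ∷ [])))
          (λ eq → +1≤⇒≢ {g} {b - 1ℤ} (lin₁ g+2≤b (ℤ-Ring.solve (g ∷ b ∷ []))) (sym eq))))
        hi≤t : hi ≤ t
        hi≤t with dichotomy hi t
        ... | inj₁ le = le
        ... | inj₂ t<hi = ⊥-elim (above∉ (from c (t + 1ℤ)
          (lin₃ lo≤b b≤t 0≤1 (ℤ-Ring.solve (lo ∷ b ∷ t ∷ []))) t<hi
          (λ eq → +1≤⇒≢ {g} {t + 1ℤ} (lin₃ g<b b≤t 0≤1 (ℤ-Ring.solve (g ∷ b ∷ t ∷ []))) (sym eq))))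

-- Codes as descriptions of sets of cells.

module Descriptions where
  open import Data.Integer using (_+_; _-_; -_; _≤_)
  open IntegerOrder
  open Columns
  open Enumeration using (Tail; done; solid; split; Code)

  -- The right neighbours of a column [lo₀ , hi₀] are the cells of [lo₀ , hi₀ + 1], whether
  -- or not the column has a one-cell gap: that gap is bridged by the cells on both sides of it.
  data Step (lo₀ hi₀ lo g hi : ℤ) : Set where
    solid : g ≡ hi + 1ℤ → lo ≤ hi₀ + 1ℤ → lo₀ ≤ hi → Step lo₀ hi₀ lo g hi
    split : g + 1ℤ ≤ hi → lo₀ + 1ℤ ≤ g → g ≤ hi₀ → Step lo₀ hi₀ lo g hi

  -- Here `lo` is the bottom of the preceding interval, whose length enters only through the index
  -- `s`. The inequalities of `Step` are absent because the types of `d` and `e` enforce them.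
  data Desc (M : ℤ → ℤ → Set) (x lo : ℤ) : ∀ {s} → Tail s → Set where
    done  : ∀ {s} → (∀ x′ y → x + 1ℤ ≤ x′ → ¬ M x′ y) → Desc M x lo (done {s})
    solid : ∀ {s k} {d : Fin (suc s ℕ.+ suc k)} {t} lo′ →
            lo′ + + k ≡ lo + + toℕ d →
            Col M (x + 1ℤ) lo′ (lo′ + + k + 1ℤ) (lo′ + + k) →
            Desc M (x + 1ℤ) lo′ t → Desc M x lo (solid k d t)
    split : ∀ {s i j} {e : Fin s} {t} lo′ →
            lo′ + + suc i ≡ lo + + suc (toℕ e) →
            Col M (x + 1ℤ) lo′ (lo′ + + suc i) (lo′ + + (2 ℕ.+ i ℕ.+ j)) →
            Desc M (x + 1ℤ) lo′ t → Desc M x lo (split i j e t)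

  record CodeDesc (M : ℤ → ℤ → Set) (x lo : ℤ) (c : Code) : Set where
    constructor codeDesc
    k : ℕ
    k = proj₁ c
    field
      none-left : ∀ x′ y → x′ + 1ℤ ≤ x → ¬ M x′ y
      column    : Col M x lo (lo + + k + 1ℤ) (lo + + k)
      rest      : Desc M x lo (proj₂ c)

  +-cancelˡ : ∀ a {b c} → a + b ≡ a + c → b ≡ c
  +-cancelˡ a {b} {c} eq = trans (lemma a b) (trans (cong (_- a) eq) (sym (lemma a c)))
    where
    lemma : ∀ a b → b ≡ a + b - a
    lemma = ℤ-Ring.solve-∀

  +-injectiveˡ : ∀ a {m n} → a + + m ≡ a + + n → m ≡ n
  +-injectiveˡ a eq = ℤ.+-injective (+-cancelˡ a eq)

  no-gap≢gap : ∀ {M x lo g hi lo′ g′ hi′} → g ≡ hi + 1ℤ → g′ + 1ℤ ≤ hi′ →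
               Col M x lo g hi → ¬ Col M x lo′ g′ hi′
  no-gap≢gap {hi = hi} refl g<hi c c′ with Col-unique c c′
  ... | refl , refl , refl = contra₂ g<hi 0≤1 (lemma hi)
    where
    lemma : ∀ z → z - (z + 1ℤ + 1ℤ) + (1ℤ - 0ℤ) ≡ - 1ℤ
    lemma = ℤ-Ring.solve-∀

  gap<top : ∀ lo i j → lo + + suc i + 1ℤ ≤ lo + + (2 ℕ.+ i ℕ.+ j)
  gap<top lo i j = subst (_≤ lo + + (2 ℕ.+ i ℕ.+ j)) (lemma lo (+ i))
    (ℤ.+-monoʳ-≤ lo (ℤ.+≤+ (ℕ.m≤m+n (2 ℕ.+ i) j)))
    where
    lemma : ∀ a i → a + (+ 2 + i) ≡ a + (1ℤ + i) + 1ℤ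
    lemma = ℤ-Ring.solve-∀

  -- The set determines the code: `Col-unique` recovers the sizes, the position relative to `lo`
  -- recovers the offset, and any cell to the right excludes `done`.
  Desc-unique : ∀ {M x lo s} {t t′ : Tail s} → Desc M x lo t → Desc M x lo t′ → t ≡ t′
  Desc-unique (done _) (done _) = refl
  Desc-unique (done none) (solid lo′ _ c _) = ⊥-elim (none _ lo′ ℤ.≤-refl (lo∈ c))
  Desc-unique (done none) (split lo′ _ c _) = ⊥-elim (none _ lo′ ℤ.≤-refl (lo∈ c))
  Desc-unique (solid lo′ _ c _) (done none) = ⊥-elim (none _ lo′ ℤ.≤-refl (lo∈ c))
  Desc-unique (split lo′ _ c _) (done none) = ⊥-elim (none _ lo′ ℤ.≤-refl (lo∈ c))
  Desc-unique (solid _ _ c _) (split {i = i} {j} lo′ _ c′ _) = ⊥-elim (no-gap≢gap refl (gap<top lo′ i j) c c′)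
  Desc-unique (split {i = i} {j} lo′ _ c′ _) (solid _ _ c _) = ⊥-elim (no-gap≢gap refl (gap<top lo′ i j) c c′)
  Desc-unique {lo = lo} (solid lo′ eq c D) (solid lo″ eq′ c′ D′)
    with refl , _ , hi≡ ← Col-unique c c′
    with refl ← +-injectiveˡ lo′ hi≡
    with refl ← Fin.toℕ-injective (+-injectiveˡ lo (trans (sym eq) eq′))
    with refl ← Desc-unique D D′ = refl
  Desc-unique {lo = lo} (split {i = i} {j} lo′ eq c D) (split {i = i′} {j′} lo″ eq′ c′ D′)
    with refl , g≡ , hi≡ ← Col-unique c c′
    with refl ← ℕ.suc-injective (+-injectiveˡ lo′ g≡)
    with refl ← ℕ.+-cancelˡ-≡ (2 ℕ.+ i) j j′ (+-injectiveˡ lo′ hi≡)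
    with refl ← Fin.toℕ-injective (ℕ.suc-injective (+-injectiveˡ lo (trans (sym eq) eq′)))
    with refl ← Desc-unique D D′ = refl

  -- The two descriptions may a priori start in different places; `none-left` makes each start the
  -- leftmost column of the same set.
  Code-unique : ∀ {M x lo x′ lo′ c c′} → CodeDesc M x lo c → CodeDesc M x′ lo′ c′ → c ≡ c′
  Code-unique {x = x} {lo} {x′} {lo′} (codeDesc none col D) (codeDesc none′ col′ D′) = by-cases (trichotomy x x′)
    where
    by-cases : x + 1ℤ ≤ x′ ⊎ x ≡ x′ ⊎ x′ + 1ℤ ≤ x → _
    by-cases (inj₁ x<x′)        = ⊥-elim (none′ x lo x<x′ (lo∈ col))
    by-cases (inj₂ (inj₂ x′<x)) = ⊥-elim (none x′ lo′ x′<x (lo∈ col′))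
    by-cases (inj₂ (inj₁ refl))
      with refl , _ , hi≡ ← Col-unique col col′
      with refl ← +-injectiveˡ lo hi≡
      with refl ← Desc-unique D D′ = refl

  next-or-later : ∀ {x x′} → x + 1ℤ ≤ x′ → x′ ≡ x + 1ℤ ⊎ x + 1ℤ + 1ℤ ≤ x′
  next-or-later {x} {x′} x<x′ with trichotomy x′ (x + 1ℤ)
  ... | inj₁ x′<x+1        = ⊥-elim (contra₂ x<x′ x′<x+1 (ℤ-Ring.solve (x ∷ x′ ∷ [])))
  ... | inj₂ (inj₁ eq)     = inj₁ eq
  ... | inj₂ (inj₂ later)  = inj₂ later

  Col-⊆ : ∀ {M M′ x lo g hi lo′ g′ hi′ y} → lo ≡ lo′ → g ≡ g′ → hi ≡ hi′ →
          Col M x lo g hi → Col M′ x lo′ g′ hi′ → M x y → M′ x y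
  Col-⊆ refl refl refl c c′ ∈ = let lo≤ , ≤hi , ≢g = to c ∈ in from c′ _ lo≤ ≤hi ≢g

  +-cancelʳ : ∀ {a b} c → a + c ≡ b + c → a ≡ b
  +-cancelʳ {a} {b} c eq = +-cancelˡ c (trans (ℤ.+-comm c a) (trans eq (ℤ.+-comm b c)))

  -- Conversely, code and base determine the set. One inclusion suffices, since the hypotheses are
  -- symmetric in `M` and `M′`.
  Desc-⊆ : ∀ {M M′ x lo s} {t : Tail s} → Desc M x lo t → Desc M′ x lo t →
           ∀ {x′ y} → x + 1ℤ ≤ x′ → M x′ y → M′ x′ y
  Desc-⊆ (done none) (done _) x<x′ ∈ = ⊥-elim (none _ _ x<x′ ∈)
  Desc-⊆ {x = x} (solid {k = k} lo′ eq c D) (solid lo″ eq′ c′ D′) x<x′ ∈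
    with refl ← +-cancelʳ {lo′} {lo″} (+ k) (trans eq (sym eq′)) | next-or-later {x} x<x′
  ... | inj₁ refl  = Col-⊆ refl refl refl c c′ ∈
  ... | inj₂ later = Desc-⊆ D D′ later ∈
  Desc-⊆ {x = x} (split {i = i} lo′ eq c D) (split lo″ eq′ c′ D′) x<x′ ∈
    with refl ← +-cancelʳ {lo′} {lo″} (+ suc i) (trans eq (sym eq′)) | next-or-later {x} x<x′
  ... | inj₁ refl  = Col-⊆ refl refl refl c c′ ∈
  ... | inj₂ later = Desc-⊆ D D′ later ∈

  CodeDesc-⊆ : ∀ {M M′ x lo c} → CodeDesc M x lo c → CodeDesc M′ x lo c → ∀ {x′ y} → M x′ y → M′ x′ y
  CodeDesc-⊆ {x = x} (codeDesc none col D) (codeDesc _ col′ D′) {x′} {y} ∈ with trichotomy x x′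
  ... | inj₁ x<x′        = Desc-⊆ D D′ x<x′ ∈
  ... | inj₂ (inj₁ refl) = Col-⊆ refl refl refl col col′ ∈
  ... | inj₂ (inj₂ x′<x) = ⊥-elim (none x′ y x′<x ∈)

-- Invariance of the code under translations.

module Translations where
  open import Data.Integer using (_+_; _-_; -_; _≤_)
  open IntegerOrder
  open Columns
  open Enumeration using (Tail; done; solid; split)
  open Descriptions

  module _ {M M′ : ℤ → ℤ → Set} (u v : ℤ) (M⇔M′ : ∀ x y → M x y ⇔ M′ (u + x) (v + y)) where

    private
      cancel : ∀ w z → w + (z - w) ≡ z
      cancel = ℤ-Ring.solve-∀

    Col-translate : ∀ {x lo g hi} → Col M x lo g hi → Col M′ (u + x) (v + lo) (v + g) (v + hi)
    Col-translate {x} {lo} {g} {hi} c = mkCol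
      (subst (_≤ v + g) (sym (ℤ.+-assoc v lo 1ℤ)) (ℤ.+-monoʳ-≤ v (lo<g c)))
      (subst (v + g ≤_) (sym (ℤ.+-assoc v hi 1ℤ)) (ℤ.+-monoʳ-≤ v (g≤hi+1 c)))
      (λ eq → g≢hi c (+-cancelˡ v eq))
      to′
      from′
      where
      to′ : ∀ {y} → M′ (u + x) y → v + lo ≤ y × y ≤ v + hi × y ≢ v + g
      to′ {y} ∈ with to c (Equivalence.from (M⇔M′ x (y - v)) (subst (M′ (u + x)) (sym (cancel v y)) ∈))
      ... | lo≤ , ≤hi , ≢g = lin₁ lo≤ (lemma₁ lo v y) , lin₁ ≤hi (lemma₂ hi v y)
                           , λ eq → ≢g (trans (cong (_- v) eq) (lemma₃ v g))
        where
        lemma₁ : ∀ lo v y → y - v - lo ≡ y - (v + lo)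
        lemma₁ = ℤ-Ring.solve-∀
        lemma₂ : ∀ hi v y → hi - (y - v) ≡ v + hi - y
        lemma₂ = ℤ-Ring.solve-∀
        lemma₃ : ∀ v g → v + g - v ≡ g
        lemma₃ = ℤ-Ring.solve-∀
      from′ : ∀ y → v + lo ≤ y → y ≤ v + hi → y ≢ v + g → M′ (u + x) y
      from′ y lo≤ ≤hi ≢g = subst (M′ (u + x)) (cancel v y) (Equivalence.to (M⇔M′ x (y - v))
        (from c (y - v) (lin₁ lo≤ (lemma₁ lo v y)) (lin₁ ≤hi (lemma₂ hi v y))
          (λ eq → ≢g (trans (sym (cancel v y)) (cong (λ z → v + z) eq)))))
        where
        lemma₁ : ∀ lo v y → y - (v + lo) ≡ y - v - lo
        lemma₁ = ℤ-Ring.solve-∀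
        lemma₂ : ∀ hi v y → v + hi - y ≡ hi - (y - v)
        lemma₂ = ℤ-Ring.solve-∀

    private
      next : ∀ {x lo g hi} g′ hi′ → v + g ≡ g′ → v + hi ≡ hi′ →
             Col M (x + 1ℤ) lo g hi → Col M′ (u + x + 1ℤ) (v + lo) g′ hi′
      next {x} {lo} {g} {hi} _ _ refl refl c =
        subst (λ z → Col M′ z (v + lo) (v + g) (v + hi)) (sym (ℤ.+-assoc u x 1ℤ)) (Col-translate c)

      M′-cell : ∀ {x y} → M′ x y → M (x - u) (y - v)
      M′-cell {x} {y} ∈ = Equivalence.from (M⇔M′ (x - u) (y - v))
        (subst₂ M′ (sym (cancel u x)) (sym (cancel v y)) ∈)

      assoc₂ : ∀ v a b → v + (a + b + 1ℤ) ≡ v + a + b + 1ℤ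
      assoc₂ = ℤ-Ring.solve-∀

    Desc-translate : ∀ {x lo s} {t : Tail s} → Desc M x lo t → Desc M′ (u + x) (v + lo) t
    Desc-translate {x} (done none) =
      done λ x′ y x<x′ ∈ → none (x′ - u) (y - v) (lin₁ x<x′ (lemma u x x′)) (M′-cell ∈)
      where
      lemma : ∀ u x x′ → x′ - (u + x + 1ℤ) ≡ x′ - u - (x + 1ℤ)
      lemma = ℤ-Ring.solve-∀
    Desc-translate {x} {lo} (solid {k = k} {d} {t} lo′ eq c D) = solid (v + lo′)
      (trans (ℤ.+-assoc v lo′ (+ k)) (trans (cong (λ z → v + z) eq) (sym (ℤ.+-assoc v lo (+ toℕ d)))))
      (next _ _ (assoc₂ v lo′ (+ k)) (sym (ℤ.+-assoc v lo′ (+ k))) c)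
      (subst (λ z → Desc M′ z (v + lo′) t) (sym (ℤ.+-assoc u x 1ℤ)) (Desc-translate D))
    Desc-translate {x} {lo} (split {i = i} {j} {e} {t} lo′ eq c D) = split (v + lo′)
      (trans (ℤ.+-assoc v lo′ (+ suc i)) (trans (cong (λ z → v + z) eq) (sym (ℤ.+-assoc v lo (+ suc (toℕ e))))))
      (next _ _ (sym (ℤ.+-assoc v lo′ (+ suc i))) (sym (ℤ.+-assoc v lo′ (+ (2 ℕ.+ i ℕ.+ j)))) c)
      (subst (λ z → Desc M′ z (v + lo′) t) (sym (ℤ.+-assoc u x 1ℤ)) (Desc-translate D))

    CodeDesc-translate : ∀ {x lo c} → CodeDesc M x lo c → CodeDesc M′ (u + x) (v + lo) c
    CodeDesc-translate {x} {lo} {k , t} (codeDesc none col D) = codeDesc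
      (λ x′ y x′<x ∈ → none (x′ - u) (y - v) (lin₁ x′<x (lemma u x x′)) (M′-cell ∈))
      (subst₂ (Col M′ (u + x) (v + lo)) (assoc₂ v lo (+ k)) (sym (ℤ.+-assoc v lo (+ k))) (Col-translate col))
      (Desc-translate D)
      where
      lemma : ∀ u x x′ → u + x - (x′ + 1ℤ) ≡ x - (x′ - u + 1ℤ)
      lemma = ℤ-Ring.solve-∀

-- Edges between adjacent columns.

module Neighbours where
  open import Data.Integer using (_+_; _-_; -_; _≤_)
  open IntegerOrder
  open Columns
  open Enumeration using (Tail; done; solid; split)
  open Descriptions

  record Lookup (M : ℤ → ℤ → Set) (x : ℤ) : Set where
    constructor mkLookup
    field
      {x₀ lo₀ g₀ hi₀ lo g hi} : ℤ
      x≡x₀+1 : x ≡ x₀ + 1ℤ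
      left   : Col M x₀ lo₀ g₀ hi₀
      right  : Col M x lo g hi
      step   : Step lo₀ hi₀ lo g hi

  solid-step : ∀ {s k} (d : Fin (suc s ℕ.+ suc k)) lo lo′ → lo′ + + k ≡ lo + + toℕ d →
               Step lo (lo + + s) lo′ (lo′ + + k + 1ℤ) (lo′ + + k)
  solid-step {s} {k} d lo lo′ eq = solid refl
    (lin₁ (ℤ.+-monoʳ-≤ lo (ℤ.+≤+ (ℕ.s≤s⁻¹ (Fin.toℕ<n d)))) (trans (cong (λ z → lo + (+ s + + suc k) - z) (sym eq)) (lemma lo lo′ (+ s) (+ k))))
    (subst (lo ≤_) (sym eq) (≤+ lo (toℕ d)))
    where
    lemma : ∀ lo lo′ s k → lo + (s + (1ℤ + k)) - (lo′ + k) ≡ lo + s + 1ℤ - lo′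
    lemma = ℤ-Ring.solve-∀

  split-step : ∀ {s} i j (e : Fin s) lo lo′ → lo′ + + suc i ≡ lo + + suc (toℕ e) →
               Step lo (lo + + s) lo′ (lo′ + + suc i) (lo′ + + (2 ℕ.+ i ℕ.+ j))
  split-step {s} i j e lo lo′ eq = split (gap<top lo′ i j)
    (subst (lo + 1ℤ ≤_) (sym eq) (ℤ.+-monoʳ-≤ lo (ℤ.+≤+ (ℕ.s≤s ℕ.z≤n))))
    (subst (_≤ lo + + s) (sym eq) (ℤ.+-monoʳ-≤ lo (ℤ.+≤+ (Fin.toℕ<n e))))

  lookup : ∀ {M x lo g s} {t : Tail s} → Col M x lo g (lo + + s) → Desc M x lo t →
           ∀ {x′ y} → x + 1ℤ ≤ x′ → M x′ y → Lookup M x′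
  lookup c₀ (done none) x<x′ ∈ = ⊥-elim (none _ _ x<x′ ∈)
  lookup {x = x} {lo} c₀ (solid {d = d} lo′ eq c D) x<x′ ∈ with next-or-later {x} x<x′
  ... | inj₁ refl  = mkLookup refl c₀ c (solid-step d lo lo′ eq)
  ... | inj₂ later = lookup c D later ∈
  lookup {x = x} {lo} c₀ (split {i = i} {j} {e} lo′ eq c D) x<x′ ∈ with next-or-later {x} x<x′
  ... | inj₁ refl  = mkLookup refl c₀ c (split-step i j e lo lo′ eq)
  ... | inj₂ later = lookup c D later ∈

  -- The witness for a solid column is the larger of the two bottoms; for a split column it is the
  -- cell next to the gap, `g - 1ℤ` below and `g + 1ℤ` above, which `Step` places among the right
  -- neighbours.
  touching-height : ∀ {lo₀ hi₀ lo g hi b t} → lo₀ ≤ hi₀ → lo ≤ hi → lo + 1ℤ ≤ g → Step lo₀ hi₀ lo g hi →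
    LowerComp lo g hi b t ⊎ UpperComp lo g hi b t → ∃[ y ] (b ≤ y × y ≤ t × lo₀ ≤ y × y ≤ hi₀ + 1ℤ)
  touching-height {lo₀} {hi₀} {lo} {g} {hi} lo₀≤hi₀ lo≤hi lo<g (solid refl lo≤hi₀+1 lo₀≤hi) (inj₁ (refl , refl))
    with dichotomy lo lo₀
  ... | inj₁ lo≤lo₀ = lo₀ , lo≤lo₀ , lin₁ lo₀≤hi (ℤ-Ring.solve (lo₀ ∷ hi ∷ [])) , ℤ.≤-refl
                    , lin₂ lo₀≤hi₀ 0≤1 (ℤ-Ring.solve (lo₀ ∷ hi₀ ∷ []))
  ... | inj₂ lo₀<lo = lo , ℤ.≤-refl , lin₁ lo≤hi (ℤ-Ring.solve (lo ∷ hi ∷ []))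
                    , lin₂ lo₀<lo 0≤1 (ℤ-Ring.solve (lo₀ ∷ lo ∷ [])) , lo≤hi₀+1
  touching-height {hi = hi} _ _ _ (solid refl _ _) (inj₂ (g<hi , _)) = ⊥-elim (contra₂ g<hi 0≤1 (ℤ-Ring.solve (hi ∷ [])))
  touching-height {lo₀} {hi₀} {lo} {g} {hi} _ _ lo<g (split _ lo₀<g g≤hi₀) (inj₁ (refl , refl)) =
    g - 1ℤ , lin₁ lo<g (ℤ-Ring.solve (lo ∷ g ∷ [])) , ℤ.≤-refl , lin₁ lo₀<g (ℤ-Ring.solve (lo₀ ∷ g ∷ []))
    , lin₃ g≤hi₀ 0≤1 0≤1 (ℤ-Ring.solve (g ∷ hi₀ ∷ []))
  touching-height {lo₀} {hi₀} {lo} {g} {hi} _ _ _ (split g<hi lo₀<g g≤hi₀) (inj₂ (_ , refl , refl)) =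
    g + 1ℤ , ℤ.≤-refl , g<hi , lin₃ lo₀<g 0≤1 0≤1 (ℤ-Ring.solve (lo₀ ∷ g ∷ [])) , ℤ.+-monoˡ-≤ 1ℤ g≤hi₀

  -- The left neighbours of a cell at height `y` have heights `y` and `y - 1ℤ`. The second is used
  -- when the first is the gap or lies just above the column; it is then present because a gap is a
  -- single cell.
  left-neighbour : ∀ {M x₀ lo₀ g₀ hi₀ y} → Col M x₀ lo₀ g₀ hi₀ → lo₀ ≤ y → y ≤ hi₀ + 1ℤ →
                   ∃[ y₀ ] (M x₀ y₀ × ShareEdge (x₀ , y₀) (x₀ + 1ℤ , y))
  left-neighbour {M} {x₀} {lo₀} {g₀} {hi₀} {y} c lo₀≤y y≤hi₀+1 with dichotomy y hi₀ | y ℤ.≟ g₀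
  ... | inj₁ y≤hi₀ | no y≢g₀ = y , from c y lo₀≤y y≤hi₀ y≢g₀ , there (there (here refl))
  ... | inj₁ y≤hi₀ | yes refl = y - 1ℤ
    , from c (y - 1ℤ) (lin₁ (lo<g c) (ℤ-Ring.solve (lo₀ ∷ y ∷ [])))
        (lin₂ y≤hi₀ 0≤1 (ℤ-Ring.solve (y ∷ hi₀ ∷ []))) (+1≤⇒≢ {y - 1ℤ} {y} (lin₁ (ℤ.≤-refl {y}) (ℤ-Ring.solve (y ∷ []))))
    , there (there (there (here (cong (x₀ + 1ℤ ,_) (lemma y)))))
    where
    lemma : ∀ y → y ≡ y - 1ℤ + 1ℤ
    lemma = ℤ-Ring.solve-∀
  ... | inj₂ hi₀<y | _ with refl ← ℤ.≤-antisym y≤hi₀+1 hi₀<y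
    = hi₀ , hi∈ c , there (there (there (here refl)))

  -- Of the six edges only two lead to the right, and both end in the next column, at height `y₀` or
  -- `y₀ + 1ℤ`.
  left-neighbour⁻ : ∀ {M x₀ lo₀ g₀ hi₀ y₀ x y} → Col M x₀ lo₀ g₀ hi₀ → M x₀ y₀ → x₀ + 1ℤ ≤ x →
                    ShareEdge (x₀ , y₀) (x , y) → x ≡ x₀ + 1ℤ × lo₀ ≤ y × y ≤ hi₀ + 1ℤ
  left-neighbour⁻ {x₀ = x₀} {lo₀} {g₀} {hi₀} {y₀} c ∈ x₀<x edge with to c ∈ | edge
  ... | _ | here refl = ⊥-elim (contra₁ x₀<x (ℤ-Ring.solve (x₀ ∷ [])))
  ... | _ | there (here refl) = ⊥-elim (contra₁ x₀<x (ℤ-Ring.solve (x₀ ∷ [])))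
  ... | lo₀≤y₀ , y₀≤hi₀ , _ | there (there (here refl)) =
    refl , lo₀≤y₀ , lin₂ y₀≤hi₀ 0≤1 (ℤ-Ring.solve (y₀ ∷ hi₀ ∷ []))
  ... | lo₀≤y₀ , y₀≤hi₀ , _ | there (there (there (here refl))) =
    refl , lin₂ lo₀≤y₀ 0≤1 (ℤ-Ring.solve (y₀ ∷ lo₀ ∷ [])) , ℤ.+-monoˡ-≤ 1ℤ y₀≤hi₀
  ... | _ | there (there (there (there (here refl)))) = ⊥-elim (contra₂ x₀<x 0≤1 (ℤ-Ring.solve (x₀ ∷ [])))
  ... | _ | there (there (there (there (there (here refl))))) = ⊥-elim (contra₂ x₀<x 0≤1 (ℤ-Ring.solve (x₀ ∷ [])))

-- Described sets are connected and cheesy.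

module DescribedCells where
  open import Data.Integer using (_+_; _-_; -_; _≤_)
  open IntegerOrder
  open Columns
  open Enumeration using (Code)
  open Descriptions
  open Neighbours

  Member : List Cell → ℤ → ℤ → Set
  Member L x y = (x , y) ∈ L

  ShareEdge-sym : ∀ {c d} → ShareEdge c d → ShareEdge d c
  ShareEdge-sym {x , y} (here refl) = there (here (cong (x ,_) (lemma y)))
    where
    lemma : ∀ y → y ≡ y + 1ℤ - 1ℤ
    lemma = ℤ-Ring.solve-∀
  ShareEdge-sym {x , y} (there (here refl)) = here (cong (x ,_) (lemma y))
    where
    lemma : ∀ y → y ≡ y - 1ℤ + 1ℤ
    lemma = ℤ-Ring.solve-∀
  ShareEdge-sym {x , y} (there (there (here refl))) = there (there (there (there (here (cong (_, y) (lemma x))))))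
    where
    lemma : ∀ y → y ≡ y + 1ℤ - 1ℤ
    lemma = ℤ-Ring.solve-∀
  ShareEdge-sym {x , y} (there (there (there (here refl)))) =
    there (there (there (there (there (here (cong₂ _,_ (lemma x) (lemma y)))))))
    where
    lemma : ∀ y → y ≡ y + 1ℤ - 1ℤ
    lemma = ℤ-Ring.solve-∀
  ShareEdge-sym {x , y} (there (there (there (there (here refl))))) = there (there (here (cong (_, y) (lemma x))))
    where
    lemma : ∀ y → y ≡ y - 1ℤ + 1ℤ
    lemma = ℤ-Ring.solve-∀
  ShareEdge-sym {x , y} (there (there (there (there (there (here refl)))))) =
    there (there (there (here (cong₂ _,_ (lemma x) (lemma y)))))
    where
    lemma : ∀ y → y ≡ y - 1ℤ + 1ℤ
    lemma = ℤ-Ring.solve-∀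

  component-of : ∀ {M x lo g hi y} → Col M x lo g hi → M x y →
    ∃[ b ] ∃[ t ] (b ≤ y × y ≤ t × Comp M x b t × (LowerComp lo g hi b t ⊎ UpperComp lo g hi b t))
  component-of {lo = lo} {g} {hi} {y} c ∈ with to c ∈ | trichotomy y g
  ... | lo≤y , y≤hi , y≢g | inj₂ (inj₁ y≡g) = ⊥-elim (y≢g y≡g)
  ... | lo≤y , y≤hi , y≢g | inj₁ y<g        =
    lo , g - 1ℤ , lo≤y , lin₁ y<g (ℤ-Ring.solve (g ∷ y ∷ [])) , lowerComp c , inj₁ (refl , refl)
  ... | lo≤y , y≤hi , y≢g | inj₂ (inj₂ g<y) =
    g + 1ℤ , hi , g<y , y≤hi , upperComp c (ℤ.≤-trans g<y y≤hi) , inj₂ (ℤ.≤-trans g<y y≤hi , refl , refl)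

  module _ (L : List Cell) {x lo : ℤ} {c : Code} (D : CodeDesc (Member L) x lo c) where

    open CodeDesc D using (none-left; column; rest) renaming (k to k₀)

    first-or-lookup : ∀ {x′ y} → (x′ , y) ∈ L → x′ ≡ x ⊎ Lookup (Member L) x′
    first-or-lookup {x′} {y} ∈ with trichotomy x x′
    ... | inj₁ x<x′        = inj₂ (lookup column rest x<x′ ∈)
    ... | inj₂ (inj₁ x≡x′) = inj₁ (sym x≡x′)
    ... | inj₂ (inj₂ x′<x) = ⊥-elim (none-left x′ y x′<x ∈)

    column-at : ∀ {x′ y} → (x′ , y) ∈ L → ∃[ lo′ ] ∃[ g ] ∃[ hi ] Col (Member L) x′ lo′ g hi
    column-at ∈ with first-or-lookup ∈
    ... | inj₁ refl = _ , _ , _ , column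
    ... | inj₂ l    = _ , _ , _ , Lookup.right l

    -- Unlike the paths in `Connected`, these steps record both ends as members, which makes them
    -- reversible.
    Edge : Cell → Cell → Set
    Edge a b = a ∈ L × b ∈ L × ShareEdge a b

    Edge-sym : ∀ {a b} → Edge a b → Edge b a
    Edge-sym (a∈ , b∈ , e) = b∈ , a∈ , ShareEdge-sym e

    reverse : ∀ {a b} → Star Edge a b → Star Edge b a
    reverse = Star.reverse Edge-sym

    descend : ∀ {x′ b t} → Comp (Member L) x′ b t → ∀ n y → y ≡ b + + n → y ≤ t → Star Edge (x′ , y) (x′ , b)
    descend {x′} {b} cp zero y refl y≤t = subst (λ z → Star Edge (x′ , z) (x′ , b)) (sym (ℤ.+-identityʳ b)) Star.ε
    descend {x′} {b} {t} cp (suc n) y refl y≤t =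
      (Comp.filled cp _ (≤+ b (suc n)) y≤t , Comp.filled cp _ (≤+ b n) b+n≤t , there (here (cong (x′ ,_) (lemma b (+ n)))))
      ◅ descend cp n (b + + n) refl b+n≤t
      where
      lemma : ∀ b n → b + n ≡ b + (1ℤ + n) - 1ℤ
      lemma = ℤ-Ring.solve-∀
      lemma′ : ∀ b n t → t - (b + (1ℤ + n)) + (1ℤ - 0ℤ) ≡ t - (b + n)
      lemma′ = ℤ-Ring.solve-∀
      b+n≤t : b + + n ≤ t
      b+n≤t = lin₂ y≤t 0≤1 (lemma′ b (+ n) t)

    within : ∀ {x′ b t y y′} → Comp (Member L) x′ b t → b ≤ y → y ≤ t → b ≤ y′ → y′ ≤ t →
             Star Edge (x′ , y) (x′ , y′)
    within cp b≤y y≤t b≤y′ y′≤t with ≤⇒∃+ b≤y | ≤⇒∃+ b≤y′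
    ... | n , eq | n′ , eq′ = descend cp n _ eq y≤t ◅◅ reverse (descend cp n′ _ eq′ y′≤t)

    -- Induction on the distance from the first column: inside its component a cell reaches a height
    -- that has a left neighbour, and the path continues there.
    to-base : ∀ n {x′ y} → x′ ≡ x + + n → (x′ , y) ∈ L → Star Edge (x′ , y) (x , lo)
    to-base n {x′} {y} eq ∈ with first-or-lookup ∈
    ... | inj₁ refl with component-of column ∈
    ...   | b , t , b≤y , y≤t , cp , inj₁ (refl , refl) = within cp b≤y y≤t ℤ.≤-refl (Comp.b≤t cp)
    ...   | b , t , b≤y , y≤t , cp , inj₂ (g<hi , _)    = ⊥-elim (contra₂ g<hi 0≤1 (lemma (lo + + k₀)))
      where
      lemma : ∀ z → z - (z + 1ℤ + 1ℤ) + (1ℤ - 0ℤ) ≡ - 1ℤ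
      lemma = ℤ-Ring.solve-∀
    to-base zero {x′} {y} eq ∈ | inj₂ (mkLookup {x₀} {lo₀} refl left _ _) =
      ⊥-elim (none-left x₀ lo₀ (ℤ.≤-reflexive (trans eq (ℤ.+-identityʳ x))) (lo∈ left))
    to-base (suc n) {x′} {y} eq ∈ | inj₂ (mkLookup {x₀} refl left right step)
      with component-of right ∈
    ... | b , t , b≤y , y≤t , cp , kind
      with touching-height (lo≤hi left) (lo≤hi right) (lo<g right) step kind
    ... | y′ , b≤y′ , y′≤t , lo₀≤y′ , y′≤hi₀+1
      with left-neighbour left lo₀≤y′ y′≤hi₀+1
    ... | y₀ , y₀∈ , edge =
      within cp b≤y y≤t b≤y′ y′≤t ◅◅
      ((Comp.filled cp y′ b≤y′ y′≤t , y₀∈ , ShareEdge-sym edge) ◅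
       to-base n (trans (lemma₁ x₀) (trans (cong (_- 1ℤ) eq) (lemma₂ x (+ n)))) y₀∈)
      where
      lemma₁ : ∀ x₀ → x₀ ≡ x₀ + 1ℤ - 1ℤ
      lemma₁ = ℤ-Ring.solve-∀
      lemma₂ : ∀ x n → x + (1ℤ + n) - 1ℤ ≡ x + n
      lemma₂ = ℤ-Ring.solve-∀

    base≤ : ∀ {x′ y} → (x′ , y) ∈ L → x ≤ x′
    base≤ {x′} {y} ∈ with dichotomy x x′
    ... | inj₁ x≤x′ = x≤x′
    ... | inj₂ x′<x = ⊥-elim (none-left x′ y x′<x ∈)

    abstract
      described⇒connected : Connected L
      described⇒connected {a} {b} a∈ b∈ with ≤⇒∃+ (base≤ a∈) | ≤⇒∃+ (base≤ b∈)
      ... | n , eq | n′ , eq′ = Star.map (λ (_ , b∈ , e) → e , b∈) (to-base n eq a∈ ◅◅ reverse (to-base n′ eq′ b∈))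

  module _ (P : Polyomino) {x lo : ℤ} {c : Code} (D : CodeDesc (Member (cells P)) x lo c) where

    open CodeDesc D using (none-left; column; rest) renaming (k to k₀)

    private
      comp : ∀ {x′} (C : Component P x′) → Comp (Member (cells P)) x′ (bottom C) (top C)
      comp C = let open IsComponent (Component.isComponent C) in mkComp bottom≤top filled below∉ above∉

    abstract
      described⇒cheesy : IsCheesy 1 P
      described⇒cheesy = record
        { rightwardSemiDirected = record
          { firstColumn     = firstColumn
          ; adjacentColumns = adjacentColumns
          }
        ; atMostTwoComponents = atMostTwo
        ; gapsAtMost          = gaps
        }
        where
        firstColumn : ∀ x′ → IsFirstColumn P x′ → NoGap P x′
        firstColumn x′ ((y , ∈) , least)
          with refl ← ℤ.≤-antisym (least x (lo , lo∈ column)) (base≤ (cells P) D ∈) = λ C C′ → same (component-cases column (comp C)) (component-cases column (comp C′))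
          where
          g hi : ℤ
          g  = lo + + k₀ + 1ℤ
          hi = lo + + k₀
          impossible : ∀ {A : Set} → g + 1ℤ ≤ hi → A
          impossible g<hi = ⊥-elim (contra₂ g<hi 0≤1 (lemma hi))
            where
            lemma : ∀ z → z - (z + 1ℤ + 1ℤ) + (1ℤ - 0ℤ) ≡ - 1ℤ
            lemma = ℤ-Ring.solve-∀
          same : ∀ {b t b′ t′} → LowerComp lo g hi b t ⊎ UpperComp lo g hi b t →
                 LowerComp lo g hi b′ t′ ⊎ UpperComp lo g hi b′ t′ → b ≡ b′ × t ≡ t′
          same (inj₁ (refl , refl)) (inj₁ (refl , refl)) = refl , refl
          same (inj₂ (g<hi , _))    _                    = impossible g<hi
          same (inj₁ _)             (inj₂ (g<hi , _))    = impossible g<hi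

        adjacentColumns : ∀ x₁ x₂ → AdjacentColumns P x₁ x₂ → (C : Component P x₂) → TouchesColumn P x₁ C
        adjacentColumns x₁ x₂ ((y₁ , ∈₁) , (y₂ , ∈₂) , x₁<x₂ , between) C with first-or-lookup (cells P) D ∈₂
        ... | inj₁ refl = ⊥-elim (contra₂ (<⇒+1≤ x₁<x₂) (base≤ (cells P) D ∈₁) (ℤ-Ring.solve (x₁ ∷ x₂ ∷ [])))
        ... | inj₂ (mkLookup {x₀} {lo₀} refl left right step) = found (trichotomy x₁ x₀)
          where
          found : x₁ + 1ℤ ≤ x₀ ⊎ x₁ ≡ x₀ ⊎ x₀ + 1ℤ ≤ x₁ → TouchesColumn P x₁ C
          found (inj₁ x₁<x₀) = ⊥-elim (between x₀ (+1≤⇒< x₁<x₀) (+1≤⇒< ℤ.≤-refl) (lo₀ , lo∈ left))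
          found (inj₂ (inj₂ x₀<x₁)) = ⊥-elim (contra₂ (<⇒+1≤ x₁<x₂) x₀<x₁ (ℤ-Ring.solve (x₁ ∷ x₀ ∷ [])))
          found (inj₂ (inj₁ refl))
            with touching-height (lo≤hi left) (lo≤hi right) (lo<g right) step (component-cases right (comp C))
          ... | y′ , b≤y′ , y′≤t , lo₀≤y′ , y′≤hi₀+1 with left-neighbour left lo₀≤y′ y′≤hi₀+1
          ...   | y₀ , y₀∈ , edge = y₀ , y′ , y₀∈ , b≤y′ , y′≤t , edge

        atMostTwo : ∀ x′ → IsColumn P x′ → AtMostTwoComponents P x′
        atMostTwo x′ (y , ∈) C C′ C″ with column-at (cells P) D ∈
        ... | lo′ , g , hi , col = pigeonhole (component-cases col (comp C)) (component-cases col (comp C′)) (component-cases col (comp C″))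
          where
          pigeonhole : ∀ {b t b′ t′ b″ t″} → LowerComp lo′ g hi b t ⊎ UpperComp lo′ g hi b t →
            LowerComp lo′ g hi b′ t′ ⊎ UpperComp lo′ g hi b′ t′ → LowerComp lo′ g hi b″ t″ ⊎ UpperComp lo′ g hi b″ t″ →
            (b ≡ b′ × t ≡ t′) ⊎ (b ≡ b″ × t ≡ t″) ⊎ (b′ ≡ b″ × t′ ≡ t″)
          pigeonhole (inj₁ (refl , refl))     (inj₁ (refl , refl))     _                        = inj₁ (refl , refl)
          pigeonhole (inj₁ (refl , refl))     (inj₂ _)                 (inj₁ (refl , refl))     = inj₂ (inj₁ (refl , refl))
          pigeonhole (inj₁ _)                 (inj₂ (_ , refl , refl)) (inj₂ (_ , refl , refl)) = inj₂ (inj₂ (refl , refl))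
          pigeonhole (inj₂ (_ , refl , refl)) (inj₂ (_ , refl , refl)) _                        = inj₁ (refl , refl)
          pigeonhole (inj₂ (_ , refl , refl)) (inj₁ _)                 (inj₂ (_ , refl , refl)) = inj₂ (inj₁ (refl , refl))
          pigeonhole (inj₂ _)                 (inj₁ (refl , refl))     (inj₁ (refl , refl))     = inj₂ (inj₂ (refl , refl))

        gaps : ∀ x′ → IsColumn P x′ → GapsAtMost 1 P x′
        gaps x′ (y , ∈) C C′ C<C′ with column-at (cells P) D ∈
        ... | lo′ , g , hi , col = bound (component-cases col (comp C)) (component-cases col (comp C′)) (<⇒+1≤ C<C′)
          where
          bound : ∀ {b t b′ t′} → LowerComp lo′ g hi b t ⊎ UpperComp lo′ g hi b t →
            LowerComp lo′ g hi b′ t′ ⊎ UpperComp lo′ g hi b′ t′ → t + 1ℤ ≤ b′ → b′ - t - 1ℤ ≤ 1ℤ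
          bound (inj₁ (refl , refl)) (inj₁ (refl , refl)) t<b′ =
            ⊥-elim (contra₂ t<b′ (lo<g col) (ℤ-Ring.solve (g ∷ lo′ ∷ [])))
          bound (inj₁ (refl , refl)) (inj₂ (_ , refl , refl)) t<b′ = ℤ.≤-reflexive (ℤ-Ring.solve (g ∷ []))
          bound (inj₂ (g<hi , refl , refl)) (inj₁ (refl , refl)) t<b′ =
            ⊥-elim (contra₂ t<b′ (lo≤hi col) (ℤ-Ring.solve (hi ∷ lo′ ∷ [])))
          bound (inj₂ (g<hi , refl , refl)) (inj₂ (_ , refl , refl)) t<b′ =
            ⊥-elim (contra₂ t<b′ g<hi (ℤ-Ring.solve (g ∷ hi ∷ [])))

-- Vertical runs of cells.

module Runs where
  open import Data.Integer using (_+_; _≤_)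
  open IntegerOrder
  open Descriptions using (+-injectiveˡ)

  abstract
    run : ℤ → ℤ → ℕ → List Cell
    run x lo n = map (λ i → (x , lo + + i)) (upTo n)

    length-run : ∀ x lo n → length (run x lo n) ≡ n
    length-run x lo n = trans (length-map _ (upTo n)) (length-upTo n)

    run-unique : ∀ x lo n → Unique (run x lo n)
    run-unique x lo n = Unique.map⁺ (λ eq → +-injectiveˡ lo (cong proj₂ eq)) (Unique.upTo⁺ n)

    ∈-run⁺ : ∀ x {lo} k {y} → lo ≤ y → y ≤ lo + + k → (x , y) ∈ run x lo (suc k)
    ∈-run⁺ x {lo} k lo≤y y≤lo+k with ≤⇒∃+ lo≤y
    ... | n , refl = ∈-map⁺ (λ i → (x , lo + + i)) (∈-upTo⁺ (ℕ.s≤s (ℤ.drop‿+≤+ (+-cancelˡ-≤ lo y≤lo+k))))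

    ∈-run⁻ : ∀ x {lo} k {x′ y} → (x′ , y) ∈ run x lo (suc k) → x′ ≡ x × lo ≤ y × y ≤ lo + + k
    ∈-run⁻ x {lo} k ∈ with ∈-map⁻ (λ i → (x , lo + + i)) ∈
    ... | i , i∈ , refl = refl , ≤+ lo i , ℤ.+-monoʳ-≤ lo (ℤ.+≤+ (ℕ.s≤s⁻¹ (∈-upTo⁻ i∈)))

-- Every code is realized by a cheesy polyomino.

module Realization where
  open import Data.Integer using (_+_; _-_; -_; _≤_)
  open IntegerOrder
  open Columns
  open Enumeration using (Tail; done; solid; split; Code; tailSize; codeSize)
  open Descriptions
  open DescribedCells
  open Runs

  -- `solidLo` and `splitLo` solve the equations in `Desc` for the bottom of the new column.
  solidLo : ∀ {s} k → Fin (suc s ℕ.+ suc k) → ℤ → ℤ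
  solidLo k d lo = lo + + toℕ d - + k

  splitLo : ∀ {s} → ℕ → Fin s → ℤ → ℤ
  splitLo i e lo = lo + + suc (toℕ e) - + suc i

  tailCells : ∀ {s} → ℤ → ℤ → Tail s → List Cell
  tailCells x lo done = []
  tailCells x lo (solid k d t) =
    run (x + 1ℤ) (solidLo k d lo) (suc k) ++ tailCells (x + 1ℤ) (solidLo k d lo) t
  tailCells x lo (split i j e t) =
    run (x + 1ℤ) (splitLo i e lo) (suc i) ++
    run (x + 1ℤ) (splitLo i e lo + + (2 ℕ.+ i)) (suc j) ++
    tailCells (x + 1ℤ) (splitLo i e lo) t

  codeCells : Code → List Cell
  codeCells (k , t) = run 0ℤ 0ℤ (suc k) ++ tailCells 0ℤ 0ℤ t

  later⇒right : ∀ {x x′} → x + 1ℤ + 1ℤ ≤ x′ → x + 1ℤ ≤ x′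
  later⇒right {x} {x′} le = lin₂ le 0≤1 (ℤ-Ring.solve (x ∷ x′ ∷ []))

  later≢ : ∀ {x} {A : Set} → x + 1ℤ ≤ x → A
  later≢ {x} le = ⊥-elim (contra₁ le (ℤ-Ring.solve (x ∷ [])))

  tailCells-right : ∀ {s x lo x′ y} (t : Tail s) → (x′ , y) ∈ tailCells x lo t → x + 1ℤ ≤ x′
  tailCells-right {x = x} {lo} (solid k d t) ∈ with ∈-++⁻ (run (x + 1ℤ) (solidLo k d lo) (suc k)) ∈
  ... | inj₁ ∈run  = ℤ.≤-reflexive (sym (proj₁ (∈-run⁻ (x + 1ℤ) k ∈run)))
  ... | inj₂ ∈rest = later⇒right {x} (tailCells-right t ∈rest)
  tailCells-right {x = x} {lo} (split i j e t) ∈ with ∈-++⁻ (run (x + 1ℤ) (splitLo i e lo) (suc i)) ∈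
  ... | inj₁ ∈low = ℤ.≤-reflexive (sym (proj₁ (∈-run⁻ (x + 1ℤ) i ∈low)))
  ... | inj₂ ∈more with ∈-++⁻ (run (x + 1ℤ) (splitLo i e lo + + (2 ℕ.+ i)) (suc j)) ∈more
  ...   | inj₁ ∈high = ℤ.≤-reflexive (sym (proj₁ (∈-run⁻ (x + 1ℤ) j ∈high)))
  ...   | inj₂ ∈rest = later⇒right {x} (tailCells-right t ∈rest)

  length-tailCells : ∀ {s} x lo (t : Tail s) → length (tailCells x lo t) ≡ tailSize t
  length-tailCells x lo done = refl
  length-tailCells x lo (solid k d t) = trans (length-++ (run (x + 1ℤ) (solidLo k d lo) (suc k)))
    (cong₂ ℕ._+_ (length-run (x + 1ℤ) (solidLo k d lo) (suc k)) (length-tailCells (x + 1ℤ) (solidLo k d lo) t))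
  length-tailCells x lo (split i j e t) = trans (length-++ (run (x + 1ℤ) (splitLo i e lo) (suc i)))
    (cong₂ ℕ._+_ (length-run (x + 1ℤ) (splitLo i e lo) (suc i))
      (trans (length-++ (run (x + 1ℤ) (splitLo i e lo + + (2 ℕ.+ i)) (suc j)))
        (cong₂ ℕ._+_ (length-run (x + 1ℤ) (splitLo i e lo + + (2 ℕ.+ i)) (suc j))
                     (length-tailCells (x + 1ℤ) (splitLo i e lo) t))))

  length-codeCells : ∀ c → length (codeCells c) ≡ codeSize c
  length-codeCells (k , t) = trans (length-++ (run 0ℤ 0ℤ (suc k)))
    (cong₂ ℕ._+_ (length-run 0ℤ 0ℤ (suc k)) (length-tailCells 0ℤ 0ℤ t))

  run-tail-disjoint : ∀ {s x lo lo′ n c} (t : Tail s) → c ∈ run x lo (suc n) × c ∈ tailCells x lo′ t → ⊥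
  run-tail-disjoint {x = x} {n = n} t (∈run , ∈tail)
    with refl ← proj₁ (∈-run⁻ x n ∈run) = later≢ {x} (tailCells-right t ∈tail)

  gap-below : ∀ lo i {y} → y ≤ lo + + i → lo + + (2 ℕ.+ i) ≤ y → ⊥
  gap-below lo i {y} y≤ ≤y = contra₂ (ℤ.≤-trans ≤y y≤) 0≤1 (lemma lo (+ i))
    where
    lemma : ∀ lo i → lo + i - (lo + (1ℤ + (1ℤ + i))) + (1ℤ - 0ℤ) ≡ - 1ℤ
    lemma = ℤ-Ring.solve-∀

  tailCells-unique : ∀ {s} x lo (t : Tail s) → Unique (tailCells x lo t)
  tailCells-unique x lo done = AllPairs.[]
  tailCells-unique x lo (solid k d t) = Unique.++⁺ (run-unique (x + 1ℤ) (solidLo k d lo) (suc k))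
    (tailCells-unique (x + 1ℤ) (solidLo k d lo) t) (run-tail-disjoint {n = k} t)
  tailCells-unique x lo (split i j e t) = Unique.++⁺ (run-unique (x + 1ℤ) lo′ (suc i))
    (Unique.++⁺ (run-unique (x + 1ℤ) (lo′ + + (2 ℕ.+ i)) (suc j)) (tailCells-unique (x + 1ℤ) lo′ t)
      (run-tail-disjoint {n = j} t)) disjoint
    where
    lo′ = splitLo i e lo
    disjoint : ∀ {c} → c ∈ run (x + 1ℤ) lo′ (suc i) ×
               c ∈ run (x + 1ℤ) (lo′ + + (2 ℕ.+ i)) (suc j) ++ tailCells (x + 1ℤ) lo′ t → ⊥
    disjoint (∈low , ∈more) with ∈-++⁻ (run (x + 1ℤ) (lo′ + + (2 ℕ.+ i)) (suc j)) ∈more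
    ... | inj₁ ∈high = gap-below lo′ i (proj₂ (proj₂ (∈-run⁻ (x + 1ℤ) i ∈low))) (proj₁ (proj₂ (∈-run⁻ (x + 1ℤ) j ∈high)))
    ... | inj₂ ∈rest = run-tail-disjoint {n = i} t (∈low , ∈rest)

  abstract
    codeCells-unique : ∀ c → Unique (codeCells c)
    codeCells-unique (k , t) = Unique.++⁺ (run-unique 0ℤ 0ℤ (suc k)) (tailCells-unique 0ℤ 0ℤ t) (run-tail-disjoint {n = k} t)

  ∈-++-right : ∀ {x y k x′ lo} {L : List Cell} → x + 1ℤ ≤ x′ → (x′ , y) ∈ run x lo (suc k) ++ L → (x′ , y) ∈ L
  ∈-++-right {x} {k = k} {lo = lo} x<x′ ∈ with ∈-++⁻ (run x lo (suc k)) ∈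
  ... | inj₂ ∈L = ∈L
  ... | inj₁ ∈run with refl ← proj₁ (∈-run⁻ x k ∈run) = later≢ {x} x<x′

  solid-column : ∀ {s} {M : ℤ → ℤ → Set} x lo lo′ k (t : Tail s) →
    (∀ y → M x y ⇔ (x , y) ∈ run x lo (suc k) ++ tailCells x lo′ t) →
    Col M x lo (lo + + k + 1ℤ) (lo + + k)
  solid-column {M = M} x lo lo′ k t M⇔ = mkCol (ℤ.+-monoˡ-≤ 1ℤ (≤+ lo k)) ℤ.≤-refl
    (λ eq → +1≤⇒≢ {lo + + k} ℤ.≤-refl (sym eq)) to′
    (λ y lo≤y y≤hi _ → Equivalence.from (M⇔ y) (∈-++⁺ˡ (∈-run⁺ x k lo≤y y≤hi)))
    where
    to′ : ∀ {y} → M x y → lo ≤ y × y ≤ lo + + k × y ≢ lo + + k + 1ℤ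
    to′ {y} ∈ with ∈-++⁻ (run x lo (suc k)) (Equivalence.to (M⇔ y) ∈)
    ... | inj₂ ∈rest = later≢ {x} (tailCells-right t ∈rest)
    ... | inj₁ ∈run  = let _ , lo≤y , y≤hi = ∈-run⁻ x k ∈run in
      lo≤y , y≤hi , λ { refl → +1≤⇒≢ y≤hi refl }

  split-column : ∀ {s} {M : ℤ → ℤ → Set} x lo i j (t : Tail s) →
    (∀ y → M x y ⇔ (x , y) ∈ run x lo (suc i) ++ run x (lo + + (2 ℕ.+ i)) (suc j) ++ tailCells x lo t) →
    Col M x lo (lo + + suc i) (lo + + (2 ℕ.+ i ℕ.+ j))
  split-column {M = M} x lo i j t M⇔ = mkCol
    (ℤ.+-monoʳ-≤ lo (ℤ.+≤+ (ℕ.s≤s ℕ.z≤n)))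
    (lin₃ (gap<top lo i j) 0≤1 0≤1 (lemma₀ (lo + + suc i) (lo + + (2 ℕ.+ i ℕ.+ j))))
    (+1≤⇒≢ (gap<top lo i j)) to′ from′
    where
    lemma₀ : ∀ a b → b - (a + 1ℤ) + (1ℤ - 0ℤ + (1ℤ - 0ℤ)) ≡ b + 1ℤ - a
    lemma₀ = ℤ-Ring.solve-∀
    hi≡ : lo + + (2 ℕ.+ i) + + j ≡ lo + + (2 ℕ.+ i ℕ.+ j)
    hi≡ = ℤ.+-assoc lo (+ (2 ℕ.+ i)) (+ j)
    mid : lo + + (2 ℕ.+ i) ≡ lo + + suc i + 1ℤ
    mid = lemma lo (+ i)
      where
      lemma : ∀ lo i → lo + (1ℤ + (1ℤ + i)) ≡ lo + (1ℤ + i) + 1ℤ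
      lemma = ℤ-Ring.solve-∀
    mid′ : lo + + suc i ≡ lo + + i + 1ℤ
    mid′ = lemma lo (+ i)
      where
      lemma : ∀ lo i → lo + (1ℤ + i) ≡ lo + i + 1ℤ
      lemma = ℤ-Ring.solve-∀
    to′ : ∀ {y} → M x y → lo ≤ y × y ≤ lo + + (2 ℕ.+ i ℕ.+ j) × y ≢ lo + + suc i
    to′ {y} ∈ with ∈-++⁻ (run x lo (suc i)) (Equivalence.to (M⇔ y) ∈)
    ... | inj₁ ∈low = let _ , lo≤y , y≤ = ∈-run⁻ x i ∈low in
      lo≤y , ℤ.≤-trans y≤ (ℤ.+-monoʳ-≤ lo (ℤ.+≤+ (ℕ.m≤n⇒m≤1+n (ℕ.m≤n⇒m≤1+n (ℕ.m≤m+n i j)))))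
           , +1≤⇒≢ (subst (y + 1ℤ ≤_) (sym mid′) (ℤ.+-monoˡ-≤ 1ℤ y≤))
    ... | inj₂ ∈more with ∈-++⁻ (run x (lo + + (2 ℕ.+ i)) (suc j)) ∈more
    ...   | inj₂ ∈rest = later≢ {x} (tailCells-right t ∈rest)
    ...   | inj₁ ∈high = let _ , ≤y , y≤ = ∈-run⁻ x j ∈high in
      ℤ.≤-trans (≤+ lo (2 ℕ.+ i)) ≤y , subst (y ≤_) hi≡ y≤ , λ eq → +1≤⇒≢ (subst (_≤ y) mid ≤y) (sym eq)
    from′ : ∀ y → lo ≤ y → y ≤ lo + + (2 ℕ.+ i ℕ.+ j) → y ≢ lo + + suc i → M x y
    from′ y lo≤y y≤hi y≢g with trichotomy y (lo + + suc i)
    ... | inj₁ y<g        = Equivalence.from (M⇔ y) (∈-++⁺ˡ (∈-run⁺ x i lo≤y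
      (lin₁ (subst (y + 1ℤ ≤_) mid′ y<g) (lemma y (lo + + i)))))
      where
      lemma : ∀ y a → a + 1ℤ - (y + 1ℤ) ≡ a - y
      lemma = ℤ-Ring.solve-∀
    ... | inj₂ (inj₁ y≡g) = ⊥-elim (y≢g y≡g)
    ... | inj₂ (inj₂ g<y) = Equivalence.from (M⇔ y) (∈-++⁺ʳ (run x lo (suc i)) (∈-++⁺ˡ
      (∈-run⁺ x j (subst (_≤ y) (sym mid) g<y) (subst (y ≤_) (sym hi≡) y≤hi))))

  -- `M` is compared with the list only to the right of `x`. The claim can thus pass to the
  -- remainder of the list, one column further, while `M` stays fixed.
  tailCells-described : ∀ {s} {M : ℤ → ℤ → Set} x lo (t : Tail s) →
    (∀ x′ y → x + 1ℤ ≤ x′ → M x′ y ⇔ (x′ , y) ∈ tailCells x lo t) → Desc M x lo t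
  tailCells-described x lo done M⇔ = done λ x′ y x<x′ ∈ → ⊥-elim (empty (Equivalence.to (M⇔ x′ y x<x′) ∈))
    where
    empty : ∀ {c : Cell} → c ∉ []
    empty ()
  tailCells-described x lo (solid k d t) M⇔ = solid lo′ (lemma lo (+ toℕ d) (+ k))
    (solid-column (x + 1ℤ) lo′ lo′ k t (λ y → M⇔ (x + 1ℤ) y ℤ.≤-refl))
    (tailCells-described (x + 1ℤ) lo′ t λ x′ y later → mk⇔
      (λ ∈ → ∈-++-right {k = k} later (Equivalence.to (M⇔ x′ y (later⇒right {x} later)) ∈))
      (λ ∈ → Equivalence.from (M⇔ x′ y (later⇒right {x} later)) (∈-++⁺ʳ (run (x + 1ℤ) lo′ (suc k)) ∈)))
    where
    lo′ = solidLo k d lo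
    lemma : ∀ lo d k → lo + d - k + k ≡ lo + d
    lemma = ℤ-Ring.solve-∀
  tailCells-described x lo (split i j e t) M⇔ = split lo′ (lemma lo (+ suc (toℕ e)) (+ suc i))
    (split-column (x + 1ℤ) lo′ i j t (λ y → M⇔ (x + 1ℤ) y ℤ.≤-refl))
    (tailCells-described (x + 1ℤ) lo′ t λ x′ y later → mk⇔
      (λ ∈ → ∈-++-right {k = j} later (∈-++-right {k = i} later (Equivalence.to (M⇔ x′ y (later⇒right {x} later)) ∈)))
      (λ ∈ → Equivalence.from (M⇔ x′ y (later⇒right {x} later))
        (∈-++⁺ʳ (run (x + 1ℤ) lo′ (suc i)) (∈-++⁺ʳ (run (x + 1ℤ) (lo′ + + (2 ℕ.+ i)) (suc j)) ∈))))
    where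
    lo′ = splitLo i e lo
    lemma : ∀ lo d k → lo + d - k + k ≡ lo + d
    lemma = ℤ-Ring.solve-∀

  abstract
    codeCells-described : ∀ c → CodeDesc (Member (codeCells c)) 0ℤ 0ℤ c
    codeCells-described (k , t) = codeDesc none-left
      (solid-column 0ℤ 0ℤ 0ℤ k t (λ y → mk⇔ (λ ∈ → ∈) (λ ∈ → ∈)))
      (tailCells-described 0ℤ 0ℤ t λ x′ y later → mk⇔ (∈-++-right {k = k} later) (∈-++⁺ʳ (run 0ℤ 0ℤ (suc k))))
      where
      none-left : ∀ x′ y → x′ + 1ℤ ≤ 0ℤ → (x′ , y) ∉ codeCells (k , t)
      none-left x′ y x′<0 ∈ with ∈-++⁻ (run 0ℤ 0ℤ (suc k)) ∈
      ... | inj₁ ∈run with refl ← proj₁ (∈-run⁻ 0ℤ k ∈run) = later≢ {0ℤ} x′<0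
      ... | inj₂ ∈tail = contra₂ x′<0 (0≤x′ (tailCells-right t ∈tail)) (lemma′ x′)
        where
        0≤x′ : 0ℤ + 1ℤ ≤ x′ → 0ℤ ≤ x′
        0≤x′ le = lin₂ le 0≤1 (ℤ-Ring.solve (x′ ∷ []))
        lemma′ : ∀ x → 0ℤ - (x + 1ℤ) + (x - 0ℤ) ≡ - 1ℤ
        lemma′ = ℤ-Ring.solve-∀

  codePolyomino : Code → Polyomino
  codePolyomino c = record
    { cells     = codeCells c
    ; unique    = codeCells-unique c
    ; nonEmpty  = _ , lo∈ (CodeDesc.column (codeCells-described c))
    ; connected = described⇒connected (codeCells c) (codeCells-described c)
    }

  codeCheesy : ∀ {n} c → codeSize c ≡ n → CheesyPolyomino 1 n
  codeCheesy c size≡ = record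
    { polyomino = codePolyomino c
    ; isCheesy  = described⇒cheesy (codePolyomino c) (codeCells-described c)
    ; size≡n    = trans (length-codeCells c) size≡
    }

-- Every cheesy polyomino has a code.

module Reconstruction where
  open import Data.Integer using (_+_; _-_; -_; _≤_; _<_)
  open IntegerOrder
  open Columns
  open Enumeration using (done; solid; split)
  open Descriptions
  open Neighbours
  open DescribedCells

  Least : (ℤ → Set) → ℤ → ℤ → Set
  Least Q a m = a ≤ m × Q m × (∀ w → a ≤ w → w + 1ℤ ≤ m → ¬ Q w)

  module _ {Q : ℤ → Set} (Q? : ∀ z → Dec (Q z)) where

    search : ∀ a n → Q (a + + n) → ∃[ m ] Least Q a m
    search a n q with Q? a
    ... | yes qa = a , ℤ.≤-refl , qa , λ w a≤w w<a _ → contra₂ a≤w w<a (ℤ-Ring.solve (a ∷ w ∷ []))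
    search a zero q | no ¬qa = ⊥-elim (¬qa (subst Q (ℤ.+-identityʳ a) q))
    search a (suc n) q | no ¬qa with search (a + 1ℤ) n (subst Q (sym (ℤ.+-assoc a 1ℤ (+ n))) q)
    ... | m , a<m , qm , least = m , lin₂ a<m 0≤1 (ℤ-Ring.solve (a ∷ m ∷ [])) , qm , least′
      where
      least′ : ∀ w → a ≤ w → w + 1ℤ ≤ m → ¬ Q w
      least′ w a≤w w<m qw with trichotomy a w
      ... | inj₁ a<w         = least w a<w w<m qw
      ... | inj₂ (inj₁ refl) = ¬qa qw
      ... | inj₂ (inj₂ w<a)  = contra₂ a≤w w<a (ℤ-Ring.solve (a ∷ w ∷ []))

    least-from : ∀ {a z} → a ≤ z → Q z → ∃[ m ] Least Q a m
    least-from {a} a≤z q with ≤⇒∃+ a≤z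
    ... | n , refl = search a n q

  lower-bound : ∀ (L : List Cell) → ∃[ b ] (∀ {x y} → (x , y) ∈ L → b ≤ x × b ≤ y)
  lower-bound [] = 0ℤ , λ ()
  lower-bound ((x , y) ∷ L) with lower-bound L
  ... | b , bound = x ℤ.⊓ y ℤ.⊓ b , λ where
    (here refl) → ℤ.≤-trans (ℤ.i⊓j≤i (x ℤ.⊓ y) b) (ℤ.i⊓j≤i x y) , ℤ.≤-trans (ℤ.i⊓j≤i (x ℤ.⊓ y) b) (ℤ.i⊓j≤j x y)
    (there ∈)   → let ≤x , ≤y = bound ∈ in
      ℤ.≤-trans (ℤ.i⊓j≤j (x ℤ.⊓ y) b) ≤x , ℤ.≤-trans (ℤ.i⊓j≤j (x ℤ.⊓ y) b) ≤y

  upper-bound : ∀ (L : List Cell) → ∃[ b ] (∀ {x y} → (x , y) ∈ L → x ≤ b × y ≤ b)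
  upper-bound [] = 0ℤ , λ ()
  upper-bound ((x , y) ∷ L) with upper-bound L
  ... | b , bound = x ℤ.⊔ y ℤ.⊔ b , λ where
    (here refl) → ℤ.≤-trans (ℤ.i≤i⊔j x y) (ℤ.i≤i⊔j (x ℤ.⊔ y) b) , ℤ.≤-trans (ℤ.i≤j⊔i x y) (ℤ.i≤i⊔j (x ℤ.⊔ y) b)
    (there ∈)   → let x≤ , y≤ = bound ∈ in
      ℤ.≤-trans x≤ (ℤ.i≤j⊔i (x ℤ.⊔ y) b) , ℤ.≤-trans y≤ (ℤ.i≤j⊔i (x ℤ.⊔ y) b)

  split-top : ∀ a i j → a + (1ℤ + i) + 1ℤ + j ≡ a + (1ℤ + (1ℤ + (i + j)))
  split-top = ℤ-Ring.solve-∀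

  -- The inequalities of `Step` are exactly the bounds on the `Fin` indices, and the differences
  -- that they provide are the sizes and offsets of the code.
  extend : ∀ {M x lo s lo′ s′ g′} → Step lo (lo + + s) lo′ g′ (lo′ + + s′) →
           Col M (x + 1ℤ) lo′ g′ (lo′ + + s′) → ∃[ t ] Desc M (x + 1ℤ) lo′ {s′} t →
           ∃[ t ] Desc M x lo {s} t
  extend {M} {x} {lo} {s} {lo′} {s′} (solid refl lo′≤ lo≤) c (t , D) with ≤⇒∃+ lo≤
  ... | m , hi≡ = solid s′ (fromℕ< m<) t , solid lo′ (trans hi≡ (cong (λ z → lo + + z) (sym (Fin.toℕ-fromℕ< m<)))) c D
    where
    m< : m ℕ.< suc s ℕ.+ suc s′
    m< = ℕ.s≤s (ℤ.drop‿+≤+ (+-cancelˡ-≤ lo (subst (_≤ lo + + (s ℕ.+ suc s′)) hi≡ (lin₁ lo′≤ (lemma lo lo′ (+ s) (+ s′))))))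
      where
      lemma : ∀ lo lo′ s s′ → lo + s + 1ℤ - lo′ ≡ lo + (s + (1ℤ + s′)) - (lo′ + s′)
      lemma = ℤ-Ring.solve-∀
  extend {M} {x} {lo} {s} {lo′} {s′} {g′} (split g<hi lo<g′ g≤) c (t , D)
    with ≤⇒∃+ (lo<g c) | ≤⇒∃+ lo<g′ | ≤⇒∃+ g<hi
  ... | i , g≡ | e , g≡′ | j , hi≡
    with refl ← trans g≡ (ℤ.+-assoc lo′ 1ℤ (+ i))
    with refl ← +-injectiveˡ lo′ (trans hi≡ (split-top lo′ (+ i) (+ j)))
    = split i j (fromℕ< e<) t , split lo′ (trans g≡″ (cong (λ z → lo + + suc z) (sym (Fin.toℕ-fromℕ< e<)))) c D
    where
    g≡″ : lo′ + + suc i ≡ lo + + suc e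
    g≡″ = trans g≡′ (ℤ.+-assoc lo 1ℤ (+ e))
    e< : e ℕ.< s
    e< = ℤ.drop‿+≤+ (+-cancelˡ-≤ lo (subst (_≤ lo + + s) g≡″ g≤))

  module _ (P : Polyomino) (cheesy : IsCheesy 1 P) where
    open IsCheesy cheesy
    open RightwardSemiDirected rightwardSemiDirected

    private
      M : ℤ → ℤ → Set
      M = Member (cells P)

      lb = proj₁ (lower-bound (cells P))
      ub = proj₁ (upper-bound (cells P))

    M? : ∀ x y → Dec (M x y)
    M? x y = DecMembership._∈?_ (Product.≡-dec ℤ._≟_ ℤ._≟_) (x , y) (cells P)

    right-of? : ∀ x → Dec (∃[ x′ ] (x + 1ℤ ≤ x′ × IsColumn P x′))
    right-of? x = map′ (λ a → let c , c∈ , le = find {P = λ c → x + 1ℤ ≤ proj₁ c} a in proj₁ c , le , proj₂ c , c∈)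
                       (λ (x′ , le , y , c∈) → lose c∈ le)
                       (Any.any? (λ c → x + 1ℤ ℤ.≤? proj₁ c) (cells P))

    column? : ∀ x → Dec (IsColumn P x)
    column? x = map′ (λ a → let c , c∈ , eq = find {P = λ c → proj₁ c ≡ x} a in proj₂ c , subst (λ z → (z , proj₂ c) ∈ cells P) eq c∈)
                     (λ (y , c∈) → lose c∈ refl)
                     (Any.any? (λ c → proj₁ c ℤ.≟ x) (cells P))

    above? : ∀ x g → Dec (∃[ y ] (g + 1ℤ ≤ y × M x y))
    above? x g = map′ (λ a → let c , c∈ , eq , le = find {P = λ c → proj₁ c ≡ x × g + 1ℤ ≤ proj₂ c} a in proj₂ c , le , subst (λ z → (z , proj₂ c) ∈ cells P) eq c∈)
                      (λ (y , le , c∈) → lose c∈ (refl , le))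
                      (Any.any? (λ c → proj₁ c ℤ.≟ x ×-dec g + 1ℤ ℤ.≤? proj₂ c) (cells P))

    Run : ℤ → ℤ → ℤ → Set
    Run x z g = z + 1ℤ ≤ g × ¬ M x g × (∀ y → z ≤ y → y + 1ℤ ≤ g → M x y)

    -- The upward search ends at `ub + 1ℤ` at the latest, which lies above every cell of `P`.
    run-up : ∀ {x z} → M x z → ∃[ g ] Run x z g
    run-up {x} {z} z∈ with least-from (λ y → ¬? (M? x y)) {z + 1ℤ} {ub + 1ℤ}
      (ℤ.+-monoˡ-≤ 1ℤ (proj₂ (proj₂ (upper-bound (cells P)) z∈)))
      (λ ∈ → +1≤⇒≢ (proj₂ (proj₂ (upper-bound (cells P)) ∈)) refl)
    ... | g , z<g , g∉ , least = g , z<g , g∉ , filled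
      where
      filled : ∀ y → z ≤ y → y + 1ℤ ≤ g → M x y
      filled y z≤y y<g with trichotomy z y
      ... | inj₁ z<y         = decidable-stable (M? x y) (least y z<y y<g)
      ... | inj₂ (inj₁ refl) = z∈
      ... | inj₂ (inj₂ y<z)  = ⊥-elim (contra₂ z≤y y<z (ℤ-Ring.solve (y ∷ z ∷ [])))

    run-component : ∀ {x z g} → ¬ M x (z - 1ℤ) → Run x z g → Component P x
    run-component {x} {z} {g} z-1∉ (z<g , g∉ , filled) = record
      { bottom = z ; top = g - 1ℤ
      ; isComponent = record
        { bottom≤top = lin₁ z<g (ℤ-Ring.solve (z ∷ g ∷ []))
        ; filled     = λ y z≤y y≤g-1 → filled y z≤y (lin₁ y≤g-1 (ℤ-Ring.solve (y ∷ g ∷ [])))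
        ; below∉     = z-1∉
        ; above∉     = λ ∈ → g∉ (subst (M x) (lemma g) ∈)
        }
      }
      where
      lemma : ∀ g → g - 1ℤ + 1ℤ ≡ g
      lemma = ℤ-Ring.solve-∀

    next-up : ∀ x g → (∀ y → g + 1ℤ ≤ y → ¬ M x y) ⊎ ∃[ h ] Least (M x) (g + 1ℤ) h
    next-up x g with above? x g
    ... | no none           = inj₁ λ y le ∈ → none (y , le , ∈)
    ... | yes (y , g<y , ∈) = inj₂ (least-from (M? x) g<y ∈)

    below-next∉ : ∀ {x g h} → ¬ M x g → Least (M x) (g + 1ℤ) h → ¬ M x (h - 1ℤ)
    below-next∉ {x} {g} {h} g∉ (g<h , _ , least) ∈ with trichotomy g (h - 1ℤ)
    ... | inj₁ g<h-1         = least (h - 1ℤ) g<h-1 (lin₁ (ℤ.≤-refl {h}) (ℤ-Ring.solve (h ∷ []))) ∈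
    ... | inj₂ (inj₁ refl)   = g∉ ∈
    ... | inj₂ (inj₂ h-1<g)  = contra₂ g<h h-1<g (ℤ-Ring.solve (g ∷ h ∷ []))

    -- The column is scanned upwards from its lowest cell. A second run must start at `g + 1ℤ` by
    -- the bound on gaps, and a third run contradicts the bound on the number of components.
    column-shape : ∀ {x} → IsColumn P x → ∃[ lo ] ∃[ g ] ∃[ hi ] Col M x lo g hi
    column-shape {x} col@(y , ∈) with least-from (M? x) (proj₂ (proj₂ (lower-bound (cells P)) ∈)) ∈
    ... | lo , _ , lo∈ , least with run-up lo∈
    ... | g , run@(lo<g , g∉ , filled) = shape (next-up x g)
      where
      lo≤ : ∀ {y} → M x y → lo ≤ y
      lo≤ {y} ∈ with dichotomy lo y
      ... | inj₁ lo≤y = lo≤y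
      ... | inj₂ y<lo = ⊥-elim (least y (proj₂ (proj₂ (lower-bound (cells P)) ∈)) y<lo ∈)

      C : Component P x
      C = run-component (λ ∈ → contra₁ (lo≤ {lo - 1ℤ} ∈) (ℤ-Ring.solve (lo ∷ []))) run

      ≤-top : ∀ {g y} → ¬ M x g → (∀ y → g + 1ℤ ≤ y → ¬ M x y) → M x y → y ≤ g - 1ℤ
      ≤-top {g} {y} g∉ none ∈ with trichotomy y g
      ... | inj₁ y<g         = lin₁ y<g (ℤ-Ring.solve (g ∷ y ∷ []))
      ... | inj₂ (inj₁ refl) = ⊥-elim (g∉ ∈)
      ... | inj₂ (inj₂ g<y)  = ⊥-elim (none y g<y ∈)

      ≤g-1⇒<g : ∀ {y g} → y ≤ g - 1ℤ → y + 1ℤ ≤ g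
      ≤g-1⇒<g {y} {g} le = lin₁ le (ℤ-Ring.solve (y ∷ g ∷ []))

      shape : (∀ y → g + 1ℤ ≤ y → ¬ M x y) ⊎ ∃[ h ] Least (M x) (g + 1ℤ) h →
              ∃[ lo ] ∃[ g ] ∃[ hi ] Col M x lo g hi
      shape (inj₁ none) = lo , g , g - 1ℤ , mkCol lo<g (ℤ.≤-reflexive (ℤ-Ring.solve (g ∷ [])))
        (λ eq → +1≤⇒≢ {g - 1ℤ} {g} (≤g-1⇒<g ℤ.≤-refl) (sym eq))
        (λ ∈ → lo≤ ∈ , ≤-top g∉ none ∈ , λ { refl → g∉ ∈ })
        (λ y lo≤y y≤g-1 _ → filled y lo≤y (≤g-1⇒<g y≤g-1))
      shape (inj₂ (h , next@(g<h , h∈ , least-h))) with run-up h∈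
      ... | g₂ , run₂@(h<g₂ , g₂∉ , filled₂) = shape₂ (next-up x g₂)
        where
        D : Component P x
        D = run-component (below-next∉ g∉ next) run₂

        h≤g+1 : h ≤ g + 1ℤ
        h≤g+1 = lin₁ gap-size (ℤ-Ring.solve (g ∷ h ∷ []))
          where
          top<h : g - 1ℤ + 1ℤ ≤ h
          top<h = lin₂ g<h 0≤1 (ℤ-Ring.solve (g ∷ h ∷ []))
          gap-size : h - (g - 1ℤ) - 1ℤ ≤ 1ℤ
          gap-size = gapsAtMost x col C D (+1≤⇒< top<h)

        g<g₂ : g + 1ℤ ≤ g₂ - 1ℤ
        g<g₂ = lin₂ g<h h<g₂ (ℤ-Ring.solve (g ∷ h ∷ g₂ ∷ []))

        shape₂ : (∀ y → g₂ + 1ℤ ≤ y → ¬ M x y) ⊎ ∃[ h ] Least (M x) (g₂ + 1ℤ) h →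
                 ∃[ lo ] ∃[ g ] ∃[ hi ] Col M x lo g hi
        shape₂ (inj₁ none) = lo , g , g₂ - 1ℤ , mkCol lo<g
          (lin₃ g<g₂ 0≤1 0≤1 (ℤ-Ring.solve (g ∷ g₂ ∷ [])))
          (+1≤⇒≢ g<g₂)
          (λ ∈ → lo≤ ∈ , ≤-top g₂∉ none ∈ , λ { refl → g∉ ∈ })
          from′
          where
          from′ : ∀ y → lo ≤ y → y ≤ g₂ - 1ℤ → y ≢ g → M x y
          from′ y lo≤y y≤hi y≢g with trichotomy y g
          ... | inj₁ y<g        = filled y lo≤y y<g
          ... | inj₂ (inj₁ y≡g) = ⊥-elim (y≢g y≡g)
          ... | inj₂ (inj₂ g<y) = filled₂ y (ℤ.≤-trans h≤g+1 g<y) (≤g-1⇒<g y≤hi)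
        shape₂ (inj₂ (h₃ , next₃@(g₂<h₃ , h₃∈ , _))) with run-up h₃∈
        ... | g₃ , run₃ = ⊥-elim (absurd (atMostTwoComponents x col C D (run-component (below-next∉ g₂∉ next₃) run₃)))
          where
          lo<h : lo + 1ℤ ≤ h
          lo<h = lin₃ lo<g g<h 0≤1 (ℤ-Ring.solve (lo ∷ g ∷ h ∷ []))
          h<h₃ : h + 1ℤ ≤ h₃
          h<h₃ = lin₃ h<g₂ g₂<h₃ 0≤1 (ℤ-Ring.solve (h ∷ g₂ ∷ h₃ ∷ []))
          h≤h₃ : h ≤ h₃
          h≤h₃ = lin₂ h<h₃ 0≤1 (ℤ-Ring.solve (h ∷ h₃ ∷ []))
          absurd : (lo ≡ h × _) ⊎ (lo ≡ h₃ × _) ⊎ (h ≡ h₃ × _) → ⊥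
          absurd (inj₁ (refl , _))        = +1≤⇒≢ lo<h refl
          absurd (inj₂ (inj₁ (refl , _))) = contra₂ lo<h h≤h₃ (ℤ-Ring.solve (h ∷ lo ∷ []))
          absurd (inj₂ (inj₂ (refl , _))) = +1≤⇒≢ h<h₃ refl

    component : ∀ {x b t} → Comp M x b t → Component P x
    component {b = b} {t} (mkComp b≤t filled below∉ above∉) = record
      { bottom = b ; top = t
      ; isComponent = record { bottom≤top = b≤t ; filled = filled ; below∉ = below∉ ; above∉ = above∉ } }

    -- Each component contains a right neighbour of the left column, hence a height in the enlarged
    -- interval. If there is a gap, the lower component gives `lo₀ + 1ℤ ≤ g` and the upper one
    -- `g ≤ hi₀`. The edge also shows that no column is skipped.
    adjacent⇒step : ∀ {x x′ lo₀ g₀ hi₀ lo g hi} → AdjacentColumns P x x′ →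
      Col M x lo₀ g₀ hi₀ → Col M x′ lo g hi → x′ ≡ x + 1ℤ × Step lo₀ hi₀ lo g hi
    adjacent⇒step {x} {x′} {lo₀} {g₀} {hi₀} {lo} {g} {hi} adj@(_ , _ , x<x′ , _) c₀ c
      with adjacentColumns x x′ adj (component (lowerComp c)) | gap c
    ... | y , y′ , y∈ , lo≤y′ , y′≤ , edge | inj₁ refl
      with left-neighbour⁻ c₀ y∈ (<⇒+1≤ x<x′) edge
    ...   | x≡ , lo₀≤y′ , y′≤hi₀+1 = x≡ , solid refl (ℤ.≤-trans lo≤y′ y′≤hi₀+1)
        (lin₂ lo₀≤y′ y′≤ (ℤ-Ring.solve (lo₀ ∷ y′ ∷ hi ∷ [])))
    adjacent⇒step {x} {x′} {lo₀} {g₀} {hi₀} {lo} {g} {hi} adj@(_ , _ , x<x′ , _) c₀ c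
        | y , y′ , y∈ , lo≤y′ , y′≤ , edge | inj₂ g<hi
      with left-neighbour⁻ c₀ y∈ (<⇒+1≤ x<x′) edge | adjacentColumns x x′ adj (component (upperComp c g<hi))
    ...   | x≡ , lo₀≤y′ , _ | z , z′ , z∈ , g<z′ , _ , edge′
      with left-neighbour⁻ c₀ z∈ (<⇒+1≤ x<x′) edge′
    ...     | _ , _ , z′≤hi₀+1 = x≡ , split g<hi (lin₂ lo₀≤y′ y′≤ (ℤ-Ring.solve (lo₀ ∷ y′ ∷ g ∷ [])))
        (lin₂ g<z′ z′≤hi₀+1 (ℤ-Ring.solve (g ∷ z′ ∷ hi₀ ∷ [])))

    -- `n` bounds the number of columns that can still follow, since no cell lies beyond `x + + n`.
    tail-of : ∀ n {x lo g s} → Col M x lo g (lo + + s) → ub ≤ x + + n → ∃[ t ] Desc M x lo {s} t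
    tail-of n {x} {lo} c ub≤ with right-of? x
    ... | no none = done , done λ x′ y x<x′ ∈ → none (x′ , x<x′ , y , ∈)
    tail-of zero {x} {lo} c ub≤ | yes (x′ , x<x′ , y , ∈) =
      ⊥-elim (+1≤⇒≢ (ℤ.≤-trans x<x′ (ℤ.≤-trans (proj₁ (proj₂ (upper-bound (cells P)) ∈))
        (subst (ub ≤_) (ℤ.+-identityʳ x) ub≤))) refl)
    tail-of (suc n) {x} {lo} c ub≤ | yes (x′ , x<x′ , col) with least-from column? x<x′ col
    ... | x₁ , x<x₁ , col₁ , least with column-shape col₁
    ... | lo₁ , g₁ , hi₁ , c₁ with adjacent⇒step
      ((lo , lo∈ c) , col₁ , +1≤⇒< x<x₁ , λ x″ x<x″ x″<x₁ → least x″ (<⇒+1≤ x<x″) (<⇒+1≤ x″<x₁)) c c₁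
    ... | refl , step with ≤⇒∃+ (lo≤hi c₁)
    ... | s₁ , refl = extend step c₁ (tail-of n c₁ (subst (ub ≤_) (sym (ℤ.+-assoc x 1ℤ (+ n))) ub≤))

    abstract
      code-of : ∃[ x ] ∃[ lo ] ∃[ c ] CodeDesc M x lo c
      code-of with Polyomino.nonEmpty P
      ... | (x′ , y) , ∈ with least-from column? (proj₁ (proj₂ (lower-bound (cells P)) ∈)) (y , ∈)
      ... | x , _ , col , least with column-shape col
      ... | lo , g , hi , c = result
        where
        x≤ : ∀ x″ → IsColumn P x″ → x ≤ x″
        x≤ x″ col″@(_ , ∈″) with dichotomy x x″
        ... | inj₁ le   = le
        ... | inj₂ x″<x = ⊥-elim (least x″ (proj₁ (proj₂ (lower-bound (cells P)) ∈″)) x″<x col″)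
        no-gap : g ≡ hi + 1ℤ
        no-gap with gap c
        ... | inj₁ eq   = eq
        -- `NoGap` would identify the two components, and with them their bottoms `lo` and `g + 1ℤ`.
        ... | inj₂ g<hi = ⊥-elim (contra₂ (lo<g c) 0≤1 (trans (cong (λ z → g - (z + 1ℤ) + (1ℤ - 0ℤ)) lo≡g+1) (lemma g)))
          where
          lo≡g+1 : lo ≡ g + 1ℤ
          lo≡g+1 = proj₁ (firstColumn x (col , x≤) (component (lowerComp c)) (component (upperComp c g<hi)))
          lemma : ∀ g → g - (g + 1ℤ + 1ℤ) + (1ℤ - 0ℤ) ≡ - 1ℤ
          lemma = ℤ-Ring.solve-∀
        result : ∃[ x ] ∃[ lo ] ∃[ c ] CodeDesc M x lo c
        result with no-gap | ≤⇒∃+ (lo≤hi c)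
        ... | refl | k , refl with ≤⇒∃+ (ℤ.≤-trans (x≤ x′ (y , ∈)) (proj₁ (proj₂ (upper-bound (cells P)) ∈)))
        ...   | n , ub≡ with tail-of n c (ℤ.≤-reflexive ub≡)
        ...     | t , D = x , lo , (k , t) , codeDesc (λ x″ y″ x″<x ∈″ → contra₂ (x≤ x″ (y″ , ∈″)) x″<x (ℤ-Ring.solve (x ∷ x″ ∷ []))) c D

-- The bijection between codes and polyominoes up to translation.

module Cardinality where
  open import Data.Integer using (_+_; _-_; -_)
  open Enumeration using (codeSize; codes; codes-sound; codes-complete; codes-unique; count; length-codes)
  open Descriptions
  open Translations
  open DescribedCells
  open Realization
  open Reconstruction

  translate-injective : ∀ t {c d} → translate t c ≡ translate t d → c ≡ d
  translate-injective (u , v) {x , y} {x′ , y′} eq =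
    cong₂ _,_ (+-cancelˡ u (cong proj₁ eq)) (+-cancelˡ v (cong proj₂ eq))

  translate-surjective : ∀ t d → ∃[ c ] d ≡ translate t c
  translate-surjective (u , v) (x , y) = (x - u , y - v) , cong₂ _,_ (lemma u x) (lemma v y)
    where
    lemma : ∀ u x → x ≡ u + (x - u)
    lemma = ℤ-Ring.solve-∀

  -- Two lists without repetitions and with the same members are permutations of each other; one of
  -- them is the translated list of cells.
  ≈ₚ⇒size≡ : ∀ P Q → P ≈ₚ Q → size P ≡ size Q
  ≈ₚ⇒size≡ P Q (t , P⇔Q) = trans (sym (length-map (translate t) (cells P))) (↭-length (∼bag⇒↭
    (unique∧set⇒bag (Unique.map⁺ (translate-injective t) (Polyomino.unique P)) (Polyomino.unique Q) (mk⇔ to′ from′))))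
    where
    to′ : ∀ {d} → d ∈ map (translate t) (cells P) → d ∈ cells Q
    to′ d∈ with ∈-map⁻ (translate t) d∈
    ... | c , c∈ , refl = Equivalence.to (P⇔Q c) c∈
    from′ : ∀ {d} → d ∈ cells Q → d ∈ map (translate t) (cells P)
    from′ {d} d∈ with translate-surjective t d
    ... | c , refl = ∈-map⁺ (translate t) (Equivalence.from (P⇔Q c) d∈)

  abstract
    codePolyomino-injective : ∀ c c′ → codePolyomino c ≈ₚ codePolyomino c′ → c ≡ c′
    codePolyomino-injective c c′ ((u , v) , ⇔′) = Code-unique
      (CodeDesc-translate {Member (codeCells c)} {Member (codeCells c′)} u v (λ x y → ⇔′ (x , y)) (codeCells-described c))
      (codeCells-described c′)

    codePolyomino-surjective : ∀ {n} (P : CheesyPolyomino 1 n) → ∃[ c ] (codeSize c ≡ n × codePolyomino c ≈ₚ polyomino P)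
    codePolyomino-surjective record { polyomino = P ; isCheesy = cheesy ; size≡n = size≡ } with code-of P cheesy
    ... | x , lo , c , D = c , trans (trans (sym (length-codeCells c)) (≈ₚ⇒size≡ (codePolyomino c) P c≈P)) size≡ , c≈P
      where
      -- The description of `P` is moved to the origin, so that it has the same base as that of the
      -- realized code; equal codes and bases then give equal sets.
      D′ : CodeDesc (λ a b → (x + a , lo + b) ∈ cells P) 0ℤ 0ℤ c
      D′ = subst₂ (λ a b → CodeDesc (λ a b → (x + a , lo + b) ∈ cells P) a b c) (ℤ.+-inverseˡ x) (ℤ.+-inverseˡ lo)
        (CodeDesc-translate (- x) (- lo) (λ a b → mk⇔
          (subst₂ (Member (cells P)) (lemma x a) (lemma lo b))
          (subst₂ (Member (cells P)) (sym (lemma x a)) (sym (lemma lo b)))) D)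
        where
        lemma : ∀ u a → a ≡ u + (- u + a)
        lemma = ℤ-Ring.solve-∀
      c≈P : codePolyomino c ≈ₚ P
      c≈P = (x , lo) , λ (a , b) → mk⇔ (CodeDesc-⊆ (codeCells-described c) D′) (CodeDesc-⊆ D′ (codeCells-described c))

  lookup-injective : ∀ {A : Set} {xs : List A} → Unique xs → ∀ i j → List.lookup xs i ≡ List.lookup xs j → i ≡ j
  lookup-injective (_ AllPairs.∷ _)  Fin.zero    Fin.zero    _  = refl
  lookup-injective (x∉ AllPairs.∷ _) Fin.zero    (Fin.suc j) eq = ⊥-elim (All.lookup x∉ (∈-lookup j) eq)
  lookup-injective (x∉ AllPairs.∷ _) (Fin.suc i) Fin.zero    eq = ⊥-elim (All.lookup x∉ (∈-lookup i) (sym eq))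
  lookup-injective (_ AllPairs.∷ u)  (Fin.suc i) (Fin.suc j) eq = cong Fin.suc (lookup-injective u i j eq)

  codes-index : ∀ {n} c → codeSize c ≡ n → ∃[ i ] c ≡ List.lookup (codes n) i
  codes-index c refl = index (codes-complete c) , lookup-index (codes-complete c)

  fromIndex : ∀ n → Fin (length (codes n)) → CheesyPolyomino 1 n
  fromIndex n i = codeCheesy (List.lookup (codes n) i) (codes-sound n (∈-lookup i))

  fromIndex-injective : ∀ n {i j} → polyomino (fromIndex n i) ≈ₚ polyomino (fromIndex n j) → i ≡ j
  fromIndex-injective n {i} {j} eq = lookup-injective (codes-unique n) i j (codePolyomino-injective _ _ eq)

  fromIndex-surjective : ∀ n (P : CheesyPolyomino 1 n) →
    ∃[ i ] (∀ {j} → j ≡ i → polyomino (fromIndex n j) ≈ₚ polyomino P)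
  fromIndex-surjective n P =
    let c , size≡ , c≈P = codePolyomino-surjective P
        i , c≡ = codes-index c size≡
    in i , λ { refl → subst (λ c → codePolyomino c ≈ₚ polyomino P) c≡ c≈P }

  hasCardinality-codes : ∀ n → HasCardinality (cheesySetoid 1 n) (length (codes n))
  hasCardinality-codes n = record
    { to        = fromIndex n
    ; cong      = λ { {i} refl → Setoid.refl (cheesySetoid 1 n) {fromIndex n i} }
    ; bijective = fromIndex-injective n , fromIndex-surjective n
    }

  HasCardinality-resp-≡ : ∀ S {m n} → m ≡ n → HasCardinality S m → HasCardinality S n
  HasCardinality-resp-≡ S refl h = h

  hasCardinality : ∀ n → 1 ℕ.≤ n → HasCardinality (cheesySetoid 1 n) (count n)
  hasCardinality (suc n) _ = HasCardinality-resp-≡ (cheesySetoid 1 (suc n))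
    {length (codes (suc n))} {count (suc n)} (length-codes n) (hasCardinality-codes (suc n))

-- Inequalities and powers of rational numbers.

module RationalOrder where
  open import Data.Rational using (_+_; _*_; _-_; -_; _≤_; _<_; _/_)
  open +-*-Solver

  0≤+ : ∀ {p q} → 0ℚ ≤ p → 0ℚ ≤ q → 0ℚ ≤ p + q
  0≤+ = ℚ.+-mono-≤

  0≤* : ∀ {p q} → 0ℚ ≤ p → 0ℚ ≤ q → 0ℚ ≤ p * q
  0≤* {p} {q} 0≤p 0≤q = subst (_≤ p * q) (ℚ.*-zeroʳ p) (ℚ.*-monoˡ-≤-nonNeg p {{ℚ.nonNegative 0≤p}} 0≤q)

  0<* : ∀ {p q} → 0ℚ < p → 0ℚ < q → 0ℚ < p * q
  0<* {p} {q} 0<p 0<q = subst (_< p * q) (ℚ.*-zeroʳ p) (ℚ.*-monoʳ-<-pos p {{ℚ.positive 0<p}} 0<q)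

  ≤⇒0≤- : ∀ {p q} → p ≤ q → 0ℚ ≤ q - p
  ≤⇒0≤- {p} {q} p≤q = subst (_≤ q - p) (ℚ.+-inverseʳ p) (ℚ.+-monoˡ-≤ (- p) p≤q)

  -- An inequality follows once the difference of its sides is written as an expression known to be
  -- nonnegative; the equation is a matter for the ring solver.
  certify : ∀ {e p q} → 0ℚ ≤ e → e ≡ q - p → p ≤ q
  certify {e} {p} {q} 0≤e eq = subst₂ _≤_ (ℚ.+-identityˡ p) (solve 2 (λ p q → q :- p :+ p := q) refl p q)
    (ℚ.+-monoˡ-≤ p (subst (0ℚ ≤_) eq 0≤e))

  *-mono-≤ : ∀ {p q r s} → 0ℚ ≤ r → 0ℚ ≤ q → p ≤ q → r ≤ s → p * r ≤ q * s
  *-mono-≤ {p} {q} {r} {s} 0≤r 0≤q p≤q r≤s = ℚ.≤-trans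
    (ℚ.*-monoʳ-≤-nonNeg r {{ℚ.nonNegative 0≤r}} p≤q) (ℚ.*-monoˡ-≤-nonNeg q {{ℚ.nonNegative 0≤q}} r≤s)

  ∣∣≤ : ∀ {p q} → p ≤ q → - p ≤ q → ∣ p ∣ ≤ q
  ∣∣≤ {p} p≤q -p≤q with ℚ.∣p∣≡p∨∣p∣≡-p p
  ... | inj₁ eq = subst (_≤ _) (sym eq) p≤q
  ... | inj₂ eq = subst (_≤ _) (sym eq) -p≤q

  infixr 8 _^_
  _^_ : ℚ → ℕ → ℚ
  p ^ zero  = 1ℚ
  p ^ suc n = p * p ^ n

  0<1 : 0ℚ < 1ℚ
  0<1 = from-yes (0ℚ ℚ.<? 1ℚ)

  0<^ : ∀ {p} → 0ℚ < p → ∀ n → 0ℚ < p ^ n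
  0<^ 0<p zero    = 0<1
  0<^ 0<p (suc n) = 0<* 0<p (0<^ 0<p n)

  ^-mono : ∀ {p q} → 0ℚ ≤ p → p ≤ q → ∀ n → 0ℚ ≤ p ^ n × p ^ n ≤ q ^ n
  ^-mono 0≤p p≤q zero    = ℚ.<⇒≤ 0<1 , ℚ.≤-refl
  ^-mono 0≤p p≤q (suc n) = let 0≤ , le = ^-mono 0≤p p≤q n in
    0≤* 0≤p 0≤ , *-mono-≤ 0≤ (ℚ.≤-trans 0≤p p≤q) p≤q le

  ^-distrib-* : ∀ p q n → (p * q) ^ n ≡ p ^ n * q ^ n
  ^-distrib-* p q zero    = refl
  ^-distrib-* p q (suc n) = trans (cong (p * q *_) (^-distrib-* p q n))
    (solve 4 (λ p q s t → p :* q :* (s :* t) := p :* s :* (q :* t)) refl p q (p ^ n) (q ^ n))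

  /1-homo-+ : ∀ i j → (i ℤ.+ j) / 1 ≡ i / 1 + j / 1
  /1-homo-+ i j = ℚ.toℚᵘ-injective (begin
    ℚ.toℚᵘ ((i ℤ.+ j) / 1)                  ≈⟨ ℚ.toℚᵘ-fromℚᵘ (mkℚᵘ (i ℤ.+ j) 0) ⟩
    mkℚᵘ (i ℤ.+ j) 0                        ≈⟨ ℚᵘ.*≡* (lemma i j) ⟩
    mkℚᵘ i 0 ℚᵘ.+ mkℚᵘ j 0                  ≈⟨ ℚᵘ.+-cong (ℚ.toℚᵘ-fromℚᵘ (mkℚᵘ i 0)) (ℚ.toℚᵘ-fromℚᵘ (mkℚᵘ j 0)) ⟨
    ℚ.toℚᵘ (i / 1) ℚᵘ.+ ℚ.toℚᵘ (j / 1)      ≈⟨ ℚ.toℚᵘ-homo-+ (i / 1) (j / 1) ⟨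
    ℚ.toℚᵘ (i / 1 + j / 1) ∎)
    where
    open ℚᵘ.≃-Reasoning
    lemma : ∀ i j → (i ℤ.+ j) ℤ.* + 1 ≡ (i ℤ.* + 1 ℤ.+ j ℤ.* + 1) ℤ.* + 1
    lemma = ℤ-Ring.solve-∀

  /1-homo-* : ∀ i j → (i ℤ.* j) / 1 ≡ i / 1 * (j / 1)
  /1-homo-* i j = ℚ.toℚᵘ-injective (begin
    ℚ.toℚᵘ ((i ℤ.* j) / 1)                  ≈⟨ ℚ.toℚᵘ-fromℚᵘ (mkℚᵘ (i ℤ.* j) 0) ⟩
    mkℚᵘ i 0 ℚᵘ.* mkℚᵘ j 0                  ≈⟨ ℚᵘ.*-cong (ℚ.toℚᵘ-fromℚᵘ (mkℚᵘ i 0)) (ℚ.toℚᵘ-fromℚᵘ (mkℚᵘ j 0)) ⟨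
    ℚ.toℚᵘ (i / 1) ℚᵘ.* ℚ.toℚᵘ (j / 1)      ≈⟨ ℚ.toℚᵘ-homo-* (i / 1) (j / 1) ⟨
    ℚ.toℚᵘ (i / 1 * (j / 1)) ∎)
    where open ℚᵘ.≃-Reasoning

  ℕ⇒ℚ : ℕ → ℚ
  ℕ⇒ℚ n = + n / 1

  0≤ℕ⇒ℚ : ∀ n → 0ℚ ≤ ℕ⇒ℚ n
  0≤ℕ⇒ℚ n = ℚ.nonNegative⁻¹ (ℕ⇒ℚ n) {{ℚ.normalize-nonNeg n 1}}

  abstract
    archimedean : ∀ q → ∃[ n ] q ≤ ℕ⇒ℚ n
    archimedean q@(ℚ.mkℚ (+ n) d _) = n , ℚ.toℚᵘ-cancel-≤ (ℚᵘ.≤-trans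
      (ℚᵘ.*≤* (ℤ.*-monoˡ-≤-nonNeg (+ n) (ℤ.+≤+ (ℕ.s≤s ℕ.z≤n))))
      (ℚᵘ.≤-reflexive (ℚᵘ.≃-sym (ℚ.toℚᵘ-fromℚᵘ (mkℚᵘ (+ n) 0)))))
    archimedean q@(ℚ.mkℚ (ℤ.-[1+ _ ]) _ _) = 0 , ℚ.<⇒≤ (ℚ.negative⁻¹ q)

    0≤½ : 0ℚ ≤ ½
    0≤½ = from-yes (0ℚ ℚ.≤? ½)

    -- This is 1 + n ≤ 2ⁿ. In the induction step the left-hand side drops by half of n · ½ⁿ.
    ½^-bound : ∀ n → (1ℚ + ℕ⇒ℚ n) * ½ ^ n ≤ 1ℚ
    ½^-bound zero    = from-yes ((1ℚ + ℕ⇒ℚ 0) * ½ ^ 0 ℚ.≤? 1ℚ)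
    ½^-bound (suc n) = ℚ.≤-trans (certify (0≤* (0≤* 0≤½ (0≤ℕ⇒ℚ n)) (proj₁ (^-mono 0≤½ ℚ.≤-refl n)))
      (trans (solve 2 (λ m h → con ½ :* m :* h := (con 1ℚ :+ m) :* h :- (con 1ℚ :+ (con 1ℚ :+ m)) :* (con ½ :* h)) refl (ℕ⇒ℚ n) (½ ^ n))
        (cong (λ z → (1ℚ + ℕ⇒ℚ n) * ½ ^ n - (1ℚ + z) * (½ * ½ ^ n)) (sym (/1-homo-+ (+ 1) (+ n))))))
      (½^-bound n)

    *½^-small : ∀ b → 0ℚ ≤ b → ∀ ε → 0ℚ < ε → ∃[ N ] (∀ n → N ℕ.≤ n → b * ½ ^ n ≤ ε)
    *½^-small b 0≤b ε 0<ε with archimedean (b * ℚ.1/_ ε {{ℚ.pos⇒nonZero ε {{ℚ.positive 0<ε}}}})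
    ... | N , le = N , small
      where
      instance
        ε-nonZero : ℚ.NonZero ε
        ε-nonZero = ℚ.pos⇒nonZero ε {{ℚ.positive 0<ε}}
      0≤ε : 0ℚ ≤ ε
      0≤ε = ℚ.<⇒≤ 0<ε
      b≤ε*N : b ≤ ε * ℕ⇒ℚ N
      b≤ε*N = subst (_≤ ε * ℕ⇒ℚ N)
        (trans (solve 3 (λ b e i → e :* (b :* i) := b :* (e :* i)) refl b ε (ℚ.1/ ε))
          (trans (cong (b *_) (ℚ.*-inverseʳ ε)) (ℚ.*-identityʳ b)))
        (ℚ.*-monoˡ-≤-nonNeg ε {{ℚ.nonNegative 0≤ε}} le)
      small : ∀ n → N ℕ.≤ n → b * ½ ^ n ≤ ε
      small n N≤n = begin
        b * ½ ^ n                          ≤⟨ *-mono-≤ 0≤½^n (0≤* 0≤ε (0≤+ (ℚ.<⇒≤ 0<1) (0≤ℕ⇒ℚ n))) b≤ ℚ.≤-refl ⟩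
        ε * (1ℚ + ℕ⇒ℚ n) * ½ ^ n           ≡⟨ ℚ.*-assoc ε (1ℚ + ℕ⇒ℚ n) (½ ^ n) ⟩
        ε * ((1ℚ + ℕ⇒ℚ n) * ½ ^ n)         ≤⟨ ℚ.*-monoˡ-≤-nonNeg ε {{ℚ.nonNegative 0≤ε}} (½^-bound n) ⟩
        ε * 1ℚ                             ≡⟨ ℚ.*-identityʳ ε ⟩
        ε ∎
        where
        open ℚ.≤-Reasoning
        0≤½^n : 0ℚ ≤ ½ ^ n
        0≤½^n = proj₁ (^-mono 0≤½ ℚ.≤-refl n)
        N≤1+n : ℕ⇒ℚ N ≤ 1ℚ + ℕ⇒ℚ n
        N≤1+n with ℕ.m≤n⇒∃[o]m+o≡n N≤n
        ... | o , refl = certify (0≤+ (ℚ.<⇒≤ 0<1) (0≤ℕ⇒ℚ o))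
          (trans (solve 2 (λ m o → con 1ℚ :+ o := con 1ℚ :+ (m :+ o) :- m) refl (ℕ⇒ℚ N) (ℕ⇒ℚ o))
            (cong (λ z → 1ℚ + z - ℕ⇒ℚ N) (sym (/1-homo-+ (+ N) (+ o)))))
        b≤ : b ≤ ε * (1ℚ + ℕ⇒ℚ n)
        b≤ = ℚ.≤-trans b≤ε*N (ℚ.*-monoˡ-≤-nonNeg ε {{ℚ.nonNegative 0≤ε}} N≤1+n)

-- Rational approximations of the dominant root, and numerical bounds.

module Root where
  open import Data.Rational using (_+_; _*_; _-_; -_; _≤_; _<_; _/_)
  open +-*-Solver
  open RationalOrder

  abstract
    -- `lower` and `upper` enclose λ - 2 to seven decimals, one more than claimed for λ, which
    -- leaves room for evaluating κ and for strict inequalities. The constants are sealed to keep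
    -- their fractions folded; `two≡` and `four≡` restore numerals where a ring identity depends on
    -- them.
    two four tenth lower upper : ℚ
    two   = + 2 / 1
    four  = + 4 / 1
    tenth = + 1 / 10
    lower = + 21149075 / 10000000
    upper = + 21149076 / 10000000

    two≡ : two ≡ 1ℚ + 1ℚ
    two≡ = refl

    four≡ : four ≡ two + two
    four≡ = refl

  -- In terms of z = λ - 2 the equation λ³ - 6λ² + 8λ - 1 = 0 reads z³ - 4z - 1 = 0.
  p : ℚ → ℚ
  p z = z * z * z - four * z - 1ℚ

  -- The divided difference of `p`. It increases in both arguments as long as these are nonnegative,
  -- so its values at `lower` and `upper` bound it in between.
  slope : ℚ → ℚ → ℚ
  slope z w = z * z + z * w + w * w - four

  -- The derivative at the root is about 9.4, so division by 10 instead of by the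
  -- derivative turns Newton's method into a monotone contraction without division.
  next : ℚ → ℚ
  next z = z - tenth * p z

  -- A step moves by a tenth of `- p z`, and this quantity at least halves each time, so all future
  -- steps together move by at most two tenths of it. `≤upper` therefore bounds every later iterate
  -- at once, in a form that a step preserves.
  record Below (z : ℚ) : Set where
    field
      lower≤ : lower ≤ z
      p≤0    : p z ≤ 0ℚ
      ≤upper : z - (tenth + tenth) * p z ≤ upper

  abstract
    k₀ k₁ k₂ w₀ w₁ : ℚ
    k₀  = + 31 / 229
    k₁  = + 35 / 229
    k₂  = + 17 / 229
    w₀  = + 105 / 229
    w₁  = + 51 / 229

  -- κ = h / p′(λ), where h = c₂ + (λ - 6) c₁ + (λ² - 6λ + 8) c₀; the division in the field
  -- generated by λ turns this quotient into a polynomial with denominator 229, the discriminant.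
  k : ℚ → ℚ
  k z = k₂ * (z * z) + (k₀ - k₁ * z)

  -- The first bracket is h with c₀ = c₁ = 1 and c₂ = 3. The second is 3z² - 4, the derivative of
  -- `p`, written as the quadratic cofactor evaluated at z + 2. The identity says that h minus `k`
  -- times the derivative is divisible by `p`, with quotient `w₀ - w₁ * z`.
  Defining : (two four z : ℚ) → Set
  Defining two four z =
    (1ℚ + two + (z - four) + z * (z - two)) - k z * ((z + two) * (z + two) + (z - four) * (z + two) + z * (z - two))
    ≡ (z * z * z - four * z - 1ℚ) * (w₀ - w₁ * z)

  abstract
    k-defining′ : ∀ z → Defining (1ℚ + 1ℚ) (1ℚ + 1ℚ + (1ℚ + 1ℚ)) z
    k-defining′ = solve 1 (λ z → (con 1ℚ :+ con 2ℚ :+ (z :- con 4ℚ) :+ z :* (z :- con 2ℚ))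
        :- (con k₂ :* (z :* z) :+ (con k₀ :- con k₁ :* z)) :* ((z :+ con 2ℚ) :* (z :+ con 2ℚ) :+ (z :- con 4ℚ) :* (z :+ con 2ℚ) :+ z :* (z :- con 2ℚ))
        := (z :* z :* z :- con 4ℚ :* z :- con 1ℚ) :* (con w₀ :- con w₁ :* z)) refl
      where
      2ℚ 4ℚ : ℚ
      2ℚ = 1ℚ + 1ℚ
      4ℚ = 1ℚ + 1ℚ + (1ℚ + 1ℚ)

  k-defining : ∀ z → Defining two four z
  k-defining z = subst₂ (λ a b → Defining a b z) (sym two≡) (sym (trans four≡ (cong₂ _+_ two≡ two≡))) (k-defining′ z)

  p-difference : ∀ z w → p z - p w ≡ (z - w) * slope z w
  p-difference = solve 3 (λ f z w → (z :* z :* z :- f :* z :- con 1ℚ) :- (w :* w :* w :- f :* w :- con 1ℚ)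
    := (z :- w) :* (z :* z :+ z :* w :+ w :* w :- f)) refl four

  abstract
    0≤tenth : 0ℚ ≤ tenth
    0≤tenth = from-yes (0ℚ ℚ.≤? tenth)

    2tenth≤1 : 0ℚ ≤ 1ℚ - (tenth + tenth)
    2tenth≤1 = from-yes (0ℚ ℚ.≤? 1ℚ - (tenth + tenth))

    0≤lower : 0ℚ ≤ lower
    0≤lower = from-yes (0ℚ ℚ.≤? lower)

    0≤upper : 0ℚ ≤ upper
    0≤upper = from-yes (0ℚ ℚ.≤? upper)

    slope-at-lower : ½ ≤ tenth * slope lower lower
    slope-at-lower = from-yes (½ ℚ.≤? tenth * slope lower lower)

    slope-at-upper : tenth * slope upper upper ≤ 1ℚ
    slope-at-upper = from-yes (tenth * slope upper upper ℚ.≤? 1ℚ)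

    p-lower≤0 : p lower ≤ 0ℚ
    p-lower≤0 = from-yes (p lower ℚ.≤? 0ℚ)

    -p-lower≤1 : - p lower ≤ 1ℚ
    -p-lower≤1 = from-yes (- p lower ℚ.≤? 1ℚ)

    p-lower-upper : lower - (tenth + tenth) * p lower ≤ upper
    p-lower-upper = from-yes (lower - (tenth + tenth) * p lower ℚ.≤? upper)

    two≤lower : two ≤ lower
    two≤lower = from-yes (two ℚ.≤? lower)

    upper≤four : upper ≤ four
    upper≤four = from-yes (upper ℚ.≤? four)

    upper+two≤5 : upper + two ≤ + 5 / 1
    upper+two≤5 = from-yes (upper + two ℚ.≤? + 5 / 1)

    -- The deviation is bounded by τⁿ for any τ above the second largest root 1.746 of the
    -- recurrence; τ = 4.1 / 2 makes the ratio to λⁿ at most 2⁻ⁿ.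
    τ τ₁ : ℚ
    τ  = + 41 / 20
    τ₁ = + 41 / 10

    0<τ : 0ℚ < τ
    0<τ = from-yes (0ℚ ℚ.<? τ)

    0≤τ₁ : 0ℚ ≤ τ₁
    0≤τ₁ = from-yes (0ℚ ℚ.≤? τ₁)

    1≤τ : 1ℚ ≤ τ
    1≤τ = from-yes (1ℚ ℚ.≤? τ)

    τ≡½τ₁ : τ ≡ ½ * τ₁
    τ≡½τ₁ = from-yes (τ ℚ.≟ ½ * τ₁)

    τ₁≤lower+two : τ₁ ≤ lower + two
    τ₁≤lower+two = from-yes (τ₁ ℚ.≤? lower + two)

    -- The summand tenth * (1 - tenth) is the slack that absorbs the defect d below.
    τ-recurrence : (four - lower) * τ + upper * (upper - two) + tenth * (1ℚ - tenth) ≤ τ * τ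
    τ-recurrence = from-yes ((four - lower) * τ + upper * (upper - two) + tenth * (1ℚ - tenth) ℚ.≤? τ * τ)

    0<tenth[1-tenth] : 0ℚ < tenth * (1ℚ - tenth)
    0<tenth[1-tenth] = from-yes (0ℚ ℚ.<? tenth * (1ℚ - tenth))

    0≤k₁ : 0ℚ ≤ k₁
    0≤k₁ = from-yes (0ℚ ℚ.≤? k₁)

    0≤k₂ : 0ℚ ≤ k₂
    0≤k₂ = from-yes (0ℚ ℚ.≤? k₂)

    0≤w₁ : 0ℚ ≤ w₁
    0≤w₁ = from-yes (0ℚ ℚ.≤? w₁)

    k-at-lower : + 144176 / 1000000 ≤ k₂ * (lower * lower) + (k₀ - k₁ * upper)
    k-at-lower = from-yes (+ 144176 / 1000000 ℚ.≤? k₂ * (lower * lower) + (k₀ - k₁ * upper))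

    -- `_<ᴿ_` asks for a positive distance valid for all late terms, so the upper bounds include
    -- this margin.
    k-margin : ℚ
    k-margin = + 1 / 10000000

    0<k-margin : 0ℚ < k-margin
    0<k-margin = from-yes (0ℚ ℚ.<? k-margin)

    k-at-upper : k₂ * (upper * upper) + (k₀ - k₁ * lower) + k-margin ≤ + 144177 / 1000000
    k-at-upper = from-yes (k₂ * (upper * upper) + (k₀ - k₁ * lower) + k-margin ℚ.≤? + 144177 / 1000000)

    tenth<k : tenth ≤ + 144176 / 1000000
    tenth<k = from-yes (tenth ℚ.≤? + 144176 / 1000000)

    k≤1/5 : + 144177 / 1000000 ≤ tenth + tenth
    k≤1/5 = from-yes (+ 144177 / 1000000 ℚ.≤? tenth + tenth)

    w-at-lower : w₀ - w₁ * lower ≤ 1ℚ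
    w-at-lower = from-yes (w₀ - w₁ * lower ℚ.≤? 1ℚ)

    w-at-upper : - 1ℚ ≤ w₀ - w₁ * upper
    w-at-upper = from-yes (- 1ℚ ℚ.≤? w₀ - w₁ * upper)

    0<lower+two : 0ℚ < lower + two
    0<lower+two = from-yes (0ℚ ℚ.<? lower + two)

    λ-at-lower : + 4114907 / 1000000 ≤ lower + two
    λ-at-lower = from-yes (+ 4114907 / 1000000 ℚ.≤? lower + two)

    λ-at-upper : upper + two + k-margin ≤ + 4114908 / 1000000
    λ-at-upper = from-yes (upper + two + k-margin ℚ.≤? + 4114908 / 1000000)

    0<tenth : 0ℚ < tenth
    0<tenth = from-yes (0ℚ ℚ.<? tenth)

    tenth-inverse : ∀ q → q ≡ + 10 / 1 * (tenth * q)
    tenth-inverse q = sym (trans (sym (ℚ.*-assoc (+ 10 / 1) tenth q))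
      (trans (cong (_* q) (from-yes (+ 10 / 1 * tenth ℚ.≟ 1ℚ))) (ℚ.*-identityˡ q)))

    fifth≤1 : (tenth + tenth) * (+ 5 / 1) ≤ 1ℚ
    fifth≤1 = from-yes ((tenth + tenth) * (+ 5 / 1) ℚ.≤? 1ℚ)

  slope-mono : ∀ {z w z′ w′} → 0ℚ ≤ z → 0ℚ ≤ w → z ≤ z′ → w ≤ w′ → slope z w ≤ slope z′ w′
  slope-mono {z} {w} {z′} {w′} 0≤z 0≤w z≤z′ w≤w′ = ℚ.+-monoˡ-≤ (- four)
    (ℚ.+-mono-≤ (ℚ.+-mono-≤ (*-mono-≤ 0≤z 0≤z′ z≤z′ z≤z′) (*-mono-≤ 0≤w 0≤z′ z≤z′ w≤w′)) (*-mono-≤ 0≤w 0≤w′ w≤w′ w≤w′))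
    where
    0≤z′ = ℚ.≤-trans 0≤z z≤z′
    0≤w′ = ℚ.≤-trans 0≤w w≤w′

  slope-lower : ∀ {z w} → lower ≤ z → lower ≤ w → ½ ≤ tenth * slope z w
  slope-lower {z} {w} l≤z l≤w = ℚ.≤-trans slope-at-lower
    (ℚ.*-monoˡ-≤-nonNeg tenth {{ℚ.nonNegative 0≤tenth}} (slope-mono {lower} {lower} 0≤lower 0≤lower l≤z l≤w))

  slope-upper : ∀ {z w} → 0ℚ ≤ z → 0ℚ ≤ w → z ≤ upper → w ≤ upper → tenth * slope z w ≤ 1ℚ
  slope-upper {z} {w} 0≤z 0≤w z≤u w≤u = ℚ.≤-trans
    (ℚ.*-monoˡ-≤-nonNeg tenth {{ℚ.nonNegative 0≤tenth}} (slope-mono 0≤z 0≤w z≤u w≤u)) slope-at-upper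

  0≤-p : ∀ {z} → Below z → 0ℚ ≤ - p z
  0≤-p b = ℚ.neg-antimono-≤ (Below.p≤0 b)

  ≤next : ∀ {z} → Below z → z ≤ next z
  ≤next {z} b = certify (0≤* 0≤tenth (0≤-p b))
    (solve 3 (λ t z p → t :* (:- p) := z :- t :* p :- z) refl tenth z (p z))

  module _ {z} (b : Below z) where
    open Below b

    private
      y = next z

      lower≤y : lower ≤ y
      lower≤y = ℚ.≤-trans lower≤ (≤next b)

      y≤upper : y ≤ upper
      y≤upper = ℚ.≤-trans (certify (0≤* 0≤tenth (0≤-p b))
        (solve 3 (λ t z p → t :* (:- p) := z :- (t :+ t) :* p :- (z :- t :* p)) refl tenth z (p z))) ≤upper

      z≤upper : z ≤ upper
      z≤upper = ℚ.≤-trans (≤next b) y≤upper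

      0≤z : 0ℚ ≤ z
      0≤z = ℚ.≤-trans 0≤lower lower≤

      -- A step multiplies `p` by `1ℚ - tenth * slope z y`. Since `tenth * slope z y` lies between ½
      -- and 1, the value at least halves in size and keeps its sign: the iteration never passes the
      -- root.
      p-next : p y ≡ p z * (1ℚ - tenth * slope z y)
      p-next = begin
        p y                                     ≡⟨ solve 2 (λ a b → b := a :- (a :- b)) refl (p z) (p y) ⟩
        p z - (p z - p y)                       ≡⟨ cong (λ d → p z - d) (p-difference z y) ⟩
        p z - (z - (z - tenth * p z)) * slope z y
          ≡⟨ solve 4 (λ t z p s → p :- (z :- (z :- t :* p)) :* s := p :* (con 1ℚ :- t :* s)) refl tenth z (p z) (slope z y) ⟩
        p z * (1ℚ - tenth * slope z y) ∎
        where open ≡-Reasoning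

    next-p : - p y ≤ ½ * - p z
    next-p = certify (0≤* (0≤-p b) (≤⇒0≤- (slope-lower lower≤ lower≤y)))
      (trans (solve 2 (λ p s → (:- p) :* (s :- con ½) := con ½ :* (:- p) :- :- (p :* (con 1ℚ :- s))) refl (p z) (tenth * slope z y))
        (cong (λ q → ½ * - p z - - q) (sym p-next)))

    bound : y - (tenth + tenth) * p y ≤ z - (tenth + tenth) * p z
    bound = certify (0≤* (0≤* 0≤tenth (from-yes (0ℚ ℚ.≤? 1ℚ + 1ℚ))) (≤⇒0≤- next-p))
      (solve 4 (λ t z p q → t :* con (1ℚ + 1ℚ) :* (con ½ :* (:- p) :- :- q)
        := z :- (t :+ t) :* p :- (z :- t :* p :- (t :+ t) :* q)) refl tenth z (p z) (p y))

    next-below : Below y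
    next-below = record
      { lower≤ = lower≤y
      ; p≤0    = certify (0≤* (0≤-p b) (≤⇒0≤- (slope-upper 0≤z (ℚ.≤-trans 0≤lower lower≤y) z≤upper y≤upper)))
          (trans (solve 2 (λ p s → (:- p) :* (con 1ℚ :- s) := con 0ℚ :- p :* (con 1ℚ :- s)) refl (p z) (tenth * slope z y))
            (cong (λ q → 0ℚ - q) (sym p-next)))
      ; ≤upper = ℚ.≤-trans bound ≤upper
      }

  lower-below : Below lower
  lower-below = record
    { lower≤ = ℚ.≤-refl
    ; p≤0    = p-lower≤0
    ; ≤upper = p-lower-upper
    }

  approximations : ℕ → Σ[ z ∈ ℚ ] Below z
  approximations zero    = lower , lower-below
  approximations (suc n) = next (proj₁ (approximations n)) , next-below (proj₂ (approximations n))

  z : ℕ → ℚ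
  z n = proj₁ (approximations n)

  z-below : ∀ n → Below (z n)
  z-below n = proj₂ (approximations n)

  lower≤z : ∀ n → lower ≤ z n
  lower≤z n = Below.lower≤ (z-below n)

  z≤upper : ∀ n → z n ≤ upper
  z≤upper n = ℚ.≤-trans (certify (0≤* (0≤+ 0≤tenth 0≤tenth) (0≤-p (z-below n))) (lemma tenth (z n) (p (z n))))
    (Below.≤upper (z-below n))
    where
    lemma : ∀ t z p → (t + t) * (- p) ≡ z - (t + t) * p - z
    lemma = solve 3 (λ t z p → (t :+ t) :* (:- p) := z :- (t :+ t) :* p :- z) refl

  0≤½^ : ∀ n → 0ℚ ≤ ½ ^ n
  0≤½^ n = proj₁ (^-mono 0≤½ ℚ.≤-refl n)

  ∣p∣≤ : ∀ n → ∣ p (z n) ∣ ≤ ½ ^ n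
  ∣p∣≤ n = subst (_≤ ½ ^ n) (trans (sym (ℚ.0≤p⇒∣p∣≡p (0≤-p (z-below n)))) (ℚ.∣-p∣≡∣p∣ (p (z n)))) (-p≤ n)
    where
    -p≤ : ∀ n → - p (z n) ≤ ½ ^ n
    -p≤ zero    = -p-lower≤1
    -p≤ (suc n) = ℚ.≤-trans (next-p (z-below n)) (ℚ.*-monoˡ-≤-nonNeg ½ (-p≤ n))

  z-mono : ∀ n k → z n ≤ z (k ℕ.+ n)
  z-mono n zero    = ℚ.≤-refl
  z-mono n (suc k) = ℚ.≤-trans (z-mono n k) (≤next (z-below (k ℕ.+ n)))

  z-bounded : ∀ n k → z (k ℕ.+ n) - (tenth + tenth) * p (z (k ℕ.+ n)) ≤ z n - (tenth + tenth) * p (z n)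
  z-bounded n zero    = ℚ.≤-refl
  z-bounded n (suc k) = ℚ.≤-trans (bound (z-below (k ℕ.+ n))) (z-bounded n k)

  z≤z+½^ : ∀ n k → z (k ℕ.+ n) ≤ z n + ½ ^ n
  z≤z+½^ n k = ℚ.≤-trans (certify (0≤* (0≤+ 0≤tenth 0≤tenth) (0≤-p (z-below (k ℕ.+ n))))
      (solve 3 (λ t z p → (t :+ t) :* (:- p) := z :- (t :+ t) :* p :- z) refl tenth (z (k ℕ.+ n)) (p (z (k ℕ.+ n)))))
    (ℚ.≤-trans (z-bounded n k) (ℚ.+-monoʳ-≤ (z n) (ℚ.≤-trans step (∣p∣≤ n))))
    where
    step : - ((tenth + tenth) * p (z n)) ≤ ∣ p (z n) ∣
    step = subst (- ((tenth + tenth) * p (z n)) ≤_)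
      (trans (sym (ℚ.0≤p⇒∣p∣≡p (0≤-p (z-below n)))) (ℚ.∣-p∣≡∣p∣ (p (z n))))
      (certify (0≤* 2tenth≤1 (0≤-p (z-below n)))
        (solve 2 (λ t p → (con 1ℚ :- (t :+ t)) :* (:- p) := (:- p) :- :- ((t :+ t) :* p)) refl tenth (p (z n))))

  ∣z-z∣≤ : ∀ n k l → z (k ℕ.+ n) - z (l ℕ.+ n) ≤ ½ ^ n
  ∣z-z∣≤ n k l = certify (0≤+ (≤⇒0≤- (z≤z+½^ n k)) (≤⇒0≤- (z-mono n l)))
    (lemma (z (k ℕ.+ n)) (z (l ℕ.+ n)) (z n) (½ ^ n))
    where
    lemma : ∀ a b c h → (c + h - a) + (b - c) ≡ h - (a - b)
    lemma = solve 4 (λ a b c h → (c :+ h :- a) :+ (b :- c) := h :- (a :- b)) refl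

  z-cauchy : IsCauchy z
  z-cauchy ε 0<ε with *½^-small 1ℚ (ℚ.<⇒≤ 0<1) ε 0<ε
  ... | N , small = N , λ m n N≤m N≤n → within m n (≤⇒+ N≤m) (≤⇒+ N≤n)
    where
    ≤⇒+ : ∀ {m n} → m ℕ.≤ n → ∃[ k ] n ≡ k ℕ.+ m
    ≤⇒+ {m} m≤n with ℕ.m≤n⇒∃[o]m+o≡n m≤n
    ... | o , refl = o , ℕ.+-comm m o
    ½^N≤ε : ½ ^ N ≤ ε
    ½^N≤ε = subst (_≤ ε) (ℚ.*-identityˡ (½ ^ N)) (small N ℕ.≤-refl)
    swap : ∀ a b → b - a ≡ - (a - b)
    swap = solve 2 (λ a b → b :- a := :- (a :- b)) refl
    within : ∀ m n → ∃[ k ] m ≡ k ℕ.+ N → ∃[ l ] n ≡ l ℕ.+ N → ∣ z m - z n ∣ ≤ ε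
    within _ _ (k , refl) (l , refl) = ℚ.≤-trans (∣∣≤ (∣z-z∣≤ N k l)
      (subst (_≤ ½ ^ N) (swap (z (k ℕ.+ N)) (z (l ℕ.+ N))) (∣z-z∣≤ N l k))) ½^N≤ε

  ζ : ℝ
  ζ = z ,ᴿ z-cauchy

-- The deviation from the leading term and its defect.

module Deviation where
  open import Data.Rational using (_+_; _*_; _-_; -_; _/_)
  open +-*-Solver
  open RationalOrder
  open Root
  open Enumeration using (count; count-recurrence)

  C : ℕ → ℚ
  C n = + count n / 1

  C-recurrence : ∀ n → C (3 ℕ.+ n) ≡ + 6 / 1 * C (2 ℕ.+ n) - + 8 / 1 * C (1 ℕ.+ n) + C n
  C-recurrence n = trans (move (C (3 ℕ.+ n)) (+ 8 / 1 * C (1 ℕ.+ n)))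
    (trans (cong (_- + 8 / 1 * C (1 ℕ.+ n)) shifted) (reorder (+ 6 / 1 * C (2 ℕ.+ n)) (C n) (+ 8 / 1 * C (1 ℕ.+ n))))
    where
    embed : ∀ a b k → + (a ℕ.+ k ℕ.* b) / 1 ≡ + a / 1 + + k / 1 * (+ b / 1)
    embed a b k = trans (/1-homo-+ (+ a) (+ (k ℕ.* b)))
      (cong (λ w → + a / 1 + w) (trans (cong (_/ 1) (ℤ.pos-* k b)) (/1-homo-* (+ k) (+ b))))
    shifted : C (3 ℕ.+ n) + + 8 / 1 * C (1 ℕ.+ n) ≡ + 6 / 1 * C (2 ℕ.+ n) + C n
    shifted = trans (sym (embed (count (3 ℕ.+ n)) (count (1 ℕ.+ n)) 8))
      (trans (cong (λ m → + m / 1) (trans (count-recurrence n) (ℕ.+-comm (6 ℕ.* count (2 ℕ.+ n)) (count n))))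
        (trans (embed (count n) (count (2 ℕ.+ n)) 6) (ℚ.+-comm (C n) (+ 6 / 1 * C (2 ℕ.+ n)))))
    move : ∀ a b → a ≡ a + b - b
    move = solve 2 (λ a b → a := a :+ b :- b) refl
    reorder : ∀ a b c → a + b - c ≡ a - c + b
    reorder = solve 3 (λ a b c → a :+ b :- c := a :- c :+ b) refl

  -- The deviation from κ λⁿ, with λ replaced by z + 2 for an arbitrary rational z.
  e : ℚ → ℕ → ℚ
  e z n = C n - k z * (z + two) ^ n

  -- At the root the deviation would satisfy the recurrence whose characteristic
  -- polynomial (x³ - 6x² + 8x - 1) / (x - λ) has roots below 2; d is the defect of that recurrence.
  d : ℚ → ℕ → ℚ
  d z n = e z (2 ℕ.+ n) + (z - four) * e z (1 ℕ.+ n) + z * (z - two) * e z n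

  -- At n = 0 the defect is h minus `k` times the derivative of `p`; `k` was chosen to make this
  -- vanish at the root.
  d-zero : ∀ z → d z 0 ≡ p z * (w₀ - w₁ * z)
  d-zero z = trans (cong (λ c₂ → c₂ - k z * ((z + two) * ((z + two) * 1ℚ)) + (z - four) * e z 1 + z * (z - two) * e z 0) C₂)
    (trans (lemma z two four (k z)) (k-defining z))
    where
    abstract
      C₂ : C 2 ≡ 1ℚ + two
      C₂ = trans (from-yes (C 2 ℚ.≟ 1ℚ + (1ℚ + 1ℚ))) (cong (λ t → 1ℚ + t) (sym two≡))
    lemma : ∀ z t f k → 1ℚ + t - k * ((z + t) * ((z + t) * 1ℚ)) + (z - f) * (1ℚ - k * ((z + t) * 1ℚ)) + z * (z - t) * (1ℚ - k * 1ℚ)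
      ≡ (1ℚ + t + (z - f) + z * (z - t)) - k * ((z + t) * (z + t) + (z - f) * (z + t) + z * (z - t))
    lemma = solve 4 (λ z t f k → con 1ℚ :+ t :- k :* ((z :+ t) :* ((z :+ t) :* con 1ℚ)) :+ (z :- f) :* (con 1ℚ :- k :* ((z :+ t) :* con 1ℚ)) :+ z :* (z :- t) :* (con 1ℚ :- k :* con 1ℚ)
      := (con 1ℚ :+ t :+ (z :- f) :+ z :* (z :- t)) :- k :* ((z :+ t) :* (z :+ t) :+ (z :- f) :* (z :+ t) :+ z :* (z :- t))) refl

  DefectStep : (two four z c₀ c₁ c₂ k q : ℚ) → Set
  DefectStep two four z c₀ c₁ c₂ k q =
    (+ 6 / 1 * c₂ - + 8 / 1 * c₁ + c₀) - k * (x * (x * (x * q))) + (z - four) * (c₂ - k * (x * (x * q))) + z * (z - two) * (c₁ - k * (x * q))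
    ≡ x * ((c₂ - k * (x * (x * q))) + (z - four) * (c₁ - k * (x * q)) + z * (z - two) * (c₀ - k * q)) - (z * z * z - four * z - 1ℚ) * c₀
    where x = z + two

  defect-step : ∀ z c₀ c₁ c₂ k q → DefectStep (1ℚ + 1ℚ) (1ℚ + 1ℚ + (1ℚ + 1ℚ)) z c₀ c₁ c₂ k q
  defect-step = solve 6 (λ z c₀ c₁ c₂ k q →
    let x = z :+ con 2ℚ in
    (con (+ 6 / 1) :* c₂ :- con (+ 8 / 1) :* c₁ :+ c₀) :- k :* (x :* (x :* (x :* q))) :+ (z :- con 4ℚ) :* (c₂ :- k :* (x :* (x :* q))) :+ z :* (z :- con 2ℚ) :* (c₁ :- k :* (x :* q))
    := x :* ((c₂ :- k :* (x :* (x :* q))) :+ (z :- con 4ℚ) :* (c₁ :- k :* (x :* q)) :+ z :* (z :- con 2ℚ) :* (c₀ :- k :* q)) :- (z :* z :* z :- con 4ℚ :* z :- con 1ℚ) :* c₀) refl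
    where
    2ℚ 4ℚ : ℚ
    2ℚ = 1ℚ + 1ℚ
    4ℚ = 1ℚ + 1ℚ + (1ℚ + 1ℚ)

  -- In terms of the shift x, (x² + (z - 4) x + z (z - 2)) (x - (z + 2)) equals x³ - 6x² + 8x - 1
  -- minus `p z`. The factor x - (z + 2) annihilates the powers of z + 2, and the cubic annihilates
  -- the counts, so only `- p z * C n` remains.
  d-suc : ∀ z n → d z (suc n) ≡ (z + two) * d z n - p z * C n
  d-suc z n = trans (cong (λ c₃ → c₃ - k z * (x * (x * (x * x ^ n))) + (z - four) * e z (2 ℕ.+ n) + z * (z - two) * e z (1 ℕ.+ n)) (C-recurrence n))
    (subst₂ (λ a b → DefectStep a b z (C n) (C (1 ℕ.+ n)) (C (2 ℕ.+ n)) (k z) ((z + two) ^ n))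
      (sym two≡) (sym (trans four≡ (cong₂ _+_ two≡ two≡)))
      (defect-step z (C n) (C (1 ℕ.+ n)) (C (2 ℕ.+ n)) (k z) ((z + two) ^ n)))
    where
    x = z + two

-- Bounds on the deviation.

module Convergence where
  open import Data.Rational using (_+_; _*_; _-_; -_; _≤_; _/_)
  open +-*-Solver
  open RationalOrder
  open Root
  open Deviation
  open Enumeration using (count)

  module _ {z : ℚ} (l≤z : lower ≤ z) (z≤u : z ≤ upper) where

    private
      0≤z : 0ℚ ≤ z
      0≤z = ℚ.≤-trans 0≤lower l≤z

    0≤z-two : 0ℚ ≤ z - two
    0≤z-two = ≤⇒0≤- (ℚ.≤-trans two≤lower l≤z)

    0≤four-z : 0ℚ ≤ four - z
    0≤four-z = ≤⇒0≤- (ℚ.≤-trans z≤u upper≤four)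

    lower≤z+two : lower + two ≤ z + two
    lower≤z+two = ℚ.+-monoˡ-≤ two l≤z

    z+two≤5 : z + two ≤ + 5 / 1
    z+two≤5 = ℚ.≤-trans (ℚ.+-monoˡ-≤ two z≤u) upper+two≤5

    0≤z+two : 0ℚ ≤ z + two
    0≤z+two = ℚ.≤-trans (ℚ.<⇒≤ 0<lower+two) lower≤z+two

    four-z≤ : four - z ≤ four - lower
    four-z≤ = ℚ.+-monoʳ-≤ four (ℚ.neg-antimono-≤ l≤z)

    z[z-two]≤ : z * (z - two) ≤ upper * (upper - two)
    z[z-two]≤ = *-mono-≤ 0≤z-two 0≤upper z≤u (ℚ.+-monoˡ-≤ (- two) z≤u)

    k≥ : + 144176 / 1000000 ≤ k z
    k≥ = ℚ.≤-trans k-at-lower (ℚ.+-mono-≤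
      (ℚ.*-monoˡ-≤-nonNeg k₂ {{ℚ.nonNegative 0≤k₂}} (*-mono-≤ 0≤lower 0≤z l≤z l≤z))
      (ℚ.+-monoʳ-≤ k₀ (ℚ.neg-antimono-≤ (ℚ.*-monoˡ-≤-nonNeg k₁ {{ℚ.nonNegative 0≤k₁}} z≤u))))

    k≤ : k z + k-margin ≤ + 144177 / 1000000
    k≤ = ℚ.≤-trans (ℚ.+-monoˡ-≤ k-margin (ℚ.+-mono-≤
      (ℚ.*-monoˡ-≤-nonNeg k₂ {{ℚ.nonNegative 0≤k₂}} (*-mono-≤ 0≤z 0≤upper z≤u z≤u))
      (ℚ.+-monoʳ-≤ k₀ (ℚ.neg-antimono-≤ (ℚ.*-monoˡ-≤-nonNeg k₁ {{ℚ.nonNegative 0≤k₁}} l≤z))))) k-at-upper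

    tenth≤k : tenth ≤ k z
    tenth≤k = ℚ.≤-trans tenth<k k≥

    0≤k : 0ℚ ≤ k z
    0≤k = ℚ.≤-trans 0≤tenth tenth≤k

    k≤2tenth : k z ≤ tenth + tenth
    k≤2tenth = ℚ.≤-trans (subst (_≤ k z + k-margin) (ℚ.+-identityʳ (k z)) (ℚ.+-monoʳ-≤ (k z) (ℚ.<⇒≤ 0<k-margin)))
      (ℚ.≤-trans k≤ k≤1/5)

    private
      ∣1-q∣≤1 : ∀ {q} → 0ℚ ≤ q → q ≤ 1ℚ → ∣ 1ℚ - q ∣ ≤ 1ℚ
      ∣1-q∣≤1 {q} 0≤q q≤1 = ∣∣≤ (certify 0≤q (lemma₁ q)) (certify (0≤+ (≤⇒0≤- q≤1) (ℚ.<⇒≤ 0<1)) (lemma₂ q))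
        where
        lemma₁ : ∀ q → q ≡ 1ℚ - (1ℚ - q)
        lemma₁ = solve 1 (λ q → q := con 1ℚ :- (con 1ℚ :- q)) refl
        lemma₂ : ∀ q → 1ℚ - q + 1ℚ ≡ 1ℚ - - (1ℚ - q)
        lemma₂ = solve 1 (λ q → con 1ℚ :- q :+ con 1ℚ := con 1ℚ :- :- (con 1ℚ :- q)) refl

      k[z+two]≤1 : k z * ((z + two) * 1ℚ) ≤ 1ℚ
      k[z+two]≤1 = ℚ.≤-trans (*-mono-≤ (subst (0ℚ ≤_) (sym (ℚ.*-identityʳ (z + two))) 0≤z+two)
        (0≤+ 0≤tenth 0≤tenth) k≤2tenth (subst (_≤ + 5 / 1) (sym (ℚ.*-identityʳ (z + two))) z+two≤5)) fifth≤1

      k≤1 : k z * 1ℚ ≤ 1ℚ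
      k≤1 = subst (_≤ 1ℚ) (sym (ℚ.*-identityʳ (k z)))
        (ℚ.≤-trans k≤2tenth (certify 2tenth≤1 refl))

    e-zero : ∣ e z 0 ∣ ≤ 1ℚ
    e-zero = ∣1-q∣≤1 (subst (0ℚ ≤_) (sym (ℚ.*-identityʳ (k z))) 0≤k) k≤1

    e-one : ∣ e z 1 ∣ ≤ 1ℚ
    e-one = ∣1-q∣≤1 (0≤* 0≤k (subst (0ℚ ≤_) (sym (ℚ.*-identityʳ (z + two))) 0≤z+two)) k[z+two]≤1

    ∣w∣≤1 : ∣ w₀ - w₁ * z ∣ ≤ 1ℚ
    ∣w∣≤1 = ∣∣≤
      (ℚ.≤-trans (ℚ.+-monoʳ-≤ w₀ (ℚ.neg-antimono-≤ (ℚ.*-monoˡ-≤-nonNeg w₁ {{ℚ.nonNegative 0≤w₁}} l≤z))) w-at-lower)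
      (ℚ.neg-antimono-≤ (ℚ.≤-trans w-at-upper
        (ℚ.+-monoʳ-≤ w₀ (ℚ.neg-antimono-≤ (ℚ.*-monoˡ-≤-nonNeg w₁ {{ℚ.nonNegative 0≤w₁}} z≤u)))))

    -- The new deviation is (4 - z) e₁ - z (z - 2) e₀ + d. The triangle inequality forgets the minus
    -- sign, so `τ` must exceed the positive root of x² - (4 - z) x - z (z - 2), about 2.006; the
    -- slack in `τ-recurrence` pays for d.
    e-step : ∀ n {t} → 0ℚ ≤ t → ∣ e z n ∣ ≤ t → ∣ e z (suc n) ∣ ≤ τ * t → ∣ d z n ∣ ≤ tenth * (1ℚ - tenth) * t →
             ∣ e z (2 ℕ.+ n) ∣ ≤ τ * (τ * t)
    e-step n {t} 0≤t e₀≤ e₁≤ d≤ = begin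
      ∣ e z (2 ℕ.+ n) ∣
        ≡⟨ cong ∣_∣ (lemma (e z (2 ℕ.+ n)) (e z (1 ℕ.+ n)) (e z n) four z (z * (z - two))) ⟩
      ∣ (four - z) * e z (1 ℕ.+ n) + (- (z * (z - two)) * e z n + d z n) ∣
        ≤⟨ ℚ.≤-trans (ℚ.∣p+q∣≤∣p∣+∣q∣ ((four - z) * e z (1 ℕ.+ n)) (- (z * (z - two)) * e z n + d z n))
             (ℚ.+-monoʳ-≤ ∣ (four - z) * e z (1 ℕ.+ n) ∣ (ℚ.∣p+q∣≤∣p∣+∣q∣ (- (z * (z - two)) * e z n) (d z n))) ⟩
      ∣ (four - z) * e z (1 ℕ.+ n) ∣ + (∣ - (z * (z - two)) * e z n ∣ + ∣ d z n ∣)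
        ≤⟨ ℚ.+-mono-≤ first (ℚ.+-mono-≤ second d≤) ⟩
      (four - lower) * (τ * t) + (upper * (upper - two) * t + tenth * (1ℚ - tenth) * t)
        ≡⟨ lemma′ (four - lower) τ t (upper * (upper - two)) (tenth * (1ℚ - tenth)) ⟩
      ((four - lower) * τ + upper * (upper - two) + tenth * (1ℚ - tenth)) * t
        ≤⟨ ℚ.*-monoʳ-≤-nonNeg t {{ℚ.nonNegative 0≤t}} τ-recurrence ⟩
      τ * τ * t
        ≡⟨ ℚ.*-assoc τ τ t ⟩
      τ * (τ * t) ∎
      where
      open ℚ.≤-Reasoning
      lemma : ∀ a b c f z s → a ≡ (f - z) * b + (- s * c + (a + (z - f) * b + s * c))
      lemma = solve 6 (λ a b c f z s → a := (f :- z) :* b :+ (:- s :* c :+ (a :+ (z :- f) :* b :+ s :* c))) refl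
      lemma′ : ∀ a t s b g → a * (t * s) + (b * s + g * s) ≡ (a * t + b + g) * s
      lemma′ = solve 5 (λ a t s b g → a :* (t :* s) :+ (b :* s :+ g :* s) := (a :* t :+ b :+ g) :* s) refl
      first : ∣ (four - z) * e z (1 ℕ.+ n) ∣ ≤ (four - lower) * (τ * t)
      first = subst (_≤ (four - lower) * (τ * t))
        (sym (trans (ℚ.∣p*q∣≡∣p∣*∣q∣ (four - z) (e z (1 ℕ.+ n))) (cong (_* ∣ e z (1 ℕ.+ n) ∣) (ℚ.0≤p⇒∣p∣≡p 0≤four-z))))
        (*-mono-≤ (ℚ.0≤∣p∣ (e z (1 ℕ.+ n))) (ℚ.≤-trans 0≤four-z four-z≤) four-z≤ e₁≤)
      second : ∣ - (z * (z - two)) * e z n ∣ ≤ upper * (upper - two) * t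
      second = subst (_≤ upper * (upper - two) * t)
        (sym (trans (ℚ.∣p*q∣≡∣p∣*∣q∣ (- (z * (z - two))) (e z n)) (cong (_* ∣ e z n ∣)
          (trans (ℚ.∣-p∣≡∣p∣ (z * (z - two))) (ℚ.0≤p⇒∣p∣≡p (0≤* 0≤z 0≤z-two))))))
        (*-mono-≤ (ℚ.0≤∣p∣ (e z n)) (ℚ.≤-trans (0≤* 0≤z 0≤z-two) z[z-two]≤) z[z-two]≤ e₀≤)

  -- Majorant for the recursion of the defect: 5 bounds z + 2, and the common factor `½ ^ j`, which
  -- bounds `p (z j)`, is taken out.
  D : ℕ → ℚ
  D zero    = 1ℚ
  D (suc n) = + 5 / 1 * D n + C n

  0≤D : ∀ n → 0ℚ ≤ D n
  0≤D zero    = ℚ.<⇒≤ 0<1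
  0≤D (suc n) = 0≤+ (0≤* (0≤ℕ⇒ℚ 5) (0≤D n)) (0≤ℕ⇒ℚ (count n))

  ∣d∣≤ : ∀ n j → ∣ d (z j) n ∣ ≤ D n * ½ ^ j
  ∣d∣≤ zero j = begin
    ∣ d (z j) 0 ∣                                ≡⟨ cong ∣_∣ (d-zero (z j)) ⟩
    ∣ p (z j) * (w₀ - w₁ * z j) ∣                ≡⟨ ℚ.∣p*q∣≡∣p∣*∣q∣ (p (z j)) (w₀ - w₁ * z j) ⟩
    ∣ p (z j) ∣ * ∣ w₀ - w₁ * z j ∣              ≤⟨ *-mono-≤ (ℚ.0≤∣p∣ (w₀ - w₁ * z j)) (0≤½^ j) (∣p∣≤ j) (∣w∣≤1 (lower≤z j) (z≤upper j)) ⟩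
    ½ ^ j * 1ℚ                                   ≡⟨ ℚ.*-comm (½ ^ j) 1ℚ ⟩
    1ℚ * ½ ^ j ∎
    where open ℚ.≤-Reasoning
  ∣d∣≤ (suc n) j = begin
    ∣ d (z j) (suc n) ∣                          ≡⟨ cong ∣_∣ (d-suc (z j) n) ⟩
    ∣ x * d (z j) n - p (z j) * C n ∣            ≤⟨ ℚ.∣p+q∣≤∣p∣+∣q∣ (x * d (z j) n) (- (p (z j) * C n)) ⟩
    ∣ x * d (z j) n ∣ + ∣ - (p (z j) * C n) ∣    ≤⟨ ℚ.+-mono-≤ first second ⟩
    + 5 / 1 * (D n * ½ ^ j) + ½ ^ j * C n        ≡⟨ lemma (+ 5 / 1) (D n) (½ ^ j) (C n) ⟩
    (+ 5 / 1 * D n + C n) * ½ ^ j ∎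
    where
    open ℚ.≤-Reasoning
    x = z j + two
    lemma : ∀ f d h c → f * (d * h) + h * c ≡ (f * d + c) * h
    lemma = solve 4 (λ f d h c → f :* (d :* h) :+ h :* c := (f :* d :+ c) :* h) refl
    first : ∣ x * d (z j) n ∣ ≤ + 5 / 1 * (D n * ½ ^ j)
    first = subst (_≤ + 5 / 1 * (D n * ½ ^ j))
      (sym (trans (ℚ.∣p*q∣≡∣p∣*∣q∣ x (d (z j) n)) (cong (_* ∣ d (z j) n ∣) (ℚ.0≤p⇒∣p∣≡p (0≤z+two (lower≤z j) (z≤upper j))))))
      (*-mono-≤ (ℚ.0≤∣p∣ (d (z j) n)) (0≤ℕ⇒ℚ 5) (z+two≤5 (lower≤z j) (z≤upper j)) (∣d∣≤ n j))
    second : ∣ - (p (z j) * C n) ∣ ≤ ½ ^ j * C n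
    second = subst (_≤ ½ ^ j * C n)
      (sym (trans (ℚ.∣-p∣≡∣p∣ (p (z j) * C n)) (trans (ℚ.∣p*q∣≡∣p∣*∣q∣ (p (z j)) (C n))
        (cong (∣ p (z j) ∣ *_) (ℚ.0≤p⇒∣p∣≡p (0≤ℕ⇒ℚ (count n)))))))
      (ℚ.*-monoʳ-≤-nonNeg (C n) {{ℚ.nonNegative (0≤ℕ⇒ℚ (count n))}} (∣p∣≤ j))

  Eventually : (ℕ → Set) → Set
  Eventually Q = ∃[ J ] (∀ j → J ℕ.≤ j → Q j)

  eventually-× : ∀ {Q R} → Eventually Q → Eventually R → Eventually (λ j → Q j × R j)
  eventually-× (J , q) (K , r) = J ℕ.⊔ K , λ j le → q j (ℕ.m⊔n≤o⇒m≤o J K le) , r j (ℕ.m⊔n≤o⇒n≤o J K le)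

  eventually-map : ∀ {Q R} → (∀ j → Q j → R j) → Eventually Q → Eventually R
  eventually-map f (J , q) = J , λ j le → f j (q j le)

  0≤τ^ : ∀ n → 0ℚ ≤ τ ^ n
  0≤τ^ n = ℚ.<⇒≤ (0<^ 0<τ n)

  abstract
    -- Two consecutive deviations are carried along, as the recurrence has order two. The threshold
    -- for j depends on n, because `D n` outgrows `τ ^ n` and must be offset by `½ ^ j`.
    e-small : ∀ n → Eventually (λ j → ∣ e (z j) n ∣ ≤ τ ^ n × ∣ e (z j) (suc n) ∣ ≤ τ ^ suc n)
    e-small zero = 0 , λ j _ → e-zero (lower≤z j) (z≤upper j) ,
      subst (∣ e (z j) 1 ∣ ≤_) (sym (ℚ.*-identityʳ τ)) (ℚ.≤-trans (e-one (lower≤z j) (z≤upper j)) 1≤τ)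
    e-small (suc n) = eventually-map
      (λ j ((e₀≤ , e₁≤) , d≤) → e₁≤ , e-step (lower≤z j) (z≤upper j) n (0≤τ^ n) e₀≤ e₁≤ (ℚ.≤-trans (∣d∣≤ n j) d≤))
      (eventually-× (e-small n)
        (*½^-small (D n) (0≤D n) (tenth * (1ℚ - tenth) * τ ^ n) (0<* 0<tenth[1-tenth] (0<^ 0<τ n))))

  term : ℕ → ℕ → ℚ
  term n j = k (z j) * (z j + two) ^ n

  0≤term : ∀ n j → 0ℚ ≤ term n j
  0≤term n j = 0≤* (0≤k (lower≤z j) (z≤upper j)) (proj₁ (^-mono (0≤z+two (lower≤z j) (z≤upper j)) ℚ.≤-refl n))

  -- `τ` is half of `τ₁`, which is at most z + 2, and `k` is at least a tenth. This turns the
  -- absolute bound `τ ^ n` into a relative error of at most 10 · ½ⁿ.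
  deviation-small : ∀ n → Eventually (λ j → ∣ C n - term n j ∣ ≤ (+ 10 / 1 * ½ ^ n) * term n j)
  deviation-small n = eventually-map (λ j (e≤ , _) → ℚ.≤-trans e≤ (bound′ j)) (e-small n)
    where
    open ℚ.≤-Reasoning
    bound′ : ∀ j → τ ^ n ≤ (+ 10 / 1 * ½ ^ n) * term n j
    bound′ j = begin
      τ ^ n                                    ≡⟨ cong (_^ n) τ≡½τ₁ ⟩
      (½ * τ₁) ^ n                             ≡⟨ ^-distrib-* ½ τ₁ n ⟩
      ½ ^ n * τ₁ ^ n                           ≤⟨ ℚ.*-monoˡ-≤-nonNeg (½ ^ n) {{ℚ.nonNegative (0≤½^ n)}}
                                                   (proj₂ (^-mono 0≤τ₁ (ℚ.≤-trans τ₁≤lower+two (lower≤z+two (lower≤z j) (z≤upper j))) n)) ⟩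
      ½ ^ n * x ^ n                            ≡⟨ tenth-inverse (½ ^ n * x ^ n) ⟩
      + 10 / 1 * (tenth * (½ ^ n * x ^ n))     ≡⟨ lemma (+ 10 / 1) tenth (½ ^ n) (x ^ n) ⟩
      (+ 10 / 1 * ½ ^ n) * (tenth * x ^ n)     ≤⟨ ℚ.*-monoˡ-≤-nonNeg (+ 10 / 1 * ½ ^ n) {{ℚ.nonNegative (0≤* (0≤ℕ⇒ℚ 10) (0≤½^ n))}}
                                                   (ℚ.*-monoʳ-≤-nonNeg (x ^ n) {{ℚ.nonNegative 0≤x^}} (tenth≤k (lower≤z j) (z≤upper j))) ⟩
      (+ 10 / 1 * ½ ^ n) * term n j ∎
      where
      x = z j + two
      0≤x^ = proj₁ (^-mono (0≤z+two (lower≤z j) (z≤upper j)) ℚ.≤-refl n)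
      lemma : ∀ a t h y → a * (t * (h * y)) ≡ (a * h) * (t * y)
      lemma = solve 4 (λ a t h y → a :* (t :* (h :* y)) := (a :* h) :* (t :* y)) refl

-- The real constants and the asymptotic equivalence.

module Limit where
  open import Data.Rational using (_+_; _*_; _-_; -_; _≤_; _<_; _/_)
  open +-*-Solver
  open RationalOrder
  open Root
  open Deviation
  open Convergence
  open Enumeration using (count)

  -- The bracketing copies the body of `k`, so that the j-th term of `κ` is `k (z j)` by computation
  -- and the rational bounds apply as they stand.
  κ ƛ : ℝ
  κ = fromℚ k₂ *ᴿ (ζ *ᴿ ζ) +ᴿ (fromℚ k₀ -ᴿ fromℚ k₁ *ᴿ ζ)
  ƛ = ζ +ᴿ fromℚ two

  0<κ : 0ᴿ <ᴿ κ
  0<κ = tenth , 0<tenth , 0 , λ j _ → subst (_≤ k (z j)) (sym (ℚ.+-identityˡ tenth)) (tenth≤k (lower≤z j) (z≤upper j))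

  0<ƛ : 0ᴿ <ᴿ ƛ
  0<ƛ = lower + two , 0<lower+two , 0 , λ j _ →
    subst (_≤ z j + two) (sym (ℚ.+-identityˡ (lower + two))) (lower≤z+two (lower≤z j) (z≤upper j))

  κ-lower : fromℚ (+ 144176 / 1000000) ≤ᴿ κ
  κ-lower ε 0<ε = 0 , λ j _ → ℚ.≤-trans (k≥ (lower≤z j) (z≤upper j))
    (subst (_≤ k (z j) + ε) (ℚ.+-identityʳ (k (z j))) (ℚ.+-monoʳ-≤ (k (z j)) (ℚ.<⇒≤ 0<ε)))

  κ-upper : κ <ᴿ fromℚ (+ 144177 / 1000000)
  κ-upper = k-margin , 0<k-margin , 0 , λ j _ → k≤ (lower≤z j) (z≤upper j)

  ƛ-lower : fromℚ (+ 4114907 / 1000000) ≤ᴿ ƛ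
  ƛ-lower ε 0<ε = 0 , λ j _ → ℚ.≤-trans λ-at-lower (ℚ.≤-trans (lower≤z+two (lower≤z j) (z≤upper j))
    (subst (_≤ z j + two + ε) (ℚ.+-identityʳ (z j + two)) (ℚ.+-monoʳ-≤ (z j + two) (ℚ.<⇒≤ 0<ε))))

  ƛ-upper : ƛ <ᴿ fromℚ (+ 4114908 / 1000000)
  ƛ-upper = k-margin , 0<k-margin , 0 , λ j _ →
    ℚ.≤-trans (ℚ.+-monoˡ-≤ k-margin (ℚ.+-monoˡ-≤ two (z≤upper j))) λ-at-upper

  seq-^ : ∀ x n j → seq (x ^ᴿ n) j ≡ seq x j ^ n
  seq-^ x zero    j = refl
  seq-^ x (suc n) j = cong (seq x j *_) (seq-^ x n j)

  -- Only for late terms, because `reciprocal` replaces a term below `ε` by `ε`.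
  reciprocal-inverse : ∀ y (0<y : 0ᴿ <ᴿ y) → Eventually (λ j → seq y j * seq (reciprocal y 0<y) j ≡ 1ℚ)
  reciprocal-inverse y (ε , 0<ε , N , ε≤y) = N , λ j N≤j →
    trans (cong (_* seq (reciprocal y (ε , 0<ε , N , ε≤y)) j)
            (sym (ℚ.p≤q⇒p⊔q≡q (subst (_≤ seq y j) (ℚ.+-identityˡ ε) (ε≤y j N≤j)))))
      (ℚ.*-inverseʳ (ε ⊔ seq y j) {{ℚ.pos⇒nonZero (ε ⊔ seq y j) {{ℚ.positive (ℚ.<-≤-trans 0<ε (ℚ.p≤p⊔q ε (seq y j)))}}}})

  -- The inverse `i` is given only by its equation; writing 1 as `y * i` factors it out of the
  -- difference.
  relative-error : ∀ {c y i b} → 0ℚ ≤ y → y * i ≡ 1ℚ → ∣ c - y ∣ ≤ b * y → ∣ c * i - 1ℚ ∣ ≤ b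
  relative-error {c} {y} {i} {b} 0≤y yi≡1 dev = begin
    ∣ c * i - 1ℚ ∣          ≡⟨ cong (λ o → ∣ c * i - o ∣) (sym yi≡1) ⟩
    ∣ c * i - y * i ∣       ≡⟨ cong ∣_∣ (lemma c y i) ⟩
    ∣ (c - y) * i ∣         ≡⟨ ℚ.∣p*q∣≡∣p∣*∣q∣ (c - y) i ⟩
    ∣ c - y ∣ * ∣ i ∣       ≤⟨ ℚ.*-monoʳ-≤-nonNeg ∣ i ∣ {{ℚ.nonNegative (ℚ.0≤∣p∣ i)}} dev ⟩
    b * y * ∣ i ∣           ≡⟨ ℚ.*-assoc b y ∣ i ∣ ⟩
    b * (y * ∣ i ∣)         ≡⟨ cong (λ w → b * (w * ∣ i ∣)) (sym (ℚ.0≤p⇒∣p∣≡p 0≤y)) ⟩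
    b * (∣ y ∣ * ∣ i ∣)     ≡⟨ cong (b *_) (trans (sym (ℚ.∣p*q∣≡∣p∣*∣q∣ y i)) (cong ∣_∣ yi≡1)) ⟩
    b * 1ℚ                  ≡⟨ ℚ.*-identityʳ b ⟩
    b ∎
    where
    open ℚ.≤-Reasoning
    lemma : ∀ c y i → c * i - y * i ≡ (c - y) * i
    lemma = solve 3 (λ c y i → c :* i :- y :* i := (c :- y) :* i) refl

  ½+½ : ∀ q → ½ * q + ½ * q ≡ q
  ½+½ = solve 1 (λ q → con ½ :* q :+ con ½ :* q := q) refl

  target : ℕ → ℝ
  target n = κ *ᴿ ƛ ^ᴿ n

  0<target : ∀ n → 0ᴿ <ᴿ target n
  0<target n = *ᴿ-pos {κ} {ƛ ^ᴿ n} 0<κ (^ᴿ-pos {ƛ} 0<ƛ n)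

  seq-target : ∀ n j → seq (target n) j ≡ term n j
  seq-target n j = cong (k (z j) *_) (seq-^ ƛ n j)

  quotient-close : ∀ n → Eventually (λ j → ∣ C n * seq (reciprocal (target n) (0<target n)) j - 1ℚ ∣ ≤ + 10 / 1 * ½ ^ n)
  quotient-close n = eventually-map
    (λ j (dev , inv) → relative-error {C n} {term n j} (0≤term n j)
      (trans (cong (_* seq (reciprocal (target n) (0<target n)) j) (sym (seq-target n j))) inv) dev)
    (eventually-× (deviation-small n) (reciprocal-inverse (target n) (0<target n)))

  0<½ : 0ℚ < ½
  0<½ = from-yes (0ℚ ℚ.<? ½)

  asymptotic : AsymptoticTo (λ n → fromℕ (count n)) target 0<target
  -- One half of `δ` absorbs the relative error, the other half is the margin demanded by `_<ᴿ_`.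
  asymptotic ε (δ , 0<δ , K , δ≤ε) = N , λ n N≤n → ½ * δ , 0<½δ , eventually-map
      (λ j (close , δ≤) → ℚ.≤-trans (ℚ.+-monoˡ-≤ (½ * δ) (ℚ.≤-trans close (small n N≤n)))
        (subst (_≤ seq ε j) (trans (ℚ.+-identityˡ δ) (sym (½+½ δ))) δ≤))
      (eventually-× (quotient-close n) (K , δ≤ε))
    where
    0<½δ : 0ℚ < ½ * δ
    0<½δ = 0<* 0<½ 0<δ
    N : ℕ
    N = proj₁ (*½^-small (+ 10 / 1) (0≤ℕ⇒ℚ 10) (½ * δ) 0<½δ)
    small : ∀ n → N ℕ.≤ n → + 10 / 1 * ½ ^ n ≤ ½ * δ
    small = proj₂ (*½^-small (+ 10 / 1) (0≤ℕ⇒ℚ 10) (½ * δ) 0<½δ)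

open import Data.Nat using (_≤_)
open import Data.Rational using (_/_)

corollary2 : Σ[ c ∈ (ℕ → ℕ) ]
    ((∀ n → 1 ≤ n → HasCardinality (cheesySetoid 1 n) (c n)) ×
    (Σ[ κ ∈ ℝ ] Σ[ ƛ ∈ ℝ ] Σ[ 0<κ ∈ 0ᴿ <ᴿ κ ] Σ[ 0<ƛ ∈ 0ᴿ <ᴿ ƛ ]
    (fromℚ (+ 144176 / 1000000) ≤ᴿ κ × κ <ᴿ fromℚ (+ 144177 / 1000000)) ×
    (fromℚ (+ 4114907 / 1000000) ≤ᴿ ƛ × ƛ <ᴿ fromℚ (+ 4114908 / 1000000)) ×
    AsymptoticTo (λ n → fromℕ (c n)) (λ n → κ *ᴿ ƛ ^ᴿ n) (λ n → *ᴿ-pos {κ} {ƛ ^ᴿ n} 0<κ (^ᴿ-pos {ƛ} 0<ƛ n))))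
corollary2 = Enumeration.count , Cardinality.hasCardinality ,
  κ , ƛ , 0<κ , 0<ƛ , (κ-lower , κ-upper) , (ƛ-lower , ƛ-upper) , asymptotic
  where open Limit
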